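{- For metric uniform MLUFL and any $\alpha,\beta\in(0,1)$, one can obtain (in polynomial time) a solution of cost at most $$\max\left\{\frac{\ln(1/\beta)}{1-\beta},\ \frac{3}{1-\beta}+\frac{2}{1-\alpha},\ \frac{4}{\alpha}\left\lceil\frac1\alpha\right\rceil\right\}\cdot\mathrm{OPT},$$ where $\mathrm{OPT}$ is the optimal value of the linear program (Unif-P) of the context. Thus, taking $\alpha=0.7426$, $\beta=0.000021$, one obtains a $10.773$-approximation algorithm for metric uniform MLUFL.
   Context: Uniform MLUFL: we are given a set $\mathcal F$ of $n$ facilities with opening costs $f_i\ge 0$, a set $\mathcal D$ of clients, connection costs $c_{ij}\ge0$ ($i\in\mathcal F$, $j\in\mathcal D$), and a root $r$, with the uniform time metric $d_{uv}=1$ for all distinct $u,v\in\mathcal F\cup\{r\}$. A solution opens a set $F\subseteq\mathcal F$, orders $F$ (a path from $r$ through $F$), and assigns each client $j$ to some $\phi(j)\in F$; its cost is $\sum_{i\in F}f_i+\sum_j\bigl(c_{\phi(j)j}+\pi(\phi(j))\bigr)$, where $\pi(i)\in\{1,2,\dots\}$ is the position of $i$ in the ordering. It is called metric uniform MLUFL when the connection costs come from a metric $c$ on $\mathcal F\cup\mathcal D$. (Unif-P) is the linear program, with $t$ ranging over $\{1,\dots,n\}$: minimize $\sum_{i,t}f_iy_{i,t}+\sum_{j,i,t}(c_{ij}+t)x_{ij,t}$ subject to $\sum_{i,t}x_{ij,t}\ge1$ for all $j$; $x_{ij,t}\le y_{i,t}$ for all $i,j,t$; $\sum_iy_{i,t}\le1$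 for all $t$; $x_{ij,t},y_{i,t}\ge0$ for all $i,j,t$.
   Formalization: The opening costs and connection costs (and the metric and the linear program's solutions and optimal value) are rational numbers rather than real numbers; α and β remain arbitrary reals in (0,1). -}

module Defs where

open import Data.Nat as ℕ using (ℕ; zero; suc)
import Data.Nat.Binary.Base as Bin
open Bin using (ℕᵇ; 2[1+_]; 1+[2_])
open import Data.Integer as ℤ using (ℤ; +_; -[1+_])
open import Data.Rational as ℚ using (ℚ; 0ℚ; 1ℚ; ½; ↥_; ↧ₙ_; ≢-nonZero)
import Data.Rational.Properties as ℚP
open import Algebra.Properties.CommutativeMonoid.Sum ℚP.+-0-commutativeMonoid using (sum)
open import Data.Fin using (Fin; toℕ; zero)
open import Data.List as List using (List; []; _∷_; allFin)
open import Data.List.Membership.Propositional using (_∈_)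
open import Data.List.Relation.Unary.Any using (index)
open import Data.List.Relation.Unary.Unique.Propositional using (Unique)
open import Data.Product using (Σ; ∃; ∃-syntax; _×_)
open import Data.Sum using (_⊎_; inj₁; inj₂)
open import Data.Vec as Vec using (Vec; lookup; _[_]≔_)
open import Relation.Nullary using (yes; no)
open import Relation.Binary.PropositionalEquality using (_≡_)

------------------------------------------------------------------------
-- Real numbers
--
-- A real number is presented by a Cauchy sequence of rationals.  The
-- arithmetic is termwise, and is defined on all sequences, so that only
-- the real numbers one starts from carry a proof of Cauchyness.

Seq : Set
Seq = ℕ → ℚ

IsCauchy : Seq → Set
IsCauchy a = ∀ ε → 0ℚ ℚ.< ε →
  ∃[ N ] (∀ m n → N ℕ.≤ m → N ℕ.≤ n → ℚ.∣ a m ℚ.- a n ∣ ℚ.≤ ε)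

infix 4 _≤ʳ_ _<ʳ_

-- On Cauchy sequences these are the order relations between the limits.

_≤ʳ_ : Seq → Seq → Set
a ≤ʳ b = ∀ ε → 0ℚ ℚ.< ε → ∃[ N ] (∀ n → N ℕ.≤ n → a n ℚ.≤ b n ℚ.+ ε)

_<ʳ_ : Seq → Seq → Set
a <ʳ b = ∃[ ε ] (0ℚ ℚ.< ε × ∃[ N ] (∀ n → N ℕ.≤ n → a n ℚ.+ ε ℚ.≤ b n))

infixl 6 _+ʳ_ _-ʳ_ _⊔ʳ_
infixl 7 _*ʳ_ _÷ʳ_

const : ℚ → Seq
const q _ = q

_+ʳ_ _-ʳ_ _*ʳ_ _⊔ʳ_ : Seq → Seq → Seq
(a +ʳ b) n = a n ℚ.+ b n
(a -ʳ b) n = a n ℚ.- b n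
(a *ʳ b) n = a n ℚ.* b n
(a ⊔ʳ b) n = a n ℚ.⊔ b n

-- Total division, with q / 0 = 0.  A Cauchy sequence whose limit is not 0
-- has only finitely many zero terms, so the convention does not affect
-- quotients by nonzero reals.

_÷₀_ : ℚ → ℚ → ℚ
p ÷₀ q with q ℚP.≟ 0ℚ
... | yes _   = 0ℚ
... | no q≢0 = ℚ._÷_ p q {{≢-nonZero q≢0}}

_÷ʳ_ : Seq → Seq → Seq
(a ÷ʳ b) n = a n ÷₀ b n

fromℕ : ℕ → ℚ
fromℕ n = + n ℚ./ 1

_^_ : ℚ → ℕ → ℚ
q ^ zero  = 1ℚ
q ^ suc k = q ℚ.* (q ^ k)

-- For y > 0,  ln y = 2 Σ_{k≥0} z^(2k+1) / (2k+1)  with  z = (y-1)/(y+1);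
-- here |z| < 1 and the series converges locally uniformly in y, so the
-- diagonal sequence below converges to the logarithm of the limit of y.

lnPartial : ℕ → ℚ → ℚ
lnPartial n y = fromℕ 2 ℚ.* sum {n} term
  where
  z : ℚ
  z = (y ℚ.- 1ℚ) ÷₀ (y ℚ.+ 1ℚ)
  term : Fin n → ℚ
  term k = (z ^ suc (2 ℕ.* toℕ k)) ÷₀ fromℕ (suc (2 ℕ.* toℕ k))

ln : Seq → Seq
ln y n = lnPartial n (y n)

-- The ceiling of a real is not a termwise (continuous) operation, hence
-- is given by its defining inequalities.

IsCeiling : ℤ → Seq → Set
IsCeiling k a = a ≤ʳ const (k ℚ./ 1) × const (k ℚ./ 1) <ʳ a +ʳ const 1ℚ

------------------------------------------------------------------------
-- Uniform MLUFL
--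
-- Facilities are Fin n, clients are Fin m.  The costs are rational, since
-- they are the input of an algorithm.

record Instance (n m : ℕ) : Set where
  field
    f   : Fin n → ℚ
    c   : Fin n → Fin m → ℚ
    f≥0 : ∀ i → 0ℚ ℚ.≤ f i
    c≥0 : ∀ i j → 0ℚ ℚ.≤ c i j

-- As usual in facility location, distinct points may be at distance 0.

record IsMetric {n m : ℕ} (I : Instance n m) : Set where
  open Instance I
  field
    d          : Fin n ⊎ Fin m → Fin n ⊎ Fin m → ℚ
    d≥0        : ∀ u v → 0ℚ ℚ.≤ d u v
    d-refl     : ∀ u → d u u ≡ 0ℚ
    d-sym      : ∀ u v → d u v ≡ d v u
    d-triangle : ∀ u v w → d u w ℚ.≤ d u v ℚ.+ d v w
    d-extends  : ∀ i j → d (inj₁ i) (inj₂ j) ≡ c i j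

record Solution (n m : ℕ) : Set where
  field
    path   : List (Fin n)
    unique : Unique path
    φ      : Fin m → Fin n
    φ-open : ∀ j → φ j ∈ path

  π∘φ : Fin m → ℕ
  π∘φ j = suc (toℕ (index (φ-open j)))

module _ {n m : ℕ} (I : Instance n m) where
  open Instance I

  cost : Solution n m → ℚ
  cost S = List.foldr ℚ._+_ 0ℚ (List.map f path)
           ℚ.+ sum (λ j → c (φ j) j ℚ.+ fromℕ (π∘φ j))
    where open Solution S

  IsOptimalSolution : Solution n m → Set
  IsOptimalSolution S = ∀ S′ → cost S ℚ.≤ cost S′

  -- The linear program (Unif-P).  The index t : Fin n stands for the time
  -- toℕ t + 1.  With rational data a linear program that has an optimum
  -- over the reals has the same optimum over the rationals.

  record Feasible (x : Fin n → Fin m → Fin n → ℚ) (y : Fin n → Fin n → ℚ) : Set where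
    field
      covered  : ∀ j → 1ℚ ℚ.≤ sum (λ i → sum (λ t → x i j t))
      x≤y      : ∀ i j t → x i j t ℚ.≤ y i t
      one-each : ∀ t → sum (λ i → y i t) ℚ.≤ 1ℚ
      x≥0      : ∀ i j t → 0ℚ ℚ.≤ x i j t
      y≥0      : ∀ i t → 0ℚ ℚ.≤ y i t

  objective : (Fin n → Fin m → Fin n → ℚ) → (Fin n → Fin n → ℚ) → ℚ
  objective x y =
    sum (λ i → sum (λ t → f i ℚ.* y i t))
    ℚ.+ sum (λ j → sum (λ i → sum (λ t → (c i j ℚ.+ fromℕ (suc (toℕ t))) ℚ.* x i j t)))

  IsLPOptimum : ℚ → Set
  IsLPOptimum v =
    (∃[ x ] ∃[ y ] (Feasible x y × objective x y ≡ v))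
    × (∀ x y → Feasible x y → v ℚ.≤ objective x y)

------------------------------------------------------------------------
-- Polynomial time
--
-- The machine model is Jones's WHILE language over binary trees.  It is
-- polynomially equivalent to Turing machines: a tree operation touches a
-- single cell of a heap in which subtrees are shared.

infixr 5 _∙_

data Tree : Set where
  nil : Tree
  _∙_ : Tree → Tree → Tree

size : Tree → ℕ
size nil     = 1
size (l ∙ r) = suc (size l ℕ.+ size r)

data Expr (v : ℕ) : Set where
  var  : Fin v → Expr v
  nil  : Expr v
  cons : Expr v → Expr v → Expr v
  hd   : Expr v → Expr v
  tl   : Expr v → Expr v

Store : ℕ → Set
Store v = Vec Tree v

left right : Tree → Tree
left nil      = nil
left (l ∙ _)  = l
right nil     = nil
right (_ ∙ r) = r

eval : ∀ {v} → Expr v → Store v → Tree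
eval (var i)    σ = lookup σ i
eval nil        σ = nil
eval (cons d e) σ = eval d σ ∙ eval e σ
eval (hd e)     σ = left (eval e σ)
eval (tl e)     σ = right (eval e σ)

steps : ∀ {v} → Expr v → ℕ
steps (var _)    = 1
steps nil        = 1
steps (cons d e) = suc (steps d ℕ.+ steps e)
steps (hd e)     = suc (steps e)
steps (tl e)     = suc (steps e)

infix  6 _:=_
infixr 5 _⨾_

data Cmd (v : ℕ) : Set where
  skip          : Cmd v
  _:=_          : Fin v → Expr v → Cmd v
  _⨾_           : Cmd v → Cmd v → Cmd v
  if_then_else_ : Expr v → Cmd v → Cmd v → Cmd v
  while_loop_     : Expr v → Cmd v → Cmd v

-- ⟨ C , σ ⟩⇓[ t ] τ : started in σ, the command C stops in τ after t steps.
-- A test succeeds when its value is not nil.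

infix 4 ⟨_,_⟩⇓[_]_

data ⟨_,_⟩⇓[_]_ {v : ℕ} : Cmd v → Store v → ℕ → Store v → Set where
  skip⇓   : ∀ {σ} → ⟨ skip , σ ⟩⇓[ 1 ] σ
  assign⇓ : ∀ {σ i e} → ⟨ i := e , σ ⟩⇓[ suc (steps e) ] (σ [ i ]≔ eval e σ)
  seq⇓    : ∀ {σ ρ τ C D s t} →
            ⟨ C , σ ⟩⇓[ s ] ρ → ⟨ D , ρ ⟩⇓[ t ] τ →
            ⟨ C ⨾ D , σ ⟩⇓[ suc (s ℕ.+ t) ] τ
  then⇓   : ∀ {σ τ e C D t l r} → eval e σ ≡ l ∙ r →
            ⟨ C , σ ⟩⇓[ t ] τ →
            ⟨ if e then C else D , σ ⟩⇓[ suc (steps e ℕ.+ t) ] τ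
  else⇓   : ∀ {σ τ e C D t} → eval e σ ≡ nil →
            ⟨ D , σ ⟩⇓[ t ] τ →
            ⟨ if e then C else D , σ ⟩⇓[ suc (steps e ℕ.+ t) ] τ
  stop⇓   : ∀ {σ e C} → eval e σ ≡ nil →
            ⟨ while e loop C , σ ⟩⇓[ suc (steps e) ] σ
  loop⇓   : ∀ {σ ρ τ e C s t l r} → eval e σ ≡ l ∙ r →
            ⟨ C , σ ⟩⇓[ s ] ρ → ⟨ while e loop C , ρ ⟩⇓[ t ] τ →
            ⟨ while e loop C , σ ⟩⇓[ suc (steps e ℕ.+ s ℕ.+ t) ] τ

record Program : Set where
  field
    extra : ℕ
    body  : Cmd (suc extra)

-- Variable 0 holds the input at the start and the output at the end; the
-- other variables are initially nil.

Runs : Program → Tree → ℕ → Tree → Set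
Runs P input t output =
  ∃[ τ ] (⟨ body , input Vec.∷ Vec.replicate extra nil ⟩⇓[ t ] τ
          × lookup τ zero ≡ output)
  where open Program P

-- Numbers are written in (bijective) binary.

⌜_⌝ᵇ : ℕᵇ → Tree
⌜ Bin.zero ⌝ᵇ = nil
⌜ 2[1+ b ] ⌝ᵇ = nil ∙ ⌜ b ⌝ᵇ
⌜ 1+[2 b ] ⌝ᵇ = (nil ∙ nil) ∙ ⌜ b ⌝ᵇ

⌜_⌝ⁿ : ℕ → Tree
⌜ n ⌝ⁿ = ⌜ Bin.fromℕ n ⌝ᵇ

⌜_⌝ᶻ : ℤ → Tree
⌜ + n ⌝ᶻ      = nil ∙ ⌜ n ⌝ⁿ
⌜ -[1+ n ] ⌝ᶻ = (nil ∙ nil) ∙ ⌜ n ⌝ⁿ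

⌜_⌝ᵠ : ℚ → Tree
⌜ q ⌝ᵠ = ⌜ ↥ q ⌝ᶻ ∙ ⌜ ↧ₙ q ⌝ⁿ

listTree : List Tree → Tree
listTree = List.foldr _∙_ nil

-- The list of opening costs, and for each client its list of connection
-- costs.

encodeInstance : ∀ {n m} → Instance n m → Tree
encodeInstance {n} {m} I =
  listTree (List.map (λ i → ⌜ f i ⌝ᵠ) (allFin n))
  ∙ listTree (List.map (λ j → listTree (List.map (λ i → ⌜ c i j ⌝ᵠ) (allFin n))) (allFin m))
  where open Instance I

encodeSolution : ∀ {n m} → Solution n m → Tree
encodeSolution {n} {m} S =
  listTree (List.map (λ i → ⌜ toℕ i ⌝ⁿ) path)
  ∙ listTree (List.map (λ j → ⌜ toℕ (φ j) ⌝ⁿ) (allFin m))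
  where open Solution S

RunsInPolyTime : Program → Set
RunsInPolyTime P =
  ∃[ a ] ∃[ k ] (∀ {n m} (I : Instance n m) → IsMetric I →
    ∃[ t ] ∃[ out ] (Runs P (encodeInstance I) t out
                     × t ℕ.≤ a ℕ.* size (encodeInstance I) ℕ.^ k))

Returns : ∀ {n m} → Program → Instance n m → Solution n m → Set
Returns P I S = ∃[ t ] Runs P (encodeInstance I) t (encodeSolution S)

------------------------------------------------------------------------
-- Performance guarantees

-- An instance with clients but no facility has no solution; (Unif-P) is
-- then infeasible and has no optimal value.

AchievesLPRatio : Program → Seq → Set
AchievesLPRatio P ρ = ∀ {n m} (I : Instance n m) → IsMetric I →
  ∀ OPT → IsLPOptimum I OPT →
  ∃[ S ] (Returns P I S × const (cost I S) ≤ʳ ρ *ʳ const OPT)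

IsApproximationAlgorithm : ℚ → Program → Set
IsApproximationAlgorithm ρ P = RunsInPolyTime P
  × (∀ {n m} (I : Instance n m) → IsMetric I →
     ∀ S* → IsOptimalSolution I S* →
     ∃[ S ] (Returns P I S × cost I S ℚ.≤ ρ ℚ.* cost I S*))

-- The third argument stands for ⌈1/α⌉.

ratio : Seq → Seq → ℤ → Seq
ratio α β k =
  ln (one ÷ʳ β) ÷ʳ (one -ʳ β)
  ⊔ʳ (const (fromℕ 3) ÷ʳ (one -ʳ β) +ʳ const (fromℕ 2) ÷ʳ (one -ʳ α))
  ⊔ʳ (const (fromℕ 4) ÷ʳ α) *ʳ const (k ℚ./ 1)
  where
  one : Seq
  one = const 1ℚ

-- The linear program need not be solved: a greedy algorithm with rising prices is a 330/31-approximation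
-- with respect to (Unif-P), while every value of the ratio is at least 32/3.
--
-- In round r the price is p = (33/32)^(r+1).  An unassigned client j is assigned to an open facility i
-- as soon as c i j ≤ p, and a closed facility i is opened as soon as its unassigned clients j with
-- c i j ≤ p can pay f i, their connections, and half of one time step for every client that was
-- unassigned at the start of the round.  A client pays the price at which it is assigned, so the cost
-- is at most twice the sum of these prices.  Let q j be the price preceding that of j.  Then
-- v j = 2/5 q j and θ t = 1/2 #{ j | t < 33/32 v j } satisfy  Σⱼ (v j - c i j - t)⁺ ≤ f i + θ t  for all
-- i and t, i.e. are feasible for the dual of (Unif-P): facility i did not open at the smallest price q l
-- of a client l with positive term, and clients with larger prices were not served by the facility of l,
-- so that the triangle inequality bounds their prices.  As Σₜ θ t ≤ 33/64 Σⱼ v j, the cost is at most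
-- 330/31 OPT.
--
-- The program keeps a stack of trees in a single variable; a computation a ⇒ b replaces the tree a on
-- top of the stack by b, with polynomial bounds on the running time and on the size of b.

module Submission where

-- The constants fit together tightly. If a share h of each time step is charged, prices grow by a
-- factor g, and v j = δ q j, then the cost is at most (g/h) Σ q j, and the dual value is at least δ
-- (1 - h g) Σ q j. For g near 1, the product h (1 - h) is largest at h = 1/2. The triangle
-- inequality asks for δ (g + δ) ≤ 1 - δ; for g = 1 this is δ ≤ √2 - 1, and 2/5 is just below. The
-- limit g = 1 would give ratio 10; g = 33/32 gives 330/31, barely under 32/3 (990 < 992). A fixed
-- factor above 1 keeps the number of rounds polynomial in the bit length of the input. The machine
-- is the other obstacle. A loop whose steps are polynomial may still grow exponentially, so every
-- loop comes with a conserved or capped quantity that bounds all its intermediate values, and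
-- bounds on numbers are turned into bounds on sizes. The duality argument needs the inequalities
-- left behind by every past round, although the state changes. They are therefore phrased through
-- the round in which each client is finally assigned, which later rounds do not alter.

module Programs where

  open import Defs
  open import Data.Bool using (Bool; true; false; not; T) renaming (if_then_else_ to ifᵇ_then_else_)
  open import Data.Fin as Fin using (Fin; zero; toℕ)
  open import Data.List as List using (List; []; _∷_; length; _ʳ++_; reverse; allFin; map; tabulate)
  open import Data.List.Properties using (reverse-involutive; map-∘; length-tabulate)
  open import Data.Maybe using (Maybe; just; nothing; is-just)
  open import Data.Nat as ℕ using (ℕ; zero; suc; _+_; _*_; _≤_; _<_; z≤n; s≤s; _≤ᵇ_; _<ᵇ_)
  import Data.Nat.Binary.Base as Bin
  import Data.Nat.Binary.Properties as Binₚ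
  open Bin using (ℕᵇ; 2[1+_]; 1+[2_])
  open import Data.Nat.Properties
  open import Data.Nat.Tactic.RingSolver using (solve-∀)
  open import Data.Product using (Σ; ∃-syntax; _×_; _,_; proj₁; proj₂)
  open import Data.Unit using (⊤; tt)
  open import Data.Vec using ([]; _∷_)
  open import Function using (_∘_)
  open import Relation.Binary.PropositionalEquality hiding ([_])

  -- Polynomials as bounds on time and size

  infixl 6 _⊕_
  infixl 7 _⊗_

  data Poly : Set where
    𝑛       : Poly
    con     : ℕ → Poly
    _⊕_ _⊗_ : Poly → Poly → Poly

  ⟦_⟧ : Poly → ℕ → ℕ
  ⟦ 𝑛 ⟧     n = n
  ⟦ con c ⟧ n = c
  ⟦ p ⊕ q ⟧ n = ⟦ p ⟧ n + ⟦ q ⟧ n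
  ⟦ p ⊗ q ⟧ n = ⟦ p ⟧ n * ⟦ q ⟧ n

  ⟦⟧-mono : ∀ p {m n} → m ≤ n → ⟦ p ⟧ m ≤ ⟦ p ⟧ n
  ⟦⟧-mono 𝑛       m≤n = m≤n
  ⟦⟧-mono (con c) m≤n = ≤-refl
  ⟦⟧-mono (p ⊕ q) m≤n = +-mono-≤ (⟦⟧-mono p m≤n) (⟦⟧-mono q m≤n)
  ⟦⟧-mono (p ⊗ q) m≤n = *-mono-≤ (⟦⟧-mono p m≤n) (⟦⟧-mono q m≤n)

  _[_] : Poly → Poly → Poly
  𝑛       [ r ] = r
  con c   [ r ] = con c
  (p ⊕ q) [ r ] = p [ r ] ⊕ q [ r ]
  (p ⊗ q) [ r ] = p [ r ] ⊗ q [ r ]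

  ⟦⟧-subst : ∀ p r n → ⟦ p [ r ] ⟧ n ≡ ⟦ p ⟧ (⟦ r ⟧ n)
  ⟦⟧-subst 𝑛       r n = refl
  ⟦⟧-subst (con c) r n = refl
  ⟦⟧-subst (p ⊕ q) r n = cong₂ _+_ (⟦⟧-subst p r n) (⟦⟧-subst q r n)
  ⟦⟧-subst (p ⊗ q) r n = cong₂ _*_ (⟦⟧-subst p r n) (⟦⟧-subst q r n)

  degree coefficient : Poly → ℕ
  degree 𝑛       = 1
  degree (con c) = 0
  degree (p ⊕ q) = degree p + degree q
  degree (p ⊗ q) = degree p + degree q
  coefficient 𝑛       = 1
  coefficient (con c) = c
  coefficient (p ⊕ q) = coefficient p + coefficient q
  coefficient (p ⊗ q) = coefficient p * coefficient q

  ⟦⟧-monomial : ∀ p n → 1 ≤ n → ⟦ p ⟧ n ≤ coefficient p * n ℕ.^ degree p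
  ⟦⟧-monomial 𝑛 n 1≤n = ≤-reflexive (n≡1*[n*1] n)
    where
    n≡1*[n*1] : ∀ n → n ≡ 1 * (n * 1)
    n≡1*[n*1] = solve-∀
  ⟦⟧-monomial (con c) n 1≤n = ≤-reflexive (sym (*-identityʳ c))
  ⟦⟧-monomial (p ⊕ q) n@(suc _) 1≤n = begin
    ⟦ p ⟧ n + ⟦ q ⟧ n
      ≤⟨ +-mono-≤ (⟦⟧-monomial p n 1≤n) (⟦⟧-monomial q n 1≤n) ⟩
    a * n ℕ.^ k + b * n ℕ.^ l
      ≤⟨ +-mono-≤ (*-monoʳ-≤ a (^-monoʳ-≤ n (m≤m+n k l)))
                  (*-monoʳ-≤ b (^-monoʳ-≤ n (m≤n+m l k))) ⟩
    a * n ℕ.^ (k + l) + b * n ℕ.^ (k + l)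
      ≡⟨ *-distribʳ-+ (n ℕ.^ (k + l)) a b ⟨
    (a + b) * n ℕ.^ (k + l) ∎
    where
    open ≤-Reasoning
    a = coefficient p
    b = coefficient q
    k = degree p
    l = degree q
  ⟦⟧-monomial (p ⊗ q) n 1≤n = begin
    ⟦ p ⟧ n * ⟦ q ⟧ n
      ≤⟨ *-mono-≤ (⟦⟧-monomial p n 1≤n) (⟦⟧-monomial q n 1≤n) ⟩
    (a * n ℕ.^ k) * (b * n ℕ.^ l)
      ≡⟨ interchange a (n ℕ.^ k) b (n ℕ.^ l) ⟩
    (a * b) * (n ℕ.^ k * n ℕ.^ l)
      ≡⟨ cong ((a * b) *_) (sym (^-distribˡ-+-* n k l)) ⟩
    (a * b) * n ℕ.^ (k + l) ∎
    where
    open ≤-Reasoning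
    a = coefficient p
    b = coefficient q
    k = degree p
    l = degree q
    interchange : ∀ a b c d → (a * b) * (c * d) ≡ (a * c) * (b * d)
    interchange = solve-∀

  -- Trees, expressions and the stack

  1≤size : ∀ x → 1 ≤ size x
  1≤size nil     = s≤s z≤n
  1≤size (_ ∙ _) = s≤s z≤n

  size-left : ∀ x → size (left x) ≤ size x
  size-left nil     = ≤-refl
  size-left (l ∙ r) = m≤n⇒m≤1+n (m≤m+n _ _)

  size-right : ∀ x → size (right x) ≤ size x
  size-right nil     = ≤-refl
  size-right (l ∙ r) = m≤n⇒m≤1+n (m≤n+m _ _)

  size-eval : ∀ (e : Expr 1) x → size (eval e (x ∷ [])) ≤ steps e * size x
  size-eval (var zero) x = ≤-reflexive (sym (*-identityˡ _))
  size-eval nil x = ≤-trans (1≤size x) (≤-reflexive (sym (*-identityˡ _)))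
  size-eval (cons d e) x = begin
    suc (size (eval d (x ∷ [])) + size (eval e (x ∷ [])))
      ≤⟨ +-mono-≤ (1≤size x) (+-mono-≤ (size-eval d x) (size-eval e x)) ⟩
    size x + (steps d * size x + steps e * size x)
      ≡⟨ cong (size x +_) (*-distribʳ-+ (size x) (steps d) (steps e)) ⟨
    suc (steps d + steps e) * size x ∎
    where open ≤-Reasoning
  size-eval (hd e) x = ≤-trans (size-left (eval e (x ∷ [])))
    (≤-trans (size-eval e x) (m≤n+m _ (size x)))
  size-eval (tl e) x = ≤-trans (size-right (eval e (x ∷ [])))
    (≤-trans (size-eval e x) (m≤n+m _ (size x)))

  -- Commands work on the top of a stack, held in the single variable as
  -- top ∙ rest.

  onTop : Expr 1 → Expr 1
  onTop (var i)    = hd (var i)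
  onTop nil        = nil
  onTop (cons d e) = cons (onTop d) (onTop e)
  onTop (hd e)     = hd (onTop e)
  onTop (tl e)     = tl (onTop e)

  eval-onTop : ∀ e x s → eval (onTop e) ((x ∙ s) ∷ []) ≡ eval e (x ∷ [])
  eval-onTop (var zero) x s = refl
  eval-onTop nil        x s = refl
  eval-onTop (cons d e) x s = cong₂ _∙_ (eval-onTop d x s) (eval-onTop e x s)
  eval-onTop (hd e)     x s = cong left (eval-onTop e x s)
  eval-onTop (tl e)     x s = cong right (eval-onTop e x s)

  infix 4 _⊢_⟶_within_

  _⊢_⟶_within_ : Cmd 1 → Tree → Tree → ℕ → Set
  C ⊢ x ⟶ y within b = ∃[ t ] (⟨ C , x ∷ [] ⟩⇓[ t ] (y ∷ []) × t ≤ b)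

  weaken : ∀ {C x y b b′} → b ≤ b′ → C ⊢ x ⟶ y within b → C ⊢ x ⟶ y within b′
  weaken b≤b′ (t , r , t≤b) = t , r , ≤-trans t≤b b≤b′

  top rest : Expr 1
  top  = hd (var zero)
  rest = tl (var zero)

  set : Expr 1 → Cmd 1
  set e = zero := e

  set-run : ∀ e {x y} → eval e (x ∷ []) ≡ y → set e ⊢ x ⟶ y within suc (steps e)
  set-run e refl = _ , assign⇓ , ≤-refl

  seq-run : ∀ {C D x y z b c} → C ⊢ x ⟶ y within b → D ⊢ y ⟶ z within c →
            (C ⨾ D) ⊢ x ⟶ z within suc (b + c)
  seq-run (s , r , s≤b) (t , r′ , t≤c) = _ , seq⇓ r r′ , s≤s (+-mono-≤ s≤b t≤c)

  -- Combinators for polynomial-time computations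

  infix 3 _⇒_

  -- Families of trees replace functions on trees: one command and one pair of polynomials serve all
  -- `d`, while correctness is demanded only on the encodings `a d`. The bound `growth` makes
  -- composition possible, because the time of a second stage is measured in the size of what the
  -- first stage leaves.
  record _⇒_ {D : Set} (a b : D → Tree) : Set where
    field
      cmd    : Cmd 1
      time   : Poly
      growth : Poly
      run    : ∀ d s → cmd ⊢ a d ∙ s ⟶ b d ∙ s within ⟦ time ⟧ (size (a d))
      grow   : ∀ d → size (b d) ≤ ⟦ growth ⟧ (size (a d))

  open _⇒_

  reindex : ∀ {D E : Set} {a b : D → Tree} (h : E → D) → a ⇒ b → (λ e → a (h e)) ⇒ (λ e → b (h e))
  reindex h p = record
    { cmd = cmd p ; time = time p ; growth = growth p
    ; run = λ e → run p (h e) ; grow = λ e → grow p (h e) }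

  recast : ∀ {D : Set} {a a′ b b′ : D → Tree} → (∀ d → a d ≡ a′ d) → (∀ d → b d ≡ b′ d) →
           a ⇒ b → a′ ⇒ b′
  recast {a = a} {a′} {b} {b′} a≡a′ b≡b′ p = record
    { cmd = cmd p ; time = time p ; growth = growth p
    ; run = λ d s → subst₂ (λ x y → cmd p ⊢ x ∙ s ⟶ y ∙ s within ⟦ time p ⟧ (size x))
                           (a≡a′ d) (b≡b′ d) (run p d s)
    ; grow = λ d → subst₂ (λ x y → size y ≤ ⟦ growth p ⟧ (size x)) (a≡a′ d) (b≡b′ d) (grow p d) }

  infixr 4 _⟫_

  _⟫_ : ∀ {D : Set} {a b c : D → Tree} → a ⇒ b → b ⇒ c → a ⇒ c
  _⟫_ {a = a} {b} {c} p q = record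
    { cmd = cmd p ⨾ cmd q
    ; time = con 1 ⊕ (time p ⊕ time q [ growth p ])
    ; growth = growth q [ growth p ]
    ; run = λ d s → weaken
        (s≤s (+-monoʳ-≤ _ (≤-trans (⟦⟧-mono (time q) (grow p d)) (≤-reflexive (sym (⟦⟧-subst (time q) (growth p) _))))))
        (seq-run (run p d s) (run q d s))
    ; grow = λ d → ≤-trans (grow q d)
        (≤-trans (⟦⟧-mono (growth q) (grow p d)) (≤-reflexive (sym (⟦⟧-subst (growth q) (growth p) _))))
    }

  -- Loop-free case distinctions: their time is constant and their output linear in the input, so a
  -- single proof covers every step of constant complexity.
  data DecisionTree : Set where
    ret : Expr 1 → DecisionTree
    br  : Expr 1 → DecisionTree → DecisionTree → DecisionTree

  branch : {A : Set} → Tree → A → A → A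
  branch nil     _ y = y
  branch (_ ∙ _) x _ = x

  decide : DecisionTree → Tree → Tree
  decide (ret e)    x = eval e (x ∷ [])
  decide (br e p q) x = branch (eval e (x ∷ [])) (decide p x) (decide q x)

  compile : DecisionTree → Cmd 1
  compile (ret e)    = set (cons (onTop e) rest)
  compile (br e p q) = if onTop e then compile p else compile q

  dtTime : DecisionTree → ℕ
  dtTime (ret e)    = steps (cons (onTop e) rest) + 1
  dtTime (br e p q) = suc (steps (onTop e) + (dtTime p + dtTime q))

  dtGrowth : DecisionTree → ℕ
  dtGrowth (ret e)    = steps e
  dtGrowth (br e p q) = dtGrowth p + dtGrowth q

  compile-run : ∀ p x s → compile p ⊢ x ∙ s ⟶ decide p x ∙ s within dtTime p
  compile-run (ret e) x s = weaken (≤-reflexive (+-comm 1 _))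
    (set-run (cons (onTop e) rest) (cong (_∙ s) (eval-onTop e x s)))
  compile-run (br e p q) x s with eval e (x ∷ []) | eval-onTop e x s
  ... | nil   | e≡ with compile-run q x s
  ...   | t , r , t≤ = _ , else⇓ e≡ r , s≤s (+-monoʳ-≤ (steps (onTop e)) (≤-trans t≤ (m≤n+m _ _)))
  compile-run (br e p q) x s | l ∙ m | e≡ with compile-run p x s
  ...   | t , r , t≤ = _ , then⇓ e≡ r , s≤s (+-monoʳ-≤ (steps (onTop e)) (≤-trans t≤ (m≤m+n _ _)))

  size-decide : ∀ p x → size (decide p x) ≤ dtGrowth p * size x
  size-decide (ret e) x = size-eval e x
  size-decide (br e p q) x with eval e (x ∷ [])
  ... | nil   = ≤-trans (size-decide q x) (*-monoˡ-≤ (size x) (m≤n+m (dtGrowth q) (dtGrowth p)))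
  ... | _ ∙ _ = ≤-trans (size-decide p x) (*-monoˡ-≤ (size x) (m≤m+n (dtGrowth p) (dtGrowth q)))

  simple : ∀ {D : Set} {a b : D → Tree} (p : DecisionTree) → (∀ d → decide p (a d) ≡ b d) → a ⇒ b
  simple {a = a} p p≡ = recast (λ _ → refl) p≡ record
    { cmd = compile p ; time = con (dtTime p) ; growth = con (dtGrowth p) ⊗ 𝑛
    ; run = λ d s → compile-run p (a d) s ; grow = λ d → size-decide p (a d) }

  expr : ∀ {D : Set} {a b : D → Tree} (e : Expr 1) → (∀ d → eval e (a d ∷ []) ≡ b d) → a ⇒ b
  expr e = simple (ret e)

  infixr 5 _▵_

  -- The input is pushed a second time. A computation leaves the rest of the stack alone, so the
  -- lower copy survives `p` and is then swapped to the top for `q`.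
  _▵_ : ∀ {D : Set} {a b c : D → Tree} → a ⇒ b → a ⇒ c → a ⇒ (λ d → b d ∙ c d)
  _▵_ {a = a} {b} {c} p q = record
    { cmd = set (cons top (var zero)) ⨾ cmd p ⨾ set (cons (hd rest) (cons top (tl rest))) ⨾ cmd q ⨾ set (cons (cons (hd rest) top) (tl rest))
    ; time = con 31 ⊕ (time p ⊕ time q)
    ; growth = con 1 ⊕ (growth p ⊕ growth q)
    ; run = λ d s → weaken (≤-reflexive (count (⟦ time p ⟧ (size (a d))) (⟦ time q ⟧ (size (a d))) )) (
        seq-run (set-run (cons top (var zero)) {y = a d ∙ (a d ∙ s)} refl)
        (seq-run (run p d (a d ∙ s))
        (seq-run (set-run (cons (hd rest) (cons top (tl rest))) refl)
        (seq-run (run q d (b d ∙ s))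
                 (set-run (cons (cons (hd rest) top) (tl rest)) refl)))))
    ; grow = λ d → s≤s (+-mono-≤ (grow p d) (grow q d)) }
    where
    count : ∀ x y → suc (5 + suc (x + suc (11 + suc (y + 11)))) ≡ 31 + (x + y)
    count = solve-∀

  bool : Bool → Tree
  bool true  = nil ∙ nil
  bool false = nil

  ifP : ∀ {D : Set} {a b c : D → Tree} {β : D → Bool} → a ⇒ (λ d → bool (β d)) → a ⇒ b → a ⇒ c →
        a ⇒ (λ d → ifᵇ β d then b d else c d)
  ifP {a = a} {b} {c} {β} test p q = record
    { cmd = cmd tested ⨾ if hd top then (set drop ⨾ cmd p) else (set drop ⨾ cmd q)
    ; time = time tested ⊕ (con 20 ⊕ (time p ⊕ time q))
    ; growth = growth p ⊕ growth q
    ; run = λ d s → let r = seq-run (run tested d s) (branches d s (β d) refl) in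
        weaken (≤-reflexive (count (⟦ time tested ⟧ (size (a d))) _)) r
    ; grow = λ d → sized d (β d) refl }
    where
    -- The test consumes its input, hence a copy is kept beside the answer for the chosen branch.
    tested = test ▵ expr {b = a} (var zero) (λ _ → refl)
    drop : Expr 1
    drop = cons (tl top) rest
    count : ∀ x y → suc (x + suc (18 + y)) ≡ x + (20 + y)
    count = solve-∀
    branches : ∀ d s β′ → β d ≡ β′ → (if hd top then (set drop ⨾ cmd p) else (set drop ⨾ cmd q)) ⊢
               (bool (β d) ∙ a d) ∙ s ⟶ (ifᵇ β d then b d else c d) ∙ s
               within suc (18 + (⟦ time p ⟧ (size (a d)) + ⟦ time q ⟧ (size (a d))))
    branches d s true e rewrite e
      with seq-run (set-run drop {(bool true ∙ a d) ∙ s} refl) (run p d s)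
    ... | t , r , t≤ = _ , then⇓ refl r , s≤s (≤-trans (+-monoʳ-≤ 3 t≤) (≤-trans (m≤m+n _ (⟦ time q ⟧ (size (a d)))) (≤-trans (m≤n+m _ 7) (≤-reflexive (count′ (⟦ time p ⟧ (size (a d))) _)))))
      where
      count′ : ∀ x y → 7 + (3 + (suc (7 + x)) + y) ≡ 18 + (x + y)
      count′ = solve-∀
    branches d s false e rewrite e
      with seq-run (set-run drop {(bool false ∙ a d) ∙ s} refl) (run q d s)
    ... | t , r , t≤ = _ , else⇓ refl r , s≤s (≤-trans (+-monoʳ-≤ 3 t≤) (≤-trans (m≤n+m _ (⟦ time p ⟧ (size (a d)))) (≤-trans (m≤n+m _ 7) (≤-reflexive (count′ (⟦ time p ⟧ (size (a d))) _)))))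
      where
      count′ : ∀ x y → 7 + (x + (3 + (suc (7 + y)))) ≡ 18 + (x + y)
      count′ = solve-∀
    sized : ∀ d β′ → β d ≡ β′ → size (ifᵇ β d then b d else c d) ≤ ⟦ growth p ⊕ growth q ⟧ (size (a d))
    sized d true  e rewrite e = ≤-trans (grow p d) (m≤m+n _ _)
    sized d false e rewrite e = ≤-trans (grow q d) (m≤n+m _ _)

  -- Lists and bounded loops

  list : {X : Set} → (X → Tree) → List X → Tree
  list e xs = listTree (List.map e xs)

  length≤size : ∀ {X : Set} (e : X → Tree) xs → length xs ≤ size (list e xs)
  length≤size e []       = z≤n
  length≤size e (x ∷ xs) = s≤s (≤-trans (length≤size e xs) (m≤n+m _ _))

  fold : {X A : Set} → (X → A → A) → List X → A → A
  fold step []       a = a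
  fold step (x ∷ xs) a = fold step xs (step x a)

  module _ {X A : Set} (eA : A → Tree) (step : X → A → A) where

    -- A polynomial bound for one step says little about its iterates, which may grow exponentially.
    -- A loop therefore asks for one bound on all intermediate accumulators.
    Bounded : ℕ → List X → A → Set
    Bounded b []       a = size (eA a) ≤ b
    Bounded b (x ∷ xs) a = size (eA a) ≤ b × Bounded b xs (step x a)

    Bounded-here : ∀ {b} xs a → Bounded b xs a → size (eA a) ≤ b
    Bounded-here []       a p       = p
    Bounded-here (x ∷ xs) a (p , _) = p

    Bounded-end : ∀ {b} xs a → Bounded b xs a → size (eA (fold step xs a)) ≤ b
    Bounded-end []       a p       = p
    Bounded-end (x ∷ xs) a (_ , p) = Bounded-end xs (step x a) p

    -- The invariant also sees the items still to come, so that it can be a balance such as "size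
    -- reached so far plus an allowance for every remaining item".
    bounded : ∀ {b} (Inv : List X → A → Set) →
              (∀ x xs a → Inv (x ∷ xs) a → Inv xs (step x a)) →
              (∀ xs a → Inv xs a → size (eA a) ≤ b) →
              ∀ xs a → Inv xs a → Bounded b xs a
    bounded Inv pres small []       a i = small [] a i
    bounded Inv pres small (x ∷ xs) a i =
      small (x ∷ xs) a i , bounded Inv pres small xs (step x a) (pres x xs a i)

  module _ {D : Set} {X A : D → Set}
           (eX : ∀ d → X d → Tree) (eA : ∀ d → A d → Tree)
           (step : ∀ d → X d → A d → A d) where

    Step : Set
    Step = _⇒_ {Σ D (λ d → X d × A d)} (λ (d , x , a) → eX d x ∙ eA d a) (λ (d , x , a) → eA d (step d x a))

    module _ (p : Step) (xs : ∀ d → List (X d)) (a₀ : ∀ d → A d) (B : Poly)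
             (bound : ∀ d → Bounded (eA d) (step d) (⟦ B ⟧ (size (list (eX d) (xs d) ∙ eA d (a₀ d)))) (xs d) (a₀ d)) where

      private
        -- With (y ∙ ys) ∙ a on top, `enter` leaves y ∙ a on top and parks ys below it during the
        -- step; `leave` puts ys back beside the new accumulator.
        enter leave : Expr 1
        enter = cons (cons (hd (hd top)) (tl top)) (cons (tl (hd top)) rest)
        leave = cons (cons (hd rest) top) (tl rest)
        body : Cmd 1
        body = set enter ⨾ cmd p ⨾ set leave
        loop : Cmd 1
        loop = while hd top loop body

        loop-run : ∀ d n b ys a s → size (list (eX d) ys) ≤ n → Bounded (eA d) (step d) b ys a →
          loop ⊢ (list (eX d) ys ∙ eA d a) ∙ s ⟶ (nil ∙ eA d (fold (step d) ys a)) ∙ s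
          within 4 + length ys * (40 + ⟦ time p ⟧ (1 + (n + b)))
        loop-run d n b []       a s ys≤n bd = _ , stop⇓ refl , ≤-refl
        loop-run d n b (y ∷ ys) a s ys≤n (a≤b , bd)
          with seq-run (set-run enter {(list (eX d) (y ∷ ys) ∙ eA d a) ∙ s} refl)
                 (seq-run (run p (d , y , a) (list (eX d) ys ∙ s)) (set-run leave refl))
             | loop-run d n b ys (step d y a) s (≤-trans (m≤n⇒m≤1+n (m≤n+m _ _)) ys≤n) bd
        ... | t , r , t≤ | u , r′ , u≤ = _ , loop⇓ refl r r′ , (begin
          4 + t + u
            ≤⟨ +-mono-≤ (+-monoʳ-≤ 4 t≤) u≤ ⟩
          4 + suc (suc (steps enter) + suc (⟦ time p ⟧ (1 + (size (eX d y) + size (eA d a))) + 11)) + (4 + k * w)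
            ≤⟨ +-monoˡ-≤ (4 + k * w) (+-monoʳ-≤ 4 (s≤s (+-monoʳ-≤ (suc (steps enter)) (s≤s (+-monoˡ-≤ 11
                (⟦⟧-mono (time p) (s≤s (+-mono-≤ y≤n a≤b)))))))) ⟩
          4 + suc (suc (steps enter) + suc (v + 11)) + (4 + k * w)
            ≤⟨ m≤m+n _ 6 ⟩
          4 + suc (suc (steps enter) + suc (v + 11)) + (4 + k * w) + 6
            ≡⟨ count v (k * w) ⟩
          4 + suc k * w ∎)
          where
          open ≤-Reasoning
          k = length ys
          v = ⟦ time p ⟧ (1 + (n + b))
          w = 40 + v
          y≤n : size (eX d y) ≤ n
          y≤n = ≤-trans (m≤n⇒m≤1+n (m≤m+n _ _)) ys≤n
          count : ∀ v z → 4 + suc (17 + suc (v + 11)) + (4 + z) + 6 ≡ 4 + (40 + v + z)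
          count = solve-∀

      foldP : (λ d → list (eX d) (xs d) ∙ eA d (a₀ d)) ⇒ (λ d → eA d (fold (step d) (xs d) (a₀ d)))
      foldP = record
        { cmd = loop ⨾ set (cons (tl top) rest)
        ; time = con 12 ⊕ 𝑛 ⊗ (con 40 ⊕ time p [ con 1 ⊕ (𝑛 ⊕ B) ])
        ; growth = B
        ; run = λ d s → let N = size (list (eX d) (xs d) ∙ eA d (a₀ d)) in
            weaken (begin
              suc (4 + length (xs d) * (40 + ⟦ time p ⟧ (1 + (N + ⟦ B ⟧ N))) + 7)
                ≡⟨ count _ ⟩
              12 + length (xs d) * (40 + ⟦ time p ⟧ (1 + (N + ⟦ B ⟧ N)))
                ≤⟨ +-monoʳ-≤ 12 (*-monoˡ-≤ _ (≤-trans (length≤size (eX d) (xs d)) (m≤n⇒m≤1+n (m≤m+n _ _)))) ⟩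
              12 + N * (40 + ⟦ time p ⟧ (1 + (N + ⟦ B ⟧ N)))
                ≡⟨ cong (λ z → 12 + N * (40 + z)) {x = ⟦ time p [ con 1 ⊕ (𝑛 ⊕ B) ] ⟧ N} {y = ⟦ time p ⟧ (1 + (N + ⟦ B ⟧ N))} (⟦⟧-subst (time p) (con 1 ⊕ (𝑛 ⊕ B)) N) ⟨
              12 + N * (40 + ⟦ time p [ con 1 ⊕ (𝑛 ⊕ B) ] ⟧ N) ∎)
            (seq-run (loop-run d N (⟦ B ⟧ N) (xs d) (a₀ d) s (m≤n⇒m≤1+n (m≤m+n _ _)) (bound d))
                     (set-run (cons (tl top) rest) refl))
        ; grow = λ d → Bounded-end (eA d) (step d) (xs d) (a₀ d) (bound d) }
        where
        open ≤-Reasoning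
        count : ∀ z → suc (4 + z + 7) ≡ 12 + z
        count = solve-∀

  v : Expr 1
  v = var zero

  fold-ʳ++ : ∀ {X : Set} (xs ys : List X) → fold _∷_ xs ys ≡ xs ʳ++ ys
  fold-ʳ++ []       ys = refl
  fold-ʳ++ (x ∷ xs) ys = fold-ʳ++ xs (x ∷ ys)

  revOnto : ∀ {D : Set} {X : D → Set} (e : ∀ d → X d → Tree) (xs ys : ∀ d → List (X d)) →
            (λ d → list (e d) (xs d) ∙ list (e d) (ys d)) ⇒ (λ d → list (e d) (xs d ʳ++ ys d))
  revOnto {D} {X} e xs ys = recast (λ _ → refl) (λ d → cong (list (e d)) (fold-ʳ++ (xs d) (ys d)))
    (foldP e (λ d → list (e d)) (λ d → _∷_) (expr v (λ _ → refl)) xs ys 𝑛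
      (λ d → bounded (list (e d)) _∷_
        (λ xs ys → size (list (e d) xs ∙ list (e d) ys) ≤ size (list (e d) (xs₀ d) ∙ list (e d) (ys₀ d)))
        (λ x xs ys → ≤-trans (≤-reflexive (shift (size (e d x)) (size (list (e d) xs)) (size (list (e d) ys)))))
        (λ xs ys → ≤-trans (m≤n⇒m≤1+n (m≤n+m _ _)))
        (xs d) (ys d) ≤-refl))
    where
    xs₀ = xs
    ys₀ = ys
    shift : ∀ a b c → suc (b + suc (a + c)) ≡ suc (suc (a + b) + c)
    shift = solve-∀

  -- Arithmetic of binary numerals

  -- Bijective binary numbers as lists of digits; true is the digit 2.

  Bits : Set
  Bits = List Bool

  digit : Bool → Tree
  digit true  = nil
  digit false = nil ∙ nil

  digits : Bits → Tree
  digits = list digit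

  dval : Bool → ℕ
  dval true  = 2
  dval false = 1

  val : Bits → ℕ
  val []       = 0
  val (d ∷ ds) = dval d + 2 * val ds

  toBits : ℕᵇ → Bits
  toBits Bin.zero   = []
  toBits 2[1+ b ] = true ∷ toBits b
  toBits 1+[2 b ] = false ∷ toBits b

  fromBits : Bits → ℕᵇ
  fromBits []           = Bin.zero
  fromBits (true ∷ ds)  = 2[1+ fromBits ds ]
  fromBits (false ∷ ds) = 1+[2 fromBits ds ]

  bits : ℕ → Bits
  bits n = toBits (Bin.fromℕ n)

  ⌜⌝-toBits : ∀ b → digits (toBits b) ≡ ⌜ b ⌝ᵇ
  ⌜⌝-toBits Bin.zero = refl
  ⌜⌝-toBits 2[1+ b ] = cong (nil ∙_) (⌜⌝-toBits b)
  ⌜⌝-toBits 1+[2 b ] = cong ((nil ∙ nil) ∙_) (⌜⌝-toBits b)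

  digits-bits : ∀ n → digits (bits n) ≡ ⌜ n ⌝ⁿ
  digits-bits n = ⌜⌝-toBits (Bin.fromℕ n)

  val-toBits : ∀ b → val (toBits b) ≡ Bin.toℕ b
  val-toBits Bin.zero = refl
  val-toBits 2[1+ b ] = trans (cong (λ n → 2 + 2 * n) (val-toBits b)) (sym (*-suc 2 (Bin.toℕ b)))
  val-toBits 1+[2 b ] = cong (λ n → 1 + 2 * n) (val-toBits b)

  val-bits : ∀ n → val (bits n) ≡ n
  val-bits n = trans (val-toBits (Bin.fromℕ n)) (Binₚ.toℕ-fromℕ n)

  toBits-fromBits : ∀ ds → toBits (fromBits ds) ≡ ds
  toBits-fromBits []           = refl
  toBits-fromBits (true ∷ ds)  = cong (true ∷_) (toBits-fromBits ds)
  toBits-fromBits (false ∷ ds) = cong (false ∷_) (toBits-fromBits ds)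

  bits-val : ∀ ds → bits (val ds) ≡ ds
  bits-val ds = begin
    toBits (Bin.fromℕ (val ds))                       ≡⟨ cong (toBits ∘ Bin.fromℕ ∘ val) (toBits-fromBits ds) ⟨
    toBits (Bin.fromℕ (val (toBits (fromBits ds))))   ≡⟨ cong (toBits ∘ Bin.fromℕ) (val-toBits (fromBits ds)) ⟩
    toBits (Bin.fromℕ (Bin.toℕ (fromBits ds)))        ≡⟨ cong toBits (Binₚ.fromℕ-toℕ (fromBits ds)) ⟩
    toBits (fromBits ds)                              ≡⟨ toBits-fromBits ds ⟩
    ds ∎
    where open ≡-Reasoning

  digits-val : ∀ ds → digits ds ≡ ⌜ val ds ⌝ⁿ
  digits-val ds = trans (cong digits (sym (bits-val ds))) (digits-bits (val ds))

  size-digit : ∀ d → size (digit d) ≤ 3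
  size-digit true  = s≤s z≤n
  size-digit false = ≤-refl

  -- Addition

  data Carry : Set where
    c0 c1 c2 : Carry

  carry : Carry → Tree
  carry c0 = nil
  carry c1 = nil ∙ nil
  carry c2 = (nil ∙ nil) ∙ nil

  cval : Carry → ℕ
  cval c0 = 0
  cval c1 = 1
  cval c2 = 2

  first : Bits → ℕ
  first []      = 0
  first (d ∷ _) = dval d

  rest′ : Bits → Bits
  rest′ []       = []
  rest′ (_ ∷ ds) = ds

  -- Only applied to numbers between 1 and 6.
  sumDigit : ℕ → Bool
  sumDigit 1 = false
  sumDigit 2 = true
  sumDigit 3 = false
  sumDigit 4 = true
  sumDigit 5 = false
  sumDigit _ = true

  sumCarry : ℕ → Carry
  sumCarry 1 = c0
  sumCarry 2 = c0
  sumCarry 3 = c1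
  sumCarry 4 = c1
  sumCarry _ = c2

  addStep : Bool → Bits × Carry × Bits → Bits × Carry × Bits
  addStep d (y , c , out) = rest′ y , sumCarry s , sumDigit s ∷ out
    where s = dval d + (first y + cval c)

  addState : Bits × Carry × Bits → Tree
  addState (y , c , out) = digits y ∙ (carry c ∙ digits out)

  quoteTree : Tree → Expr 1
  quoteTree nil     = nil
  quoteTree (l ∙ r) = cons (quoteTree l) (quoteTree r)

  addStepP : ∀ {D : Set} → Step {D} (λ _ → digit) (λ _ → addState) (λ _ → addStep)
  addStepP = simple tree λ where
      (_ , true , [] , c0 , out) → refl
      (_ , true , [] , c1 , out) → refl
      (_ , true , [] , c2 , out) → refl
      (_ , true , true ∷ y , c0 , out) → refl
      (_ , true , true ∷ y , c1 , out) → refl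
      (_ , true , true ∷ y , c2 , out) → refl
      (_ , true , false ∷ y , c0 , out) → refl
      (_ , true , false ∷ y , c1 , out) → refl
      (_ , true , false ∷ y , c2 , out) → refl
      (_ , false , [] , c0 , out) → refl
      (_ , false , [] , c1 , out) → refl
      (_ , false , [] , c2 , out) → refl
      (_ , false , true ∷ y , c0 , out) → refl
      (_ , false , true ∷ y , c1 , out) → refl
      (_ , false , true ∷ y , c2 , out) → refl
      (_ , false , false ∷ y , c0 , out) → refl
      (_ , false , false ∷ y , c1 , out) → refl
      (_ , false , false ∷ y , c2 , out) → refl
    where
    Y = hd (tl v)
    C = hd (tl (tl v))
    O = tl (tl (tl v))
    leaf withCarry withDigit : ℕ → DecisionTree
    leaf s = ret (cons (tl Y) (cons (quoteTree (carry (sumCarry s))) (cons (quoteTree (digit (sumDigit s))) O)))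
    withCarry s = br C (br (hd C) (leaf (s + 2)) (leaf (s + 1))) (leaf s)
    withDigit s = br Y (br (hd Y) (withCarry (s + 1)) (withCarry (s + 2))) (withCarry s)
    tree : DecisionTree
    tree = br (hd v) (withDigit 1) (withDigit 2)

  -- The number whose low digits are out, in reverse, and whose high part is h.
  above : Bits → ℕ → ℕ
  above []        h = h
  above (d ∷ out) h = above out (dval d + 2 * h)

  val-ʳ++ : ∀ out ds → val (out ʳ++ ds) ≡ above out (val ds)
  val-ʳ++ []        ds = refl
  val-ʳ++ (d ∷ out) ds = val-ʳ++ out (d ∷ ds)

  -- The conserved quantity of the addition loop: the digits already written, below the sum of
  -- everything not yet added.
  addState-value : Bits → Bits × Carry × Bits → ℕ
  addState-value x (y , c , out) = above out (val x + (val y + cval c))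

  addStep-value : ∀ d x s → addState-value x (addStep d s) ≡ addState-value (d ∷ x) s
  addStep-value d x (y , c , out) = cong (above out) (digitwise d y c)
    where
    module _ where
      -- Here `a`, `b` are the two digits, `e` the incoming carry, `m` the digit written and `k` the
      -- outgoing carry. Each of the 18 cases only has to check `a + (b + e) ≡ m + 2 * k`.
      lemma : ∀ a b e n m k → a + (b + e) ≡ m + 2 * k → ∀ p → m + 2 * (n + (p + k)) ≡ a + 2 * n + (b + 2 * p + e)
      lemma a b e n m k eq p = begin
        m + 2 * (n + (p + k))         ≡⟨ l₁ m n p k ⟩
        m + 2 * k + (2 * n + 2 * p)   ≡⟨ cong (_+ (2 * n + 2 * p)) eq ⟨
        a + (b + e) + (2 * n + 2 * p) ≡⟨ l₂ a b e n p ⟩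
        a + 2 * n + (b + 2 * p + e)   ∎
        where
        open ≡-Reasoning
        l₁ : ∀ m n p k → m + 2 * (n + (p + k)) ≡ m + 2 * k + (2 * n + 2 * p)
        l₁ = solve-∀
        l₂ : ∀ a b e n p → a + (b + e) + (2 * n + 2 * p) ≡ a + 2 * n + (b + 2 * p + e)
        l₂ = solve-∀
    digitwise : ∀ d y c → let s = dval d + (first y + cval c) in
      dval (sumDigit s) + 2 * (val x + (val (rest′ y) + cval (sumCarry s))) ≡ dval d + 2 * val x + (val y + cval c)
    digitwise true  []          c0 = lemma 2 0 0 (val x) 2 0 refl 0
    digitwise true  []          c1 = lemma 2 0 1 (val x) 1 1 refl 0
    digitwise true  []          c2 = lemma 2 0 2 (val x) 2 1 refl 0
    digitwise true  (true ∷ y)  c0 = lemma 2 2 0 (val x) 2 1 refl (val y)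
    digitwise true  (true ∷ y)  c1 = lemma 2 2 1 (val x) 1 2 refl (val y)
    digitwise true  (true ∷ y)  c2 = lemma 2 2 2 (val x) 2 2 refl (val y)
    digitwise true  (false ∷ y) c0 = lemma 2 1 0 (val x) 1 1 refl (val y)
    digitwise true  (false ∷ y) c1 = lemma 2 1 1 (val x) 2 1 refl (val y)
    digitwise true  (false ∷ y) c2 = lemma 2 1 2 (val x) 1 2 refl (val y)
    digitwise false []          c0 = lemma 1 0 0 (val x) 1 0 refl 0
    digitwise false []          c1 = lemma 1 0 1 (val x) 2 0 refl 0
    digitwise false []          c2 = lemma 1 0 2 (val x) 1 1 refl 0
    digitwise false (true ∷ y)  c0 = lemma 1 2 0 (val x) 1 1 refl (val y)
    digitwise false (true ∷ y)  c1 = lemma 1 2 1 (val x) 2 1 refl (val y)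
    digitwise false (true ∷ y)  c2 = lemma 1 2 2 (val x) 1 2 refl (val y)
    digitwise false (false ∷ y) c0 = lemma 1 1 0 (val x) 2 0 refl (val y)
    digitwise false (false ∷ y) c1 = lemma 1 1 1 (val x) 1 1 refl (val y)
    digitwise false (false ∷ y) c2 = lemma 1 1 2 (val x) 2 1 refl (val y)

  addFold : Bits → Bits × Carry × Bits → Bits × Carry × Bits
  addFold = fold addStep

  addFold-value : ∀ x s → addState-value [] (addFold x s) ≡ addState-value x s
  addFold-value []      s = refl
  addFold-value (d ∷ x) s = trans (addFold-value x (addStep d s)) (addStep-value d x s)

  addFold-[] : ∀ x c out → proj₁ (addFold x ([] , c , out)) ≡ []
  addFold-[] []      c out = refl
  addFold-[] (d ∷ x) c out = addFold-[] x _ _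

  addFoldP : (λ (x , s) → digits x ∙ addState s) ⇒ (λ (x , s) → addState (addFold x s))
  addFoldP = foldP (λ _ → digit) (λ _ → addState) (λ _ → addStep) addStepP proj₁ proj₂ (con 7 ⊕ con 4 ⊗ 𝑛)
    λ (x , s@(y , c , out)) → bounded addState addStep
      -- A step writes one digit, of size at most 3 plus a list node, hence the allowance of 4 per
      -- remaining digit. The constant 7 covers the carry and the two nodes that pair the state.
      (λ xs (y′ , c′ , out′) → size (digits y′) + size (digits out′) + 4 * length xs ≤ size (digits y) + size (digits out) + 4 * length x)
      (λ { d xs ([] , c′ , out′) inv → ≤-trans (drop d xs 1 (dval d + cval c′) out′) inv
         ; d xs (e ∷ y′ , c′ , out′) inv → ≤-trans (≤-trans (drop d xs (size (digits y′)) (dval d + (dval e + cval c′)) out′)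
              (+-monoˡ-≤ (4 * length (d ∷ xs)) (+-monoˡ-≤ (size (digits out′)) (m≤n⇒m≤1+n (m≤n+m (size (digits y′)) (size (digit e))))))) inv })
      (λ xs s′ inv → ≤-trans (small s′) (+-monoʳ-≤ 7 (≤-trans (≤-trans (m≤m+n _ _) inv) (total x s))))
      x s ≤-refl
    where
    size-carry : ∀ c → size (carry c) ≤ 5
    size-carry c0 = s≤s z≤n
    size-carry c1 = s≤s (s≤s (s≤s z≤n))
    size-carry c2 = ≤-refl
    drop : ∀ d (xs : Bits) y s out → y + size (digits (sumDigit s ∷ out)) + 4 * length xs ≤ y + size (digits out) + 4 * length (d ∷ xs)
    drop d xs y s out = ≤-trans
      (+-monoˡ-≤ (4 * length xs) (+-monoʳ-≤ y (s≤s (+-monoˡ-≤ (size (digits out)) (size-digit (sumDigit s))))))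
      (≤-reflexive (l y (size (digits out)) (length xs)))
      where
      l : ∀ y o n → y + (4 + o) + 4 * n ≡ y + o + 4 * (1 + n)
      l = solve-∀
    small : ∀ s → size (addState s) ≤ 7 + (size (digits (proj₁ s)) + size (digits (proj₂ (proj₂ s))))
    small (y , c , out) = ≤-trans (s≤s (+-monoʳ-≤ (size (digits y)) (s≤s (+-monoˡ-≤ (size (digits out)) (size-carry c)))))
      (≤-reflexive (l (size (digits y)) (size (digits out))))
      where
      l : ∀ a b → suc (a + suc (5 + b)) ≡ 7 + (a + b)
      l = solve-∀
    total : ∀ x s → size (digits (proj₁ s)) + size (digits (proj₂ (proj₂ s))) + 4 * length x ≤ 4 * size (digits x ∙ addState s)
    total x (y , c , out) = begin
      Y + O + 4 * length x ≤⟨ +-mono-≤ (m≤n*m (Y + O) 4) (*-monoʳ-≤ 4 (length≤size digit x)) ⟩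
      4 * (Y + O) + 4 * size (digits x) ≤⟨ m≤m+n _ (4 * (3 + size (carry c))) ⟩
      4 * (Y + O) + 4 * size (digits x) + 4 * (3 + size (carry c)) ≡⟨ l Y O (size (digits x)) (size (carry c)) ⟩
      4 * size (digits x ∙ addState (y , c , out)) ∎
      where
      open ≤-Reasoning
      Y = size (digits y)
      O = size (digits out)
      l : ∀ y o x c → 4 * (y + o) + 4 * x + 4 * (3 + c) ≡ 4 * suc (x + suc (y + suc (c + o)))
      l = solve-∀

  carryBits : Carry → Bits
  carryBits c0 = []
  carryBits c1 = false ∷ []
  carryBits c2 = true ∷ []

  val-carryBits : ∀ c → val (carryBits c) ≡ cval c
  val-carryBits c0 = refl
  val-carryBits c1 = refl
  val-carryBits c2 = refl

  -- The loop ends with the digits of the first number. What is left of the second is sent through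
  -- the same loop against the empty numeral, after which only a carry remains.
  addRest : Bits × Carry × Bits → Bits × Carry × Bits
  addRest (y , c , out) = addFold y ([] , c , out)

  addFinish : Bits × Carry × Bits → Bits
  addFinish (_ , c , out) = out ʳ++ carryBits c

  addBits : Bits × Bits → Bits
  addBits (x , y) = addFinish (addRest (addFold x (y , c0 , [])))

  val-addBits : ∀ x y → val (addBits (x , y)) ≡ val x + val y
  val-addBits x y = begin
    val (addFinish (addRest s))      ≡⟨ val-addFinish (addRest s) (addFold-[] (proj₁ s) _ _) ⟩
    addState-value [] (addRest s)    ≡⟨ addFold-value (proj₁ s) _ ⟩
    addState-value (proj₁ s) ([] , proj₂ s) ≡⟨⟩
    addState-value [] s              ≡⟨ addFold-value x (y , c0 , []) ⟩
    val x + (val y + 0)              ≡⟨ cong (val x +_) (+-identityʳ (val y)) ⟩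
    val x + val y                    ∎
    where
    open ≡-Reasoning
    s = addFold x (y , c0 , [])
    val-addFinish : ∀ s → proj₁ s ≡ [] → val (addFinish s) ≡ addState-value [] s
    val-addFinish (_ , c , out) refl = trans (val-ʳ++ out (carryBits c)) (cong (above out) (val-carryBits c))

  addBitsP : (λ ((x , y) : Bits × Bits) → digits x ∙ digits y) ⇒ (λ xy → digits (addBits xy))
  addBitsP =
    expr (cons (hd v) (cons (tl v) (quoteTree (nil ∙ nil)))) (λ _ → refl) ⟫
    reindex (λ (x , y) → x , y , c0 , []) addFoldP ⟫
    expr (cons (hd v) (cons nil (tl v))) (λ _ → refl) ⟫
    reindex (λ (x , y) → let (y′ , s) = addFold x (y , c0 , []) in y′ , [] , s) addFoldP ⟫
    simple finish (λ (x , y) → finish≡ (addRest (addFold x (y , c0 , [])))) ⟫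
    revOnto (λ _ → digit) (λ (x , y) → proj₂ (proj₂ (addRest (addFold x (y , c0 , []))))) 
      (λ (x , y) → carryBits (proj₁ (proj₂ (addRest (addFold x (y , c0 , []))))))
    where
    C = hd (tl v)
    O = tl (tl v)
    finish : DecisionTree
    finish = br C (br (hd C) (ret (cons O (quoteTree (digits (carryBits c2))))) (ret (cons O (quoteTree (digits (carryBits c1))))))
                  (ret (cons O (quoteTree (digits (carryBits c0)))))
    finish≡ : ∀ s → decide finish (addState s) ≡ digits (proj₂ (proj₂ s)) ∙ digits (carryBits (proj₁ (proj₂ s)))
    finish≡ (_ , c0 , _) = refl
    finish≡ (_ , c1 , _) = refl
    finish≡ (_ , c2 , _) = refl

  addP : (λ ((x , y) : ℕ × ℕ) → ⌜ x ⌝ⁿ ∙ ⌜ y ⌝ⁿ) ⇒ (λ (x , y) → ⌜ x + y ⌝ⁿ)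
  addP = recast (λ (x , y) → cong₂ _∙_ (digits-bits x) (digits-bits y))
    (λ (x , y) → trans (digits-val (addBits (bits x , bits y)))
      (cong ⌜_⌝ⁿ (trans (val-addBits (bits x) (bits y)) (cong₂ _+_ (val-bits x) (val-bits y)))))
    (reindex (λ (x , y) → bits x , bits y) addBitsP)

  -- Comparison

  -- The digits of x and y already read decide a tie between the remaining
  -- parts; b tells that they decide it in favour of x ≤ y.
  below : Bool → ℕ → ℕ → Bool
  below true  x y = x ≤ᵇ y
  below false x y = x <ᵇ y

  -- Digits arrive from the least significant one on, so an unequal pair overrides all earlier
  -- verdicts. In bijective notation a longer numeral is the larger number: once `y` has run out, a
  -- further digit of `x` refutes x ≤ y, and digits of `y` left at the end confirm it in `leFinish`.
  leStep : Bool → Bits × Bool → Bits × Bool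
  leStep d     ([]        , b) = [] , false
  leStep true  (true ∷ y  , b) = y , b
  leStep true  (false ∷ y , b) = y , false
  leStep false (true ∷ y  , b) = y , true
  leStep false (false ∷ y , b) = y , b

  leState : Bits × Bool → Tree
  leState (y , b) = digits y ∙ bool b

  leFinish : Bits × Bool → Bool
  leFinish ([]    , b) = b
  leFinish (_ ∷ _ , _) = true

  ≤ᵇ-reflect : ∀ a b c d → (a ≤ b → c ≤ d) → (c ≤ d → a ≤ b) → (a ≤ᵇ b) ≡ (c ≤ᵇ d)
  ≤ᵇ-reflect a b c d f g with a ≤ᵇ b in p | c ≤ᵇ d in q
  ... | true  | true  = refl
  ... | false | false = refl
  ... | true  | false with () ← subst T q (≤⇒≤ᵇ (f (≤ᵇ⇒≤ a b (subst T (sym p) tt))))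
  ... | false | true  with () ← subst T p (≤⇒≤ᵇ (g (≤ᵇ⇒≤ c d (subst T (sym q) tt))))

  double-≤ : ∀ {a b} c → a ≤ b → c + 2 * a ≤ c + 2 * b
  double-≤ c a≤b = +-monoʳ-≤ c (*-monoʳ-≤ 2 a≤b)

  double-≤⁻¹ : ∀ a b c → c + 2 * a ≤ c + 2 * b → a ≤ b
  double-≤⁻¹ a b c p = *-cancelˡ-≤ {a} {b} 2 (+-cancelˡ-≤ c (2 * a) (2 * b) p)

  double-< : ∀ {a b} c → suc a ≤ b → suc (suc (c + 2 * a)) ≤ c + 2 * b
  double-< {a} {b} c p = ≤-trans (≤-reflexive (l a c)) (double-≤ c p)
    where
    l : ∀ a c → suc (suc (c + 2 * a)) ≡ c + 2 * suc a
    l = solve-∀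

  double-<⁻¹ : ∀ a b c → suc (c + 2 * a) ≤ c + 2 * b → suc a ≤ b
  double-<⁻¹ a b c p = *-cancelˡ-< 2 a b (+-cancelˡ-< c (2 * a) (2 * b) p)

  leStep-below : ∀ d x y b → below (proj₂ (leStep d (y , b))) (val x) (val (proj₁ (leStep d (y , b)))) ≡ below b (dval d + 2 * val x) (val y)
  leStep-below true  x [] true  = refl
  leStep-below true  x [] false = refl
  leStep-below false x [] true  = refl
  leStep-below false x [] false = refl
  leStep-below true  x (true ∷ y) true  = ≤ᵇ-reflect (val x) (val y) (2 + 2 * val x) (2 + 2 * val y) (double-≤ 2) (double-≤⁻¹ (val x) (val y) 2)
  leStep-below true  x (true ∷ y) false = ≤ᵇ-reflect (suc (val x)) (val y) (3 + 2 * val x) (2 + 2 * val y)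
    (λ p → ≤-trans (n≤1+n _) (double-< 2 p)) (double-<⁻¹ (val x) (val y) 2)
  leStep-below true  x (false ∷ y) true  = ≤ᵇ-reflect (suc (val x)) (val y) (2 + 2 * val x) (1 + 2 * val y)
    (λ p → ≤-trans (n≤1+n _) (double-< 1 p)) (double-<⁻¹ (val x) (val y) 1)
  leStep-below true  x (false ∷ y) false = ≤ᵇ-reflect (suc (val x)) (val y) (3 + 2 * val x) (1 + 2 * val y)
    (double-< 1) (λ p → double-<⁻¹ (val x) (val y) 1 (≤-trans (n≤1+n _) p))
  leStep-below false x (true ∷ y) true = ≤ᵇ-reflect (val x) (val y) (1 + 2 * val x) (2 + 2 * val y)
    (λ p → ≤-trans (double-≤ 1 p) (n≤1+n _)) (λ p → ≤-pred (double-<⁻¹ (val x) (suc (val y)) 0 (≤-trans p (≤-reflexive (l (val y))))))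
    where
    l : ∀ x → 2 + 2 * x ≡ 2 * suc x
    l = solve-∀
  leStep-below false x (true ∷ y) false = ≤ᵇ-reflect (val x) (val y) (2 + 2 * val x) (2 + 2 * val y) (double-≤ 2) (double-≤⁻¹ (val x) (val y) 2)
  leStep-below false x (false ∷ y) true  = ≤ᵇ-reflect (val x) (val y) (1 + 2 * val x) (1 + 2 * val y) (double-≤ 1) (double-≤⁻¹ (val x) (val y) 1)
  leStep-below false x (false ∷ y) false = ≤ᵇ-reflect (suc (val x)) (val y) (2 + 2 * val x) (1 + 2 * val y)
    (λ p → ≤-trans (n≤1+n _) (double-< 1 p)) (double-<⁻¹ (val x) (val y) 1)

  leFold-below : ∀ x s → leFinish (fold leStep x s) ≡ below (proj₂ s) (val x) (val (proj₁ s))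
  leFold-below [] ([]         , true)  = refl
  leFold-below [] ([]         , false) = refl
  leFold-below [] (true ∷ y   , true)  = refl
  leFold-below [] (true ∷ y   , false) = refl
  leFold-below [] (false ∷ y  , true)  = refl
  leFold-below [] (false ∷ y  , false) = refl
  leFold-below (d ∷ x) s = trans (leFold-below x (leStep d s)) (leStep-below d x (proj₁ s) (proj₂ s))

  leBitsP : (λ ((x , y) : Bits × Bits) → digits x ∙ digits y) ⇒ (λ (x , y) → bool (leFinish (fold leStep x (y , true))))
  leBitsP =
    expr (cons (hd v) (cons (tl v) (quoteTree (bool true)))) (λ _ → refl) ⟫
    foldP (λ _ → digit) (λ _ → leState) (λ _ → leStep) stepP proj₁ (λ (_ , y) → y , true) (con 4 ⊕ 𝑛)
      (λ (x , y) → bounded leState leStep (λ _ (y′ , _) → size (digits y′) ≤ size (digits y))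
        (λ { d xs ([] , b) inv → inv
           ; true xs (true ∷ y′ , b) inv → smaller y′ inv
           ; true xs (false ∷ y′ , b) inv → smaller y′ inv
           ; false xs (true ∷ y′ , b) inv → smaller y′ inv
           ; false xs (false ∷ y′ , b) inv → smaller y′ inv })
        (λ xs (y′ , b) inv → ≤-trans (s≤s (≤-trans (+-monoʳ-≤ (size (digits y′)) (size-bool b)) (≤-reflexive (+-comm _ 3))))
          (+-monoʳ-≤ 4 (≤-trans inv (≤-trans (m≤m+n (size (digits y)) _) (≤-trans (n≤1+n _) (≤-trans (m≤n+m _ (size (digits x))) (n≤1+n _)))))))
        x (y , true) ≤-refl) ⟫
    simple finish (λ (x , y) → finish≡ (fold leStep x (y , true)))
    where
    size-bool : ∀ b → size (bool b) ≤ 3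
    size-bool true  = ≤-refl
    size-bool false = s≤s z≤n
    smaller : ∀ {n m} y → suc (m + size (digits y)) ≤ n → size (digits y) ≤ n
    smaller {m = m} y inv = ≤-trans (m≤n⇒m≤1+n (m≤n+m _ m)) inv
    Y = hd (tl v)
    B = tl (tl v)
    step finish : DecisionTree
    step = br Y (br (hd v) (br (hd Y) (ret (cons (tl Y) B)) (ret (cons (tl Y) (quoteTree (bool true)))))
                           (br (hd Y) (ret (cons (tl Y) nil)) (ret (cons (tl Y) B))))
                (ret (cons nil nil))
    finish = br (hd v) (ret (quoteTree (bool true))) (ret (tl v))
    stepP : Step {Bits × Bits} (λ _ → digit) (λ _ → leState) (λ _ → leStep)
    stepP = simple step λ where
      (_ , true , [] , b) → refl
      (_ , false , [] , b) → refl
      (_ , true  , true ∷ y  , b) → refl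
      (_ , true  , false ∷ y , b) → refl
      (_ , false , true ∷ y  , b) → refl
      (_ , false , false ∷ y , b) → refl
    finish≡ : ∀ s → decide finish (leState s) ≡ bool (leFinish s)
    finish≡ ([] , b) = refl
    finish≡ (true ∷ y , b) = refl
    finish≡ (false ∷ y , b) = refl

  leP : (λ ((x , y) : ℕ × ℕ) → ⌜ x ⌝ⁿ ∙ ⌜ y ⌝ⁿ) ⇒ (λ (x , y) → bool (x ≤ᵇ y))
  leP = recast (λ (x , y) → cong₂ _∙_ (digits-bits x) (digits-bits y))
    (λ (x , y) → cong bool (trans (leFold-below (bits x) (bits y , true)) (cong₂ _≤ᵇ_ (val-bits x) (val-bits y))))
    (reindex (λ (x , y) → bits x , bits y) leBitsP)

  -- Sizes of numerals

  2^ : ℕ → ℕ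
  2^ k = 2 ℕ.^ k

  1≤2^ : ∀ k → 1 ≤ 2^ k
  1≤2^ k = m^n>0 2 k

  2^-mono : ∀ {k l} → k ≤ l → 2^ k ≤ 2^ l
  2^-mono = ^-monoʳ-≤ 2

  size-digits : ∀ ds → size (digits ds) ≤ 1 + 4 * length ds
  size-digits []       = ≤-refl
  size-digits (d ∷ ds) = ≤-trans (s≤s (+-mono-≤ (size-digit d) (size-digits ds))) (≤-reflexive (l (length ds)))
    where
    l : ∀ n → suc (3 + (1 + 4 * n)) ≡ 1 + 4 * suc n
    l = solve-∀

  2^length≤1+val : ∀ ds → 2^ (length ds) ≤ 1 + val ds
  2^length≤1+val []       = ≤-refl
  2^length≤1+val (d ∷ ds) = ≤-trans (*-monoʳ-≤ 2 (2^length≤1+val ds)) (≤-trans (≤-reflexive (l (val ds))) (s≤s (+-monoˡ-≤ (2 * val ds) (1≤dval d))))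
    where
    l : ∀ n → 2 * (1 + n) ≡ 1 + (1 + 2 * n)
    l = solve-∀
    1≤dval : ∀ d → 1 ≤ dval d
    1≤dval true  = s≤s z≤n
    1≤dval false = ≤-refl

  2+val≤2^1+length : ∀ ds → 2 + val ds ≤ 2^ (suc (length ds))
  2+val≤2^1+length []       = ≤-refl
  2+val≤2^1+length (d ∷ ds) = ≤-trans (+-monoʳ-≤ 2 (+-monoˡ-≤ (2 * val ds) (dval≤2 d))) (≤-trans (≤-reflexive (l (val ds))) (*-monoʳ-≤ 2 (2+val≤2^1+length ds)))
    where
    l : ∀ n → 2 + (2 + 2 * n) ≡ 2 * (2 + n)
    l = solve-∀
    dval≤2 : ∀ d → dval d ≤ 2
    dval≤2 true  = ≤-refl
    dval≤2 false = n≤1+n 1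

  2^-cancel : ∀ {k l} → 2^ k ≤ 2^ l → k ≤ l
  2^-cancel {k} {l} p = ≮⇒≥ λ l<k → <⇒≱ (^-monoʳ-< 2 (s≤s (s≤s z≤n)) l<k) p

  -- Together with the converse `<2^size`, this lets the size of intermediate numerals be controlled
  -- through their values, where conserved quantities are available.
  size-⌜⌝ : ∀ {n} k → n < 2^ k → size ⌜ n ⌝ⁿ ≤ 1 + 4 * k
  size-⌜⌝ {n} k n<2^k = ≤-trans (≤-reflexive (cong size (sym (digits-bits n)))) (≤-trans (size-digits (bits n))
    (s≤s (*-monoʳ-≤ 4 (2^-cancel {length (bits n)} {k} (≤-trans (2^length≤1+val (bits n)) (≤-trans (≤-reflexive (cong suc (val-bits n))) n<2^k))))))

  <2^size : ∀ n → n < 2^ (size ⌜ n ⌝ⁿ)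
  <2^size n = begin
    suc n                        ≡⟨ cong suc (val-bits n) ⟨
    suc (val (bits n))           ≤⟨ n≤1+n _ ⟩
    2 + val (bits n)             ≤⟨ 2+val≤2^1+length (bits n) ⟩
    2^ (suc (length (bits n)))   ≤⟨ 2^-mono (1+length≤size (bits n)) ⟩
    2^ (size (digits (bits n)))  ≡⟨ cong (λ t → 2^ (size t)) (digits-bits n) ⟩
    2^ (size ⌜ n ⌝ⁿ)             ∎
    where
    open ≤-Reasoning
    1+length≤size : ∀ ds → suc (length ds) ≤ size (digits ds)
    1+length≤size []       = ≤-refl
    1+length≤size (d ∷ ds) = s≤s (≤-trans (1+length≤size ds) (m≤n+m _ (size (digit d))))

  -- Multiplication

  mulStep : Bool → ℕ × ℕ → ℕ × ℕ
  mulStep d (y , acc) = y + y , acc + dval d * y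

  mulState : ℕ × ℕ → Tree
  mulState (y , acc) = ⌜ y ⌝ⁿ ∙ ⌜ acc ⌝ⁿ

  mulStepP : ∀ {D : Set} → Step {D} (λ _ → digit) (λ _ → mulState) (λ _ → mulStep)
  mulStepP =
    (expr (cons Y Y) (λ _ → refl) ⟫ reindex (λ (_ , d , y , acc) → y , y) addP)
    ▵ recast (λ _ → refl) (λ (_ , d , y , acc) → pick d y acc)
        (ifP {β = λ (_ , d , _) → not d} (simple (ret (hd v)) λ { (_ , true , _) → refl ; (_ , false , _) → refl })
          once
          ((once ▵ expr Y (λ _ → refl)) ⟫ reindex (λ (_ , d , y , acc) → acc + y , y) addP))
    where
    Y = hd (tl v)
    Acc = tl (tl v)
    once = expr (cons Acc Y) (λ _ → refl) ⟫ reindex (λ (_ , d , y , acc) → acc , y) addP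
    pick : ∀ d y acc → (ifᵇ not d then ⌜ acc + y ⌝ⁿ else ⌜ acc + y + y ⌝ⁿ) ≡ ⌜ acc + dval d * y ⌝ⁿ
    pick true  y acc = cong ⌜_⌝ⁿ (trans (+-assoc acc y y) (cong (λ z → acc + (y + z)) (sym (+-identityʳ y))))
    pick false y acc = cong (λ z → ⌜ acc + z ⌝ⁿ) (sym (+-identityʳ y))

  mulFold-value : ∀ x y acc → proj₂ (fold mulStep x (y , acc)) ≡ acc + val x * y
  mulFold-value []      y acc = sym (+-identityʳ acc)
  mulFold-value (d ∷ x) y acc = trans (mulFold-value x (y + y) (acc + dval d * y)) (l (dval d) (val x) y acc)
    where
    l : ∀ d n y a → a + d * y + n * (y + y) ≡ a + (d + 2 * n) * y
    l = solve-∀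

  mulP : (λ ((x , y) : ℕ × ℕ) → ⌜ x ⌝ⁿ ∙ ⌜ y ⌝ⁿ) ⇒ (λ (x , y) → ⌜ x * y ⌝ⁿ)
  mulP =
    expr (cons (hd v) (cons (tl v) nil)) (λ (x , y) → cong (_∙ (⌜ y ⌝ⁿ ∙ nil)) (sym (digits-bits x))) ⟫
    foldP (λ _ → digit) (λ _ → mulState) (λ _ → mulStep) mulStepP (λ (x , _) → bits x) (λ (_ , y) → y , 0) (con 3 ⊕ con 8 ⊗ 𝑛)
      (λ (x , y) → let N = size (digits (bits x) ∙ mulState (y , 0)) in
        bounded mulState mulStep
          -- A step changes neither quantity: the doubling of `y′` is offset by the shorter `ds`,
          -- and what `acc` gains leaves `val ds * y′`. Both therefore stay below their initial
          -- bound.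
          (λ ds (y′ , acc) → 2^ (length ds) * y′ < 2^ N × acc + val ds * y′ < 2^ N)
          (λ d ds (y′ , acc) (p , q) →
            ≤-trans (s≤s (≤-reflexive (l₁ (2^ (length ds)) y′))) p ,
            ≤-trans (s≤s (≤-reflexive (l₂ (dval d) (val ds) y′ acc))) q)
          (λ ds (y′ , acc) (p , q) → ≤-trans (s≤s (+-mono-≤
            (size-⌜⌝ N (≤-<-trans (≤-trans (≤-reflexive (sym (*-identityˡ y′))) (*-monoˡ-≤ y′ (1≤2^ (length ds)))) p))
            (size-⌜⌝ N (≤-<-trans (m≤m+n acc _) q)))) (≤-reflexive (l₃ N)))
          (bits x) (y , 0)
          ( product (digits (bits x)) (2^ (length (bits x))) y (2^-mono (length≤size digit (bits x)))
          , product (digits (bits x)) (val (bits x)) y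
              (≤-trans (≤-reflexive (val-bits x)) (≤-trans (<⇒≤ (<2^size x)) (≤-reflexive (cong (λ t → 2^ (size t)) (sym (digits-bits x))))))
          )) ⟫
    simple (ret (tl v)) (λ (x , y) → cong ⌜_⌝ⁿ (trans (mulFold-value (bits x) y 0) (cong (_* y) (val-bits x))))
    where
    l₁ : ∀ p y → p * (y + y) ≡ 2 * p * y
    l₁ = solve-∀
    l₂ : ∀ d n y a → a + d * y + n * (y + y) ≡ a + (d + 2 * n) * y
    l₂ = solve-∀
    l₃ : ∀ n → suc (1 + 4 * n + (1 + 4 * n)) ≡ 3 + 8 * n
    l₃ = solve-∀
    product : ∀ t a y → a ≤ 2^ (size t) → a * y < 2^ (size (t ∙ mulState (y , 0)))
    product t a y a≤ = begin-strict
      a * y                              ≤⟨ *-monoˡ-≤ y a≤ ⟩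
      2^ (size t) * y                    <⟨ *-monoʳ-< (2^ (size t)) {{ℕ.>-nonZero (1≤2^ (size t))}} (<2^size y) ⟩
      2^ (size t) * 2^ (size ⌜ y ⌝ⁿ)     ≡⟨ ^-distribˡ-+-* 2 (size t) (size ⌜ y ⌝ⁿ) ⟨
      2^ (size t + size ⌜ y ⌝ⁿ)          ≤⟨ 2^-mono (m≤n⇒m≤1+n (+-monoʳ-≤ (size t) (m≤n⇒m≤1+n (m≤m+n _ 1)))) ⟩
      2^ (size (t ∙ mulState (y , 0)))   ∎
      where open ≤-Reasoning

  -- Fractions

  -- (a , b) stands for a / (1 + b); fractions are never reduced.
  Fraction : Set
  Fraction = ℕ × ℕ

  -- The inner `nil` is the sign that `⌜_⌝ᶻ` puts before a nonnegative integer, so the rationals of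
  -- the input are fractions already, without conversion.
  fraction : Fraction → Tree
  fraction (a , b) = (nil ∙ ⌜ a ⌝ⁿ) ∙ ⌜ suc b ⌝ⁿ

  infixl 6 _+ᶠ_

  _+ᶠ_ : Fraction → Fraction → Fraction
  (a , b) +ᶠ (c , d) = a * suc d + c * suc b , d + b * suc d

  _≤ᶠ_ : Fraction → Fraction → Bool
  (a , b) ≤ᶠ (c , d) = a * suc d ≤ᵇ c * suc b

  0ᶠ : Fraction
  0ᶠ = 0 , 0

  num₁ den₁ num₂ den₂ : Expr 1
  num₁ = tl (hd (hd v))
  den₁ = tl (hd v)
  num₂ = tl (hd (tl v))
  den₂ = tl (tl v)

  addᶠ : (λ ((x , y) : Fraction × Fraction) → fraction x ∙ fraction y) ⇒ (λ (x , y) → fraction (x +ᶠ y))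
  addᶠ =
    (((expr (cons num₁ den₂) (λ _ → refl) ⟫ reindex (λ ((a , b) , (c , d)) → a , suc d) mulP)
      ▵ (expr (cons num₂ den₁) (λ _ → refl) ⟫ reindex (λ ((a , b) , (c , d)) → c , suc b) mulP))
     ⟫ reindex (λ ((a , b) , (c , d)) → a * suc d , c * suc b) addP)
    ▵ (expr (cons den₁ den₂) (λ _ → refl) ⟫ reindex (λ ((a , b) , (c , d)) → suc b , suc d) mulP)
    ⟫ expr (cons (cons nil (hd v)) (tl v)) (λ _ → refl)

  leᶠ : (λ ((x , y) : Fraction × Fraction) → fraction x ∙ fraction y) ⇒ (λ (x , y) → bool (x ≤ᶠ y))
  leᶠ =
    (expr (cons num₁ den₂) (λ _ → refl) ⟫ reindex (λ ((a , b) , (c , d)) → a , suc d) mulP)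
    ▵ (expr (cons num₂ den₁) (λ _ → refl) ⟫ reindex (λ ((a , b) , (c , d)) → c , suc b) mulP)
    ⟫ reindex (λ ((a , b) , (c , d)) → a * suc d , c * suc b) leP

  Fits : ℕ → Fraction → Set
  Fits k (a , b) = a < 2^ k × suc b ≤ 2^ k

  Fits-size : ∀ x → Fits (size (fraction x)) x
  Fits-size (a , b) =
    ≤-trans (<2^size a) (2^-mono {A} {S} (m≤n⇒m≤1+n (≤-trans (m≤n+m A 2) (m≤m+n (2 + A) B)))) ,
    ≤-trans (<⇒≤ (<2^size (suc b))) (2^-mono {B} {S} (m≤n⇒m≤1+n (m≤n+m B (2 + A))))
    where
    A = size ⌜ a ⌝ⁿ
    B = size ⌜ suc b ⌝ⁿ
    S = size (fraction (a , b))

  size-Fits : ∀ k x → Fits k x → size (fraction x) ≤ 9 + 8 * k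
  size-Fits k (a , b) (a< , b<) = ≤-trans
    (s≤s (+-mono-≤ (s≤s (s≤s (size-⌜⌝ k a<)))
      (size-⌜⌝ (suc k) (≤-<-trans b< (^-monoʳ-< 2 (s≤s (s≤s z≤n)) (n<1+n k))))))
    (≤-reflexive (l k))
    where
    l : ∀ k → suc (2 + (1 + 4 * k) + (1 + 4 * suc k)) ≡ 9 + 8 * k
    l = solve-∀

  -- Unreduced denominators multiply, but bit lengths only add up, with one more bit for the sum of
  -- the two cross products. The sum of a list thus has at most as many bits as the list has size,
  -- the extra bit being covered by the list node.
  Fits-+ᶠ : ∀ {k l} x y → Fits k x → Fits l y → Fits (suc (k + l)) (x +ᶠ y)
  Fits-+ᶠ {k} {l} (a , b) (c , d) (a< , b<) (c< , d<) = num , ≤-trans den (m≤m+n _ _)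
    where
    open ≤-Reasoning
    instance _ = ℕ.>-nonZero (1≤2^ k)
    instance _ = ℕ.>-nonZero (1≤2^ l)
    2^k*2^l : 2^ k * 2^ l ≡ 2^ (k + l)
    2^k*2^l = sym (^-distribˡ-+-* 2 k l)
    den : suc b * suc d ≤ 2^ (k + l)
    den = ≤-trans (*-mono-≤ b< d<) (≤-reflexive 2^k*2^l)
    num : a * suc d + c * suc b < 2^ (suc (k + l))
    num = begin-strict
      a * suc d + c * suc b      <⟨ +-mono-< (*-monoˡ-< (suc d) a<) (*-monoˡ-< (suc b) c<) ⟩
      2^ k * suc d + 2^ l * suc b ≤⟨ +-mono-≤ (*-monoʳ-≤ (2^ k) d<) (*-monoʳ-≤ (2^ l) b<) ⟩
      2^ k * 2^ l + 2^ l * 2^ k  ≡⟨ cong (2^ k * 2^ l +_) (trans (*-comm (2^ l) (2^ k)) (sym (+-identityʳ _))) ⟩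
      2 * (2^ k * 2^ l)          ≡⟨ cong (2 *_) 2^k*2^l ⟩
      2^ (suc (k + l))           ∎

  sumᶠ : List Fraction → Fraction
  sumᶠ xs = fold _+ᶠ_ xs 0ᶠ

  sumP : list fraction ⇒ (λ xs → fraction (sumᶠ xs))
  sumP =
    expr (cons v (quoteTree (fraction 0ᶠ))) (λ _ → refl) ⟫
    foldP (λ _ → fraction) (λ _ → fraction) (λ _ → _+ᶠ_) (reindex proj₂ addᶠ) (λ xs → xs) (λ _ → 0ᶠ) (con 9 ⊕ con 8 ⊗ 𝑛)
      (λ xs → bounded fraction _+ᶠ_
        (λ ys y → ∃[ k ] (Fits k y × k + size (list fraction ys) ≤ size (list fraction xs ∙ fraction 0ᶠ)))
        (λ x ys y (k , fits , k≤) → suc (size (fraction x) + k) , Fits-+ᶠ {size (fraction x)} {k} x y (Fits-size x) fits ,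
          ≤-trans (≤-reflexive (l (size (fraction x)) k (size (list fraction ys)))) k≤)
        (λ ys y (k , fits , k≤) → ≤-trans (size-Fits k y fits) (+-monoʳ-≤ 9 (*-monoʳ-≤ 8 (≤-trans (m≤m+n k _) k≤))))
        xs 0ᶠ (0 , (s≤s z≤n , ≤-refl) , m≤n⇒m≤1+n (m≤m+n _ _)))
    where
    l : ∀ x k n → suc (x + k) + n ≡ k + suc (x + n)
    l = solve-∀

  -- Maps and zips of lists

  module _ {D : Set} {X : D → Set} (env : D → Tree) (eX eY : ∀ d → X d → Tree) where

    -- A step sees only the item and the accumulator, so `env` travels in the accumulator. The list
    -- is reversed beforehand because the results are consed. No result exceeds `G` at the initial
    -- size, as `p` is always applied to parts of the initial data.
    mapP : (λ ((d , x) : Σ D X) → env d ∙ eX d x) ⇒ (λ (d , x) → eY d x) → (xs : ∀ d → List (X d)) →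
           (λ d → env d ∙ list (eX d) (xs d)) ⇒ (λ d → list (eY d) (xs d))
    mapP p xs = recast (λ _ → refl) (λ d → cong (list (eY d)) (twice d (xs d)))
      ((expr (cons (tl v) nil) (λ _ → refl) ⟫ revOnto eX xs (λ _ → []))
       ▵ expr (cons (hd v) nil) (λ _ → refl)
       ⟫ foldP eX acc (λ _ → _∷_) stepP (λ d → reverse (xs d)) (λ _ → []) B
           (λ d → bounded (acc d) _∷_ (Inv d) (preserved d) (small d) (reverse (xs d)) []
             (m≤n⇒m≤1+n (m≤m+n _ _) , ≤-refl))
       ⟫ expr (tl v) (λ _ → refl))
      where
      acc : ∀ d → List (X d) → Tree
      acc d ys = env d ∙ list (eY d) ys
      stepP : Step eX acc (λ _ → _∷_)
      stepP = expr (hd (tl v)) (λ _ → refl)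
        ▵ (expr (cons (hd (tl v)) (hd v)) (λ _ → refl) ⟫ reindex (λ (d , x , _) → d , x) p)
        ▵ expr (tl (tl v)) (λ _ → refl)
      G = _⇒_.growth p [ con 1 ⊕ (𝑛 ⊕ 𝑛) ]
      B = con 2 ⊕ (𝑛 ⊕ 𝑛 ⊗ (con 1 ⊕ G))
      N : D → ℕ
      N d = size (list (eX d) (reverse (xs d)) ∙ acc d [])
      Inv : ∀ d → List (X d) → List (X d) → Set
      Inv d ys out = size (list (eX d) ys) ≤ N d ×
        size (list (eY d) out) + length ys * (1 + ⟦ G ⟧ (N d)) ≤ 1 + length (reverse (xs d)) * (1 + ⟦ G ⟧ (N d))
      env≤N : ∀ d → size (env d) ≤ N d
      env≤N d = m≤n⇒m≤1+n (≤-trans (m≤n⇒m≤1+n (m≤m+n _ 1)) (m≤n+m _ _))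
      preserved : ∀ d y ys out → Inv d (y ∷ ys) out → Inv d ys (y ∷ out)
      preserved d y ys out (s , i) = ≤-trans (m≤n⇒m≤1+n (m≤n+m _ _)) s , ≤-trans (≤-trans
        (+-monoˡ-≤ _ (s≤s (+-monoˡ-≤ (size (list (eY d) out)) Y≤)))
        (≤-reflexive (l (⟦ G ⟧ (N d)) (size (list (eY d) out)) (length ys)))) i
        where
        Y≤ : size (eY d y) ≤ ⟦ G ⟧ (N d)
        Y≤ = ≤-trans (_⇒_.grow p (d , y)) (≤-trans (⟦⟧-mono (_⇒_.growth p)
          (s≤s (+-mono-≤ (env≤N d) (≤-trans (m≤n⇒m≤1+n (m≤m+n _ _)) s))))
          (≤-reflexive (sym (⟦⟧-subst (_⇒_.growth p) _ (N d)))))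
        l : ∀ g o n → suc (g + o) + n * (1 + g) ≡ o + (1 + n) * (1 + g)
        l = solve-∀
      small : ∀ d ys out → Inv d ys out → size (acc d out) ≤ ⟦ B ⟧ (N d)
      small d ys out (_ , i) = ≤-trans (s≤s (+-mono-≤ (env≤N d)
        (≤-trans (≤-trans (m≤m+n _ _) i) (s≤s (*-monoˡ-≤ (1 + ⟦ G ⟧ (N d)) (≤-trans (length≤size (eX d) (reverse (xs d))) (m≤n⇒m≤1+n (m≤m+n _ _))))))))
        (≤-reflexive (cong suc (+-suc (N d) _)))
      twice : ∀ d (ys : List (X d)) → fold _∷_ (reverse ys) [] ≡ ys
      twice d ys = trans (fold-ʳ++ (reverse ys) []) (reverse-involutive ys)

  module _ {D : Set} {X : D → Set} (e₁ e₂ : ∀ d → X d → Tree) where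

    zipped : ∀ d → X d → Tree
    zipped d x = e₁ d x ∙ e₂ d x

    -- Both trees list images of the same `xs`, so while the loop runs over one, `left` and `right`
    -- walk down the other. Keeping that other list as a raw tree makes the step total and spares a
    -- proof that the lengths agree.
    zipP : (xs : ∀ d → List (X d)) →
           (λ d → list (e₁ d) (xs d) ∙ list (e₂ d) (xs d)) ⇒ (λ d → list (zipped d) (xs d))
    zipP xs =
      expr (cons (hd v) (cons (tl v) nil)) (λ _ → refl) ⟫
      foldP e₁ (λ _ → pair) step (expr (cons (tl (hd (tl v))) (cons (cons (hd v) (hd (hd (tl v)))) (tl (tl v)))) (λ _ → refl))
        xs (λ d → list (e₂ d) (xs d) , nil) (con 3 ⊗ 𝑛)
        (λ d → bounded pair (step d) (Inv d) (preserved d)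
          (λ ys s i → ≤-trans (s≤s (≤-trans (m≤m+n _ _) i)) (start d))
          (xs d) _ ≤-refl) ⟫
      recast (λ d → cong pair (sym (zip-fold d (xs d) []))) (λ d → cong (list (zipped d)) (reverse-involutive (xs d)))
        (expr (cons (tl v) nil) (λ _ → refl) ⟫ revOnto zipped (λ d → reverse (xs d)) (λ _ → []))
      where
      pair : Tree × Tree → Tree
      pair (a , b) = a ∙ b
      step : ∀ d → X d → Tree × Tree → Tree × Tree
      step d x (l , out) = right l , (e₁ d x ∙ left l) ∙ out
      measure : ∀ d → List (X d) → Tree × Tree → ℕ
      measure d ys (l , out) = size l + size out + (size (list (e₁ d) ys) + 2 * length ys)
      Inv : ∀ d → List (X d) → Tree × Tree → Set
      Inv d ys s = measure d ys s ≤ measure d (xs d) (list (e₂ d) (xs d) , nil)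
      preserved : ∀ d y ys s → Inv d (y ∷ ys) s → Inv d ys (step d y s)
      preserved d y ys (nil , out) i = ≤-trans (≤-reflexive (l (size (e₁ d y)) (size out) (size (list (e₁ d) ys)) (length ys))) i
        where
        l : ∀ y o n k → 1 + suc (suc (y + 1) + o) + (n + 2 * k) ≡ 1 + o + (suc (y + n) + 2 * suc k)
        l = solve-∀
      preserved d y ys (a ∙ b , out) i = ≤-trans (≤-trans (m≤m+n _ 2) (≤-reflexive (l (size a) (size b) (size (e₁ d y)) (size out) (size (list (e₁ d) ys)) (length ys)))) i
        where
        l : ∀ a b y o n k → b + suc (suc (y + a) + o) + (n + 2 * k) + 2 ≡ suc (a + b) + o + (suc (y + n) + 2 * suc k)
        l = solve-∀
      start : ∀ d → 1 + measure d (xs d) (list (e₂ d) (xs d) , nil) ≤ 3 * size (list (e₁ d) (xs d) ∙ (list (e₂ d) (xs d) ∙ nil))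
      start d = begin
        1 + (b + 1 + (a + 2 * length (xs d)))         ≤⟨ s≤s (+-monoʳ-≤ (b + 1) (+-monoʳ-≤ a (*-monoʳ-≤ 2 (length≤size (e₁ d) (xs d))))) ⟩
        1 + (b + 1 + (a + 2 * a))                     ≤⟨ m≤m+n _ (7 + 2 * b) ⟩
        1 + (b + 1 + (a + 2 * a)) + (7 + 2 * b)       ≡⟨ l a b ⟩
        3 * suc (a + suc (b + 1))                     ∎
        where
        open ≤-Reasoning
        a = size (list (e₁ d) (xs d))
        b = size (list (e₂ d) (xs d))
        l : ∀ a b → 1 + (b + 1 + (a + 2 * a)) + (7 + 2 * b) ≡ 3 * suc (a + suc (b + 1))
        l = solve-∀
      zip-fold : ∀ d ys zs → fold (step d) ys (list (e₂ d) ys , list (zipped d) zs) ≡ (nil , list (zipped d) (ys ʳ++ zs))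
      zip-fold d []       zs = refl
      zip-fold d (y ∷ ys) zs = zip-fold d ys (y ∷ zs)

  -- The greedy algorithm on fractions

  record Costs : Set where
    field
      n m : ℕ
      f   : Fin n → Fraction
      c   : Fin n → Fin m → Fraction

  open Costs public

  -- Q r stands for (33/32) ^ r.
  Q : ℕ → Fraction
  Q zero    = 1 , 0
  Q (suc r) = let (a , b) = Q r in a * 33 , 31 + b * 32

  nextPrice : (λ r → fraction (Q r)) ⇒ (λ r → fraction (Q (suc r)))
  nextPrice =
    (expr (cons (tl (hd v)) (quoteTree ⌜ 33 ⌝ⁿ)) (λ _ → refl) ⟫ reindex (λ r → proj₁ (Q r) , 33) mulP)
    ▵ (expr (cons (tl v) (quoteTree ⌜ 32 ⌝ⁿ)) (λ _ → refl) ⟫ reindex (λ r → suc (proj₂ (Q r)) , 32) mulP)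
    ⟫ expr (cons (cons nil (hd v)) (tl v)) (λ _ → refl)

  -- Both 33 and 32 are at most 2^6, so a round adds at most 6 bits to the unreduced price.
  Fits-Q : ∀ r → Fits (1 + 6 * r) (Q r)
  Fits-Q zero    = s≤s (s≤s z≤n) , s≤s z≤n
  Fits-Q (suc r) with Q r | Fits-Q r
  ... | a , b | p , q = subst (λ k → a * 33 < k) e (<-≤-trans (*-monoˡ-< 33 p) (*-monoʳ-≤ (2^ (1 + 6 * r)) 33≤64))
                      , subst (λ k → suc b * 32 ≤ k) e (*-mono-≤ q 32≤64)
    where
    33≤64 : 33 ≤ 64
    33≤64 = m≤m+n 33 31
    32≤64 : 32 ≤ 64
    32≤64 = m≤m+n 32 32
    e : 2^ (1 + 6 * r) * 64 ≡ 2^ (1 + 6 * suc r)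
    e = trans (sym (^-distribˡ-+-* 2 (1 + 6 * r) 6)) (cong 2^ (l r))
      where
      l : ∀ r → 1 + 6 * r + 6 ≡ 1 + 6 * suc r
      l = solve-∀

  module _ (I : Costs) where

    -- Client j is assigned to facility i in round r if its entry is
    -- just (i , r).  The programs do not store the round.
    Entry Assignment : Set
    Entry      = Maybe (Fin (n I) × ℕ)
    Assignment = Fin (m I) → Entry

    -- The numeral of facility 0 is `nil`; the extra node tells a client of that facility from an
    -- unassigned one.
    entry : Entry → Tree
    entry nothing        = nil
    entry (just (i , _)) = ⌜ toℕ i ⌝ⁿ ∙ nil

    entries : Assignment → Tree
    entries a = list (λ j → entry (a j)) (allFin (m I))

    -- A facility carries its own number and its whole column of costs, so that the loops need no
    -- access by index.
    facility : Fin (n I) → Tree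
    facility i = ⌜ toℕ i ⌝ⁿ ∙ (fraction (f I i) ∙ list (λ j → fraction (c I i j)) (allFin (m I)))

    near : Fraction → Entry → Fraction → Bool
    near p e x = ifᵇ is-just e then false else x ≤ᶠ p

    nearPrices nearCosts : Fraction → Fin (n I) → Assignment → Fraction
    nearPrices p i a = sumᶠ (map (λ j → ifᵇ near p (a j) (c I i j) then p else 0ᶠ) (allFin (m I)))
    nearCosts  p i a = sumᶠ (map (λ j → ifᵇ near p (a j) (c I i j) then c I i j else 0ᶠ) (allFin (m I)))

    half : Fraction
    half = 1 , 1

    waiting : Assignment → Fraction
    waiting a = sumᶠ (map (λ j → ifᵇ is-just (a j) then 0ᶠ else half) (allFin (m I)))

    -- The condition Σ (p - c) ≥ f + K over the near unassigned clients, with the costs moved to the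
    -- other side since fractions have no subtraction.
    affordable : ℕ → Fraction → Fin (n I) → Assignment → Bool
    affordable r K i a = ((f I i +ᶠ K) +ᶠ nearCosts (Q (suc r)) i a) ≤ᶠ nearPrices (Q (suc r)) i a

    assign : ℕ → Fin (n I) → Assignment → Assignment
    assign r i a j = ifᵇ near (Q (suc r)) (a j) (c I i j) then just (i , r) else a j

    Sites : Set
    Sites = List (Fin (n I)) × List (Fin (n I)) × Assignment

    State : Set
    State = ℕ × Sites

    reconnect : ℕ → List (Fin (n I)) → Assignment → Assignment
    reconnect r = fold (assign r)

    tryOpen : ℕ → Fraction → Fin (n I) → Sites → Sites
    tryOpen r K i (O , C , a) =
      ifᵇ affordable r K i a then (i ∷ O , C , assign r i a) else (O , i ∷ C , a)

    facilities : List (Fin (n I)) → Tree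
    facilities = list facility

    sites : Sites → Tree
    sites (O , C , a) = facilities O ∙ (facilities C ∙ entries a)

    pass : ℕ → Fraction → List (Fin (n I)) → Sites → Sites
    pass r K = fold (tryOpen r K)

    round : State → State
    -- `waiting` is taken at `a`, before the reconnections, and kept for the whole pass: it is an
    -- upper bound on the waiting caused by each opening of the round, and exactly the number that
    -- the dual solution has to account for.
    round (r , O , C , a) = suc r , pass r (waiting a) C (O , [] , reconnect r O a)

    state : State → Tree
    state (r , s) = fraction (Q (suc r)) ∙ sites s

    rounds : List ⊤ → State → State
    rounds = fold (λ _ → round)

  -- Programs for one round and for all rounds

  sumMapP : ∀ {D : Set} {X : D → Set} (g : ∀ d → X d → Fraction) (xs : ∀ d → List (X d)) →
            (λ d → list (λ x → fraction (g d x)) (xs d)) ⇒ (λ d → fraction (sumᶠ (map (g d) (xs d))))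
  sumMapP g xs = recast (λ d → cong listTree (sym (map-∘ (xs d)))) (λ _ → refl)
    (reindex (λ d → map (g d) (xs d)) sumP)

  nearP : (λ ((I , p , e , x) : Σ Costs λ I → Fraction × Entry I × Fraction) → fraction p ∙ (entry I e ∙ fraction x)) ⇒
          (λ (I , p , e , x) → bool (near I p e x))
  nearP = recast (λ _ → refl) (λ { (I , p , nothing , x) → refl ; (I , p , just _ , x) → refl })
    (ifP {c = λ (I , p , e , x) → bool (x ≤ᶠ p)} {β = λ (I , p , e , x) → is-just e}
      (simple (br (hd (tl v)) (ret (cons nil nil)) (ret nil)) λ { (I , p , nothing , x) → refl ; (I , p , just _ , x) → refl })
      (expr {b = λ _ → nil} nil (λ _ → refl))
      (expr (cons (tl (tl v)) (hd v)) (λ _ → refl) ⟫ reindex (λ (I , p , e , x) → x , p) leᶠ))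

  waitingP : (λ ((I , a) : Σ Costs Assignment) → entries I a) ⇒ (λ (I , a) → fraction (waiting I a))
  waitingP =
    expr (cons nil v) (λ _ → refl) ⟫
    mapP (λ _ → nil) (λ (I , a) j → entry I (a j)) _
      (simple (br (tl v) (ret (quoteTree (fraction 0ᶠ))) (ret (quoteTree (fraction (1 , 1)))))
        λ ((I , a) , j) → chosen I (a j))
      (λ (I , a) → allFin (m I)) ⟫
    sumMapP (λ (I , a) j → ifᵇ is-just (a j) then 0ᶠ else half I) (λ (I , a) → allFin (m I))
    where
    chosen : ∀ I e → decide (br (tl v) (ret (quoteTree (fraction 0ᶠ))) (ret (quoteTree (fraction (1 , 1))))) (nil ∙ entry I e) ≡
             fraction (ifᵇ is-just e then 0ᶠ else half I)
    chosen I nothing  = refl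
    chosen I (just _) = refl

  Site : Set
  Site = Σ Costs λ I → ℕ × Fin (n I) × Assignment I

  clients : (s : Site) → List (Fin (m (proj₁ s)))
  clients (I , _) = allFin (m I)

  offer : (s : Site) → Fin (m (proj₁ s)) → Tree
  offer (I , r , i , a) j = entry I (a j) ∙ fraction (c I i j)

  nearSum : (g : Fraction → Fraction → Fraction) →
            (λ ((x , y) : Fraction × Fraction) → fraction x ∙ fraction y) ⇒ (λ (x , y) → fraction (g x y)) →
            (λ s@(I , r , i , a) → fraction (Q (suc r)) ∙ list (offer s) (clients s)) ⇒
            (λ s@(I , r , i , a) → fraction (sumᶠ (map (λ j → ifᵇ near I (Q (suc r)) (a j) (c I i j) then g (Q (suc r)) (c I i j) else 0ᶠ) (clients s))))
  nearSum g gP =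
    mapP (λ (I , r , i , a) → fraction (Q (suc r))) offer _
      (recast (λ _ → refl) (λ ((I , r , i , a) , j) → pick (near I (Q (suc r)) (a j) (c I i j)) (g (Q (suc r)) (c I i j)))
        (ifP {β = λ ((I , r , i , a) , j) → near I (Q (suc r)) (a j) (c I i j)}
          (reindex (λ ((I , r , i , a) , j) → I , Q (suc r) , a j , c I i j) nearP)
          (expr (cons (hd v) (tl (tl v))) (λ _ → refl) ⟫ reindex (λ ((I , r , i , a) , j) → Q (suc r) , c I i j) gP)
          (expr {b = λ _ → fraction 0ᶠ} (quoteTree (fraction 0ᶠ)) (λ _ → refl))))
      clients ⟫
    sumMapP (λ (I , r , i , a) j → ifᵇ near I (Q (suc r)) (a j) (c I i j) then g (Q (suc r)) (c I i j) else 0ᶠ) clients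
    where
    pick : ∀ b x → (ifᵇ b then fraction x else fraction 0ᶠ) ≡ fraction (ifᵇ b then x else 0ᶠ)
    pick true  x = refl
    pick false x = refl

  offersP : (λ s@(I , r , i , a) → fraction (Q (suc r)) ∙ (facility I i ∙ entries I a)) ⇒
            (λ s@(I , r , i , a) → fraction (Q (suc r)) ∙ list (offer s) (clients s))
  offersP = expr (hd v) (λ _ → refl) ▵
    (expr (cons (tl (tl v)) (tl (tl (hd (tl v))))) (λ _ → refl) ⟫ zipP (λ (I , r , i , a) j → entry I (a j)) (λ (I , r , i , a) j → fraction (c I i j)) clients)

  affordableP : (λ ((s@(I , r , i , a) , K) : Site × Fraction) → fraction K ∙ (fraction (Q (suc r)) ∙ (facility I i ∙ entries I a))) ⇒
                (λ ((I , r , i , a) , K) → bool (affordable I r K i a))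
  affordableP =
    (((expr (cons (hd (tl (hd (tl (tl v))))) (hd v)) (λ _ → refl) ⟫ reindex (λ ((I , r , i , a) , K) → f I i , K) addᶠ)
      ▵ (offers ⟫ reindex proj₁ (nearSum (λ p x → x) (expr (tl v) (λ _ → refl)))))
     ⟫ reindex (λ ((I , r , i , a) , K) → f I i +ᶠ K , nearCosts I (Q (suc r)) i a) addᶠ)
    ▵ (offers ⟫ reindex proj₁ (nearSum (λ p x → p) (expr (hd v) (λ _ → refl))))
    ⟫ reindex (λ ((I , r , i , a) , K) → (f I i +ᶠ K) +ᶠ nearCosts I (Q (suc r)) i a , nearPrices I (Q (suc r)) i a) leᶠ
    where
    offers = expr (tl v) (λ _ → refl) ⟫ reindex {E = Site × Fraction} proj₁ offersP

  assignP : (λ s@(I , r , i , a) → fraction (Q (suc r)) ∙ (facility I i ∙ entries I a)) ⇒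
            (λ s@(I , r , i , a) → entries I (assign I r i a))
  assignP =
    (expr (cons (hd v) (hd (hd (tl v)))) (λ _ → refl) ▵ (offersP ⟫ expr (tl v) (λ _ → refl))) ⟫
    mapP (λ (I , r , i , a) → fraction (Q (suc r)) ∙ ⌜ toℕ i ⌝ⁿ) offer _
      (recast (λ _ → refl) (λ ((I , r , i , a) , j) → pick I r i (near I (Q (suc r)) (a j) (c I i j)) (a j))
        (ifP {β = λ ((I , r , i , a) , j) → near I (Q (suc r)) (a j) (c I i j)}
          (expr (cons (hd (hd v)) (tl v)) (λ _ → refl) ⟫ reindex (λ ((I , r , i , a) , j) → I , Q (suc r) , a j , c I i j) nearP)
          (expr {b = λ ((I , r , i , a) , j) → ⌜ toℕ i ⌝ⁿ ∙ nil} (cons (tl (hd v)) nil) (λ _ → refl))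
          (expr {b = λ ((I , r , i , a) , j) → entry I (a j)} (hd (tl v)) (λ _ → refl))))
      clients
    where
    pick : ∀ I r i b e → (ifᵇ b then ⌜ toℕ i ⌝ⁿ ∙ nil else entry I e) ≡ entry I (ifᵇ b then just (i , r) else e)
    pick I r i true  e = refl
    pick I r i false e = refl

  length-allFin : ∀ k → length (allFin k) ≡ k
  length-allFin k = length-tabulate {n = k} (λ j → j)

  size-list-≤ : ∀ {X : Set} (e e′ : X → Tree) K → (∀ x → size (e x) ≤ size (e′ x) + K) →
                ∀ xs → size (list e xs) ≤ size (list e′ xs) + length xs * K
  size-list-≤ e e′ K e≤e′ []       = ≤-refl
  size-list-≤ e e′ K e≤e′ (x ∷ xs) = s≤s (≤-trans (+-mono-≤ (e≤e′ x) (size-list-≤ e e′ K e≤e′ xs))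
    (≤-reflexive (l (size (e′ x)) K (size (list e′ xs)) (length xs))))
    where
    l : ∀ a k b n → a + k + (b + n * k) ≡ a + b + (1 + n) * k
    l = solve-∀

  module _ (I : Costs) where

    -- A new entry consists of the numeral of `i` and little else, and that numeral is part of
    -- `facility I i`. Processing `i` thus costs at most one copy of the facility per client.
    size-assign : ∀ r i a → size (entries I (assign I r i a)) ≤ size (entries I a) + m I * size (facility I i)
    size-assign r i a = ≤-trans
      (size-list-≤ (λ j → entry I (assign I r i a j)) (λ j → entry I (a j)) (size (facility I i))
        (λ j → entry≤ (near I (Q (suc r)) (a j) (c I i j)) (a j)) (allFin (m I)))
      (≤-reflexive (cong (λ k → size (entries I a) + k * size (facility I i)) (length-allFin (m I))))
      where
      entry≤ : ∀ b e → size (entry I (ifᵇ b then just (i , r) else e)) ≤ size (entry I e) + size (facility I i)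
      entry≤ false e = m≤m+n _ _
      entry≤ true  e = ≤-trans (s≤s (+-monoʳ-≤ (size ⌜ toℕ i ⌝ⁿ) (1≤size (fraction (f I i) ∙ list (λ j → fraction (c I i j)) (allFin (m I))))))
        (m≤n+m (size (facility I i)) (size (entry I e)))

    m≤entries : ∀ a → m I ≤ size (entries I a)
    m≤entries a = ≤-trans (≤-reflexive (sym (length-allFin (m I)))) (length≤size (λ j → entry I (a j)) (allFin (m I)))

    -- Every facility still to be processed may enlarge the entries of all clients.
    Budget : List (Fin (n I)) → Assignment I → ℕ
    Budget is a = size (entries I a) + m I * size (facilities I is)

    Budget-assign : ∀ r i is a → Budget is (assign I r i a) ≤ Budget (i ∷ is) a
    Budget-assign r i is a = ≤-trans (+-monoˡ-≤ (m I * size (facilities I is)) (size-assign r i a))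
      (≤-trans (m≤m+n _ (m I)) (≤-reflexive (l (size (entries I a)) (m I) (size (facility I i)) (size (facilities I is)))))
      where
      l : ∀ a k x y → a + k * x + k * y + k ≡ a + k * suc (x + y)
      l = solve-∀

    Budget-tail : ∀ i is a → Budget is a ≤ Budget (i ∷ is) a
    Budget-tail i is a = +-monoʳ-≤ (size (entries I a)) (*-monoʳ-≤ (m I) (m≤n⇒m≤1+n (m≤n+m _ _)))

    Budget-reconnect : ∀ r is a → Budget [] (reconnect I r is a) ≤ Budget is a
    Budget-reconnect r []       a = ≤-refl
    Budget-reconnect r (i ∷ is) a = ≤-trans (Budget-reconnect r is (assign I r i a)) (Budget-assign r i is a)

    facilitiesSize : List (Fin (n I)) → Sites I → ℕ
    facilitiesSize is (O , C , _) = size (facilities I O) + size (facilities I C) + size (facilities I is)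

    facilitiesSize-tryOpen : ∀ r K i is s → facilitiesSize is (tryOpen I r K i s) ≡ facilitiesSize (i ∷ is) s
    facilitiesSize-tryOpen r K i is (O , C , a) with affordable I r K i a
    ... | true  = l (size (facility I i)) (size (facilities I O)) (size (facilities I C)) (size (facilities I is))
      where
      l : ∀ x a b y → suc (x + a) + b + y ≡ a + b + suc (x + y)
      l = solve-∀
    ... | false = l (size (facility I i)) (size (facilities I O)) (size (facilities I C)) (size (facilities I is))
      where
      l : ∀ x a b y → a + suc (x + b) + y ≡ a + b + suc (x + y)
      l = solve-∀

    facilitiesSize-pass : ∀ r K is s → facilitiesSize [] (pass I r K is s) ≡ facilitiesSize is s
    facilitiesSize-pass r K []       s = refl
    facilitiesSize-pass r K (i ∷ is) s = trans (facilitiesSize-pass r K is _) (facilitiesSize-tryOpen r K i is s)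

    Budget-tryOpen : ∀ r K i is s → Budget is (proj₂ (proj₂ (tryOpen I r K i s))) ≤ Budget (i ∷ is) (proj₂ (proj₂ s))
    Budget-tryOpen r K i is (O , C , a) with affordable I r K i a
    ... | true  = Budget-assign r i is a
    ... | false = Budget-tail i is a

    Budget-pass : ∀ r K is s → Budget [] (proj₂ (proj₂ (pass I r K is s))) ≤ Budget is (proj₂ (proj₂ s))
    Budget-pass r K []       s = ≤-refl
    Budget-pass r K (i ∷ is) s = ≤-trans (Budget-pass r K is _) (Budget-tryOpen r K i is s)

  reconnectP : (λ ((I , r , O , a) : Σ Costs λ I → ℕ × List (Fin (n I)) × Assignment I) → facilities I O ∙ (fraction (Q (suc r)) ∙ entries I a)) ⇒
               (λ (I , r , O , a) → fraction (Q (suc r)) ∙ entries I (reconnect I r O a))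
  reconnectP =
    foldP (λ (I , _) → facility I) (λ (I , r , _) a → fraction (Q (suc r)) ∙ entries I a) (λ (I , r , _) → assign I r)
      (expr (hd (tl v)) (λ _ → refl) ▵ (expr (cons (hd (tl v)) (cons (hd v) (tl (tl v)))) (λ _ → refl) ⟫ reindex (λ ((I , r , _) , i , a) → I , r , i , a) assignP))
      (λ (I , r , O , a) → O) (λ (I , r , O , a) → a) (𝑛 ⊕ 𝑛 ⊗ 𝑛)
      λ (I , r , O , a) → bounded (λ a → fraction (Q (suc r)) ∙ entries I a) (assign I r)
        (λ is a′ → Budget I is a′ ≤ Budget I O a)
        (λ i is a′ → ≤-trans (Budget-assign I r i is a′))
        (λ is a′ inv → small I r O a (size (entries I a′)) (≤-trans (m≤m+n _ _) inv))
        O a ≤-refl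
    where
    small : ∀ I r O a x → x ≤ Budget I O a → suc (size (fraction (Q (suc r))) + x) ≤
            ⟦ 𝑛 ⊕ 𝑛 ⊗ 𝑛 ⟧ (size (facilities I O ∙ (fraction (Q (suc r)) ∙ entries I a)))
    small I r O a x x≤ = begin
      suc (q + x)                 ≤⟨ s≤s (+-monoʳ-≤ q x≤) ⟩
      suc (q + (e + m I * o))     ≤⟨ m≤n⇒m≤1+n (s≤s (≤-trans (≤-reflexive (sym (+-assoc q e _))) (+-monoʳ-≤ (q + e) (*-mono-≤ mI≤N o≤N)))) ⟩
      suc (suc (q + e + N * N))   ≤⟨ m≤n+m _ o ⟩
      o + suc (suc (q + e + N * N)) ≡⟨ l o q e (N * N) ⟩
      N + N * N                   ∎
      where
      open ≤-Reasoning
      q = size (fraction (Q (suc r)))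
      e = size (entries I a)
      o = size (facilities I O)
      N = size (facilities I O ∙ (fraction (Q (suc r)) ∙ entries I a))
      o≤N : o ≤ N
      o≤N = m≤n⇒m≤1+n (m≤m+n _ _)
      mI≤N : m I ≤ N
      mI≤N = ≤-trans (m≤entries I a) (m≤n⇒m≤1+n (≤-trans (m≤n⇒m≤1+n (m≤n+m e q)) (m≤n+m _ o)))
      l : ∀ o q e k → o + suc (suc (q + e + k)) ≡ suc (o + suc (q + e)) + k
      l = solve-∀

  Round : Set
  Round = Σ Costs λ I → ℕ × Fraction

  passState : ((I , r , K) : Round) → Sites I → Tree
  passState (I , r , K) s = (fraction (Q (suc r)) ∙ fraction K) ∙ sites I s

  tryOpenP : Step (λ (I , _) → facility I) passState (λ (I , r , K) → tryOpen I r K)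
  tryOpenP = recast (λ _ → refl) (λ ((I , r , K) , i , O , C , a) → pick I r K i O C a)
    (ifP {b = λ ((I , r , K) , i , O , C , a) → passState (I , r , K) (i ∷ O , C , assign I r i a)}
         {c = λ ((I , r , K) , i , O , C , a) → passState (I , r , K) (O , i ∷ C , a)}
         {β = λ ((I , r , K) , i , O , C , a) → affordable I r K i a}
      (expr (cons K̂ (cons P̂ (cons F̂ Â))) (λ _ → refl) ⟫ reindex (λ ((I , r , K) , i , O , C , a) → (I , r , i , a) , K) affordableP)
      (expr (hd (tl v)) (λ _ → refl) ▵ expr (cons F̂ Ô) (λ _ → refl) ▵ expr Ĉ (λ _ → refl)
        ▵ (expr (cons P̂ (cons F̂ Â)) (λ _ → refl) ⟫ reindex (λ ((I , r , K) , i , O , C , a) → I , r , i , a) assignP))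
      (expr (cons (hd (tl v)) (cons Ô (cons (cons F̂ Ĉ) Â))) (λ _ → refl)))
    where
    F̂ P̂ K̂ Ô Ĉ Â : Expr 1
    F̂ = hd v
    P̂ = hd (hd (tl v))
    K̂ = tl (hd (tl v))
    Ô = hd (tl (tl v))
    Ĉ = hd (tl (tl (tl v)))
    Â = tl (tl (tl (tl v)))
    pick : ∀ I r K i O C a →
      (ifᵇ affordable I r K i a then passState (I , r , K) (i ∷ O , C , assign I r i a) else passState (I , r , K) (O , i ∷ C , a))
      ≡ passState (I , r , K) (tryOpen I r K i (O , C , a))
    pick I r K i O C a with affordable I r K i a
    ... | true  = refl
    ... | false = refl

  passP : (λ ((I , r , K , is , s) : Σ Costs λ I → ℕ × Fraction × List (Fin (n I)) × Sites I) → facilities I is ∙ passState (I , r , K) s) ⇒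
          (λ (I , r , K , is , s) → passState (I , r , K) (pass I r K is s))
  passP =
    foldP (λ (I , _) → facility I) (λ (I , r , K , _) → passState (I , r , K)) (λ (I , r , K , _) → tryOpen I r K)
      (reindex (λ ((I , r , K , _) , x) → (I , r , K) , x) tryOpenP)
      (λ (I , r , K , is , s) → is) (λ (I , r , K , is , s) → s) (𝑛 ⊕ 𝑛 ⊗ 𝑛)
      λ (I , r , K , is , s) → bounded (passState (I , r , K)) (tryOpen I r K)
        (λ is′ s′ → facilitiesSize I is′ s′ ≤ facilitiesSize I is s × Budget I is′ (proj₂ (proj₂ s′)) ≤ Budget I is (proj₂ (proj₂ s)))
        (λ i is′ s′ (p , q) → ≤-trans (≤-reflexive (facilitiesSize-tryOpen I r K i is′ s′)) p , ≤-trans (Budget-tryOpen I r K i is′ s′) q)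
        (λ is′ s′ (p , q) → small I r K is s s′ (≤-trans (m≤m+n _ _) p) (≤-trans (m≤m+n _ _) q))
        is s (≤-refl , ≤-refl)
    where
    small : ∀ I r K is s s′ → size (facilities I (proj₁ s′)) + size (facilities I (proj₁ (proj₂ s′))) ≤ facilitiesSize I is s →
            size (entries I (proj₂ (proj₂ s′))) ≤ Budget I is (proj₂ (proj₂ s)) →
            size (passState (I , r , K) s′) ≤ ⟦ 𝑛 ⊕ 𝑛 ⊗ 𝑛 ⟧ (size (facilities I is ∙ passState (I , r , K) s))
    small I r K is s@(O , C , a) s′@(O′ , C′ , a′) p q = begin
      suc (k + suc (o′ + suc (c′ + e′)))           ≡⟨ l₁ k o′ c′ e′ ⟩
      suc (suc (suc (k + (o′ + c′) + e′)))         ≤⟨ s≤s (s≤s (s≤s (+-mono-≤ (+-monoʳ-≤ k p) q))) ⟩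
      suc (suc (suc (k + (o + cc + i) + (e + m I * i)))) ≤⟨ s≤s (s≤s (s≤s (+-monoʳ-≤ (k + (o + cc + i)) (+-monoʳ-≤ e (*-mono-≤ mI≤N i≤N))))) ⟩
      suc (suc (suc (k + (o + cc + i) + (e + N * N)))) ≤⟨ n≤1+n _ ⟩
      suc (suc (suc (suc (k + (o + cc + i) + (e + N * N))))) ≡⟨ l₂ k o cc i e (N * N) ⟩
      N + N * N                                    ∎
      where
      open ≤-Reasoning
      k = size (fraction (Q (suc r)) ∙ fraction K)
      o = size (facilities I O)
      cc = size (facilities I C)
      e = size (entries I a)
      i = size (facilities I is)
      o′ = size (facilities I O′)
      c′ = size (facilities I C′)
      e′ = size (entries I a′)
      N = size (facilities I is ∙ passState (I , r , K) s)
      i≤N : i ≤ N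
      i≤N = m≤n⇒m≤1+n (m≤m+n _ _)
      l₁ : ∀ k o c e → suc (k + suc (o + suc (c + e))) ≡ suc (suc (suc (k + (o + c) + e)))
      l₁ = solve-∀
      l₂ : ∀ k o c i e x → suc (suc (suc (suc (k + (o + c + i) + (e + x))))) ≡ suc (i + suc (k + suc (o + suc (c + e)))) + x
      l₂ = solve-∀
      mI≤N : m I ≤ N
      mI≤N = ≤-trans (m≤entries I a) (≤-trans (m≤n+m e (suc (suc (suc (suc (k + (o + cc + i))))))) (≤-reflexive (trans (cong (suc ∘ suc ∘ suc ∘ suc) (cong (k + (o + cc + i) +_) (sym (+-identityʳ e)))) (trans (l₂ k o cc i e 0) (+-identityʳ N)))))
        where open import Function using (_∘_)

  roundP : (λ ((I , s) : Σ Costs State) → state I s) ⇒ (λ (I , s) → state I (round I s))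
  roundP =
    (expr P̂ (λ _ → refl) ▵ (expr Â (λ _ → refl) ⟫ reindex (λ (I , r , O , C , a) → I , a) waitingP) ▵ expr Ô (λ _ → refl) ▵ expr Ĉ (λ _ → refl)
      ▵ (expr (cons Ô (cons P̂ Â)) (λ _ → refl) ⟫ reindex (λ (I , r , O , C , a) → I , r , O , a) reconnectP ⟫ expr (tl v) (λ _ → refl))) ⟫
    expr (cons (hd (tl (tl (tl v)))) (cons (cons (hd v) (hd (tl v))) (cons (hd (tl (tl v))) (cons nil (tl (tl (tl (tl v)))))))) (λ _ → refl) ⟫
    reindex (λ (I , r , O , C , a) → I , r , waiting I a , C , (O , [] , reconnect I r O a)) passP ⟫
    (expr (hd (hd v)) (λ _ → refl) ⟫ reindex (λ (I , r , _) → suc r) nextPrice) ▵ expr (tl v) (λ _ → refl)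
    where
    P̂ Ô Ĉ Â : Expr 1
    P̂ = hd v
    Ô = hd (tl v)
    Ĉ = hd (tl (tl v))
    Â = tl (tl (tl v))

  unassigned : ∀ I → Assignment I
  unassigned I _ = nothing

  initial : ∀ I → List (Fin (n I)) → State I
  initial I C = 0 , [] , C , unassigned I

  tick : ⊤ → Tree
  tick _ = nil

  module _ (I : Costs) where

    siteSize : Sites I → ℕ
    siteSize (O , C , _) = size (facilities I O) + size (facilities I C)

    siteSize-round : ∀ r s → siteSize (proj₂ (round I (r , s))) ≡ siteSize s
    siteSize-round r s@(O , C , a) = +-cancelʳ-≡ 1 _ _ (trans (facilitiesSize-pass I r (waiting I a) C (O , [] , reconnect I r O a))
      (l (size (facilities I O)) (size (facilities I C))))
      where
      l : ∀ a b → a + 1 + b ≡ a + b + 1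
      l = solve-∀

    entries-round : ∀ r s → let (_ , _ , _ , a′) = round I (r , s) in
      size (entries I a′) ≤ size (entries I (proj₂ (proj₂ s))) + m I * siteSize s
    entries-round r s@(O , C , a) = begin
      size (entries I a′)                               ≤⟨ m≤m+n _ _ ⟩
      Budget I [] a′                                    ≤⟨ Budget-pass I r (waiting I a) C (O , [] , a₁) ⟩
      size (entries I a₁) + m I * cc                    ≤⟨ +-monoˡ-≤ (m I * cc) (≤-trans (m≤m+n _ (m I * 1)) (Budget-reconnect I r O a)) ⟩
      size (entries I a) + m I * o + m I * cc           ≡⟨ l (size (entries I a)) (m I) o cc ⟩
      size (entries I a) + m I * (o + cc)               ∎
      where
      open ≤-Reasoning
      a₁ = reconnect I r O a
      a′ = proj₂ (proj₂ (proj₂ (round I (r , s))))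
      o = size (facilities I O)
      cc = size (facilities I C)
      l : ∀ e k o c → e + k * o + k * c ≡ e + k * (o + c)
      l = solve-∀

  roundsP : (λ ((I , ts , C) : Σ Costs λ I → List ⊤ × List (Fin (n I))) → list tick ts ∙ state I (initial I C)) ⇒
            (λ (I , ts , C) → state I (rounds I ts (initial I C)))
  roundsP = foldP (λ _ → tick) (λ (I , _) → state I) (λ (I , _) _ → round I)
    (expr (tl v) (λ _ → refl) ⟫ reindex (λ ((I , _) , _ , s) → I , s) roundP)
    (λ (I , ts , C) → ts) (λ (I , ts , C) → initial I C)
    (con 68 ⊕ con 48 ⊗ 𝑛 ⊕ 𝑛 ⊕ (𝑛 ⊕ 𝑛 ⊗ (𝑛 ⊗ 𝑛)))
    λ (I , ts , C) → bounded (state I) (λ _ → round I)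
      (Inv I ts C)
      (λ _ us (r , s) (p , q , e) → ≤-trans (≤-reflexive (sym (+-suc r (length us)))) p , trans (siteSize-round I r s) q ,
        (let open ≤-Reasoning in begin
          size (entries I (proj₂ (proj₂ (proj₂ (round I (r , s)))))) + length us * (m I * W I C)
            ≤⟨ +-monoˡ-≤ _ (entries-round I r s) ⟩
          size (entries I (proj₂ (proj₂ s))) + m I * siteSize I s + length us * (m I * W I C)
            ≡⟨ cong (λ w → size (entries I (proj₂ (proj₂ s))) + m I * w + length us * (m I * W I C)) q ⟩
          size (entries I (proj₂ (proj₂ s))) + m I * W I C + length us * (m I * W I C)
            ≡⟨ +-assoc (size (entries I (proj₂ (proj₂ s)))) _ _ ⟩
          size (entries I (proj₂ (proj₂ s))) + (m I * W I C + length us * (m I * W I C))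
            ≤⟨ e ⟩
          size (entries I (unassigned I)) + length ts * (m I * W I C) ∎))
      (λ us s → small I ts C us s)
      ts (initial I C) (≤-refl , refl , ≤-refl)
    where
    W : ∀ I → List (Fin (n I)) → ℕ
    W I C = siteSize I (proj₂ (initial I C))
    -- Facilities only move between the two lists, so `siteSize` is constant. A round enlarges the
    -- entries by at most `m I * W I C`, which is set aside for every remaining tick, and the round
    -- number bounds the size of the price.
    Inv : ∀ I (ts : List ⊤) → List (Fin (n I)) → List ⊤ → State I → Set
    Inv I ts C us (r , s) = r + length us ≤ length ts × siteSize I s ≡ W I C ×
      size (entries I (proj₂ (proj₂ s))) + length us * (m I * W I C) ≤ size (entries I (unassigned I)) + length ts * (m I * W I C)
    small : ∀ I ts C us s → Inv I ts C us s → size (state I s) ≤ ⟦ con 68 ⊕ con 48 ⊗ 𝑛 ⊕ 𝑛 ⊕ (𝑛 ⊕ 𝑛 ⊗ (𝑛 ⊗ 𝑛)) ⟧ (size (list tick ts ∙ state I (initial I C)))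
    small I ts C us (r , O , C′ , a) (p , q , e) = begin
      suc (size (fraction (Q (suc r))) + suc (o + suc (cc + x))) ≡⟨ l₁ (size (fraction (Q (suc r)))) o cc x ⟩
      3 + size (fraction (Q (suc r))) + (o + cc) + x
        ≤⟨ +-mono-≤ (+-mono-≤ (+-monoʳ-≤ 3 (size-Fits (1 + 6 * suc r) (Q (suc r)) (Fits-Q (suc r)))) (≤-trans (≤-reflexive q) W≤N)) x≤ ⟩
      3 + (9 + 8 * (1 + 6 * suc r)) + N + (N + N * (N * N)) ≡⟨ l₂ r N ⟩
      68 + 48 * r + N + (N + N * (N * N))
        ≤⟨ +-monoˡ-≤ _ (+-monoˡ-≤ N (+-monoʳ-≤ 68 (*-monoʳ-≤ 48 (≤-trans (m≤m+n r _) (≤-trans p ts≤N))))) ⟩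
      68 + 48 * N + N + (N + N * (N * N)) ∎
      where
      open ≤-Reasoning
      o = size (facilities I O)
      cc = size (facilities I C′)
      x = size (entries I a)
      N = size (list tick ts ∙ state I (initial I C))
      T₀ = size (list tick ts)
      q₀ = size (fraction (Q 1))
      C₀ = size (facilities I C)
      x₀ = size (entries I (unassigned I))
      ts≤N : length ts ≤ N
      ts≤N = ≤-trans (length≤size tick ts) (m≤n⇒m≤1+n (m≤m+n _ _))
      W≤N : W I C ≤ N
      W≤N = ≤-trans (m≤m+n (1 + C₀) (4 + T₀ + q₀ + x₀)) (≤-reflexive (l C₀ T₀ q₀ x₀))
        where
        l : ∀ c t q x → 1 + c + (4 + t + q + x) ≡ suc (t + suc (q + suc (1 + suc (c + x))))
        l = solve-∀
      x₀≤N : x₀ ≤ N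
      x₀≤N = ≤-trans (m≤n+m x₀ (5 + T₀ + q₀ + C₀)) (≤-reflexive (l C₀ T₀ q₀ x₀))
        where
        l : ∀ c t q x → 5 + t + q + c + x ≡ suc (t + suc (q + suc (1 + suc (c + x))))
        l = solve-∀
      x≤ : x ≤ N + N * (N * N)
      x≤ = ≤-trans (≤-trans (m≤m+n x _) e) (+-mono-≤ x₀≤N (*-mono-≤ ts≤N (*-mono-≤ (≤-trans (m≤entries I (unassigned I)) x₀≤N) W≤N)))
      l₁ : ∀ p o c x → suc (p + suc (o + suc (c + x))) ≡ 3 + p + (o + c) + x
      l₁ = solve-∀
      l₂ : ∀ r n → 3 + (9 + 8 * (1 + 6 * suc r)) + n + (n + n * (n * n)) ≡ 68 + 48 * r + n + (n + n * (n * n))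
      l₂ = solve-∀

  -- The price grows by a factor of more than 4 in 64 rounds, so that 64 rounds
  -- per binary digit suffice to exceed a given number.

  prepend : ℕ → List ⊤ → List ⊤
  prepend zero    ts = ts
  prepend (suc k) ts = tt ∷ prepend k ts

  -- The initial tick is one beyond `k` per digit: it makes the round with number `length ds * k`,
  -- counted from 0, take place. That round is the one that rules out an unassigned client.
  clock : ℕ → Bits → List ⊤
  clock k ds = fold (λ _ → prepend k) ds (tt ∷ [])

  clockP : ∀ k → digits ⇒ (λ ds → list tick (clock k ds))
  clockP k =
    expr (cons v (cons nil nil)) (λ _ → refl) ⟫
    foldP (λ _ → digit) (λ _ → list tick) (λ _ _ → prepend k) (expr (push k) (λ (_ , _ , ts) → eval-push k ts _)) (λ ds → ds) (λ _ → tt ∷ []) (con 3 ⊕ con (k * 2) ⊗ 𝑛)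
      (λ ds → bounded (list tick) (λ _ → prepend k) (λ es ts → size (list tick ts) + k * 2 * length es ≤ 3 + k * 2 * length ds)
        (λ _ es ts → ≤-trans (≤-reflexive (trans (cong (_+ k * 2 * length es) (size-prepend k ts)) (l (k * 2) (size (list tick ts)) (length es)))))
        (λ es ts inv → ≤-trans (≤-trans (m≤m+n (size (list tick ts)) (k * 2 * length es)) inv)
          (+-monoʳ-≤ 3 (*-monoʳ-≤ (k * 2) (≤-trans (length≤size digit ds) (m≤n⇒m≤1+n (m≤m+n (size (digits ds)) 3))))))
        ds (tt ∷ []) ≤-refl)
    where
    push : ℕ → Expr 1
    push zero    = tl v
    push (suc k) = cons nil (push k)
    eval-push : ∀ k ts x → eval (push k) ((x ∙ list tick ts) ∷ []) ≡ list tick (prepend k ts)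
    eval-push zero    ts x = refl
    eval-push (suc k) ts x = cong (nil ∙_) (eval-push k ts x)
    size-prepend : ∀ k ts → size (list tick (prepend k ts)) ≡ k * 2 + size (list tick ts)
    size-prepend zero    ts = refl
    size-prepend (suc k) ts = cong (2 +_) (size-prepend k ts)
    l : ∀ k s n → k + s + k * n ≡ s + k * (1 + n)
    l = solve-∀

  -- An upper bound on the price at which the first facility of the list
  -- serves every client.
  module _ (I : Costs) where

    column : List (Fin (n I)) → List Fraction
    column []      = []
    column (i ∷ _) = f I i ∷ map (c I i) (allFin (m I))

    ceilingPrice : List (Fin (n I)) → Fraction
    ceilingPrice C = sumᶠ (column C) +ᶠ waiting I (unassigned I)

    schedule : List (Fin (n I)) → List ⊤
    schedule C = clock 64 (bits (proj₁ (ceilingPrice C)))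

  scheduleP : (λ ((I , C) : Σ Costs λ I → List (Fin (n I))) → facilities I C ∙ entries I (unassigned I)) ⇒ (λ (I , C) → list tick (schedule I C))
  scheduleP =
    (expr (tl (hd (hd v))) (λ (I , C) → column≡ I C) ⟫ reindex (λ (I , C) → column I C) sumP)
    ▵ (expr (tl v) (λ _ → refl) ⟫ reindex (λ (I , C) → I , unassigned I) waitingP)
    ⟫ reindex (λ (I , C) → sumᶠ (column I C) , waiting I (unassigned I)) addᶠ
    ⟫ expr (tl (hd v)) (λ (I , C) → sym (digits-bits (proj₁ (ceilingPrice I C))))
    ⟫ reindex (λ (I , C) → bits (proj₁ (ceilingPrice I C))) (clockP 64)
    where
    column≡ : ∀ I C → right (left (facilities I C)) ≡ list fraction (column I C)
    column≡ I []      = refl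
    column≡ I (i ∷ C) = cong (fraction (f I i) ∙_) (cong listTree (map-∘ (allFin (m I))))

  -- Reading the input and writing the output

  Table : Costs → Set
  Table I = (Fin (m I) → Tree) × ℕ × Tree

  table : ∀ I → Table I → Tree
  table I (rows , k , out) = list rows (allFin (m I)) ∙ (⌜ k ⌝ⁿ ∙ out)

  -- The input lists costs by client, the rounds read them by facility. Taking the head of every row
  -- yields the column of the next facility; rows are raw trees, so that heads and tails are total.
  transpose1 : ∀ I → Fin (n I) → Table I → Table I
  transpose1 I i (rows , k , out) =
    (λ j → right (rows j)) , k + 1 ,
    (⌜ k ⌝ⁿ ∙ (fraction (f I i) ∙ list (λ j → left (rows j)) (allFin (m I)))) ∙ out

  costRow : ∀ I → List (Fin (n I)) → Fin (m I) → Tree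
  costRow I is j = list (λ i → fraction (c I i j)) is

  n<2^n : ∀ k → k < 2^ k
  n<2^n zero    = s≤s z≤n
  n<2^n (suc k) = ≤-trans (+-mono-≤ (1≤2^ k) (n<2^n k)) (≤-reflexive (cong (2^ k +_) (sym (+-identityʳ _))))

  size-list-mono : ∀ {X : Set} {e e′ : X → Tree} → (∀ x → size (e x) ≤ size (e′ x)) → ∀ xs → size (list e xs) ≤ size (list e′ xs)
  size-list-mono e≤e′ []       = ≤-refl
  size-list-mono e≤e′ (x ∷ xs) = s≤s (+-mono-≤ (e≤e′ x) (size-list-mono e≤e′ xs))

  transpose1P : Step (λ I i → fraction (f I i)) table transpose1
  transpose1P =
    (rows ⟫ mapP (λ _ → nil) (λ (I , i , rows , _) → rows) _ (expr (tl (tl v)) (λ _ → refl)) clients′)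
    ▵ (expr (cons K̂ (quoteTree ⌜ 1 ⌝ⁿ)) (λ _ → refl) ⟫ reindex (λ (I , i , _ , k , _) → k , 1) addP)
    ▵ (expr K̂ (λ _ → refl) ▵ expr (hd v) (λ _ → refl) ▵ (rows ⟫ mapP (λ _ → nil) (λ (I , i , rows , _) → rows) _ (expr (hd (tl v)) (λ _ → refl)) clients′))
    ▵ expr (tl (tl (tl v))) (λ _ → refl)
    where
    K̂ = hd (tl (tl v))
    clients′ : (d : Σ Costs λ I → Fin (n I) × Table I) → List (Fin (m (proj₁ d)))
    clients′ (I , _) = allFin (m I)
    rows : (λ ((I , i , t) : Σ Costs λ I → Fin (n I) × Table I) → fraction (f I i) ∙ table I t) ⇒ (λ (I , i , rows , _) → nil ∙ list rows (allFin (m I)))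
    rows = expr (cons nil (hd (tl v))) (λ _ → refl)

  -- The numeral attached to a facility is produced by the counter of the loop, and is the right one
  -- only if the list runs through consecutive indices.
  Consecutive : ∀ {k} → ℕ → List (Fin k) → Set
  Consecutive o []       = ⊤
  Consecutive o (i ∷ is) = toℕ i ≡ o × Consecutive (o + 1) is

  Consecutive-allFin : ∀ k → Consecutive 0 (allFin k)
  Consecutive-allFin k = go 0 (λ i → i) (λ _ → refl)
    where
    go : ∀ {l} o (g : Fin l → Fin k) → (∀ i → toℕ (g i) ≡ o + toℕ i) → Consecutive o (tabulate g)
    go {zero}  o g g≡ = tt
    go {suc l} o g g≡ = trans (g≡ zero) (+-identityʳ o) , go (o + 1) (λ i → g (Fin.suc i)) (λ i → trans (g≡ (Fin.suc i)) (sym (+-assoc o 1 (toℕ i))))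

  transpose-fold : ∀ I o is ys → Consecutive o is →
    proj₂ (proj₂ (fold (transpose1 I) is (costRow I is , o , facilities I ys))) ≡ facilities I (is ʳ++ ys)
  transpose-fold I o []       ys _          = refl
  transpose-fold I _ (i ∷ is) ys (refl , p) = transpose-fold I (toℕ i + 1) is (i ∷ ys) p

  encodeCosts : Costs → Tree
  encodeCosts I = list (λ i → fraction (f I i)) (allFin (n I)) ∙ list (costRow I (allFin (n I))) (allFin (m I))

  closed : ∀ I → List (Fin (n I))
  closed I = reverse (allFin (n I))

  transposeP : encodeCosts ⇒ (λ I → facilities I (closed I))
  transposeP =
    expr (cons (hd v) (cons (tl v) (cons nil nil))) (λ _ → refl) ⟫
    foldP (λ I i → fraction (f I i)) table transpose1 transpose1P (λ I → allFin (n I)) (λ I → costRow I (allFin (n I)) , 0 , nil)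
      (con 4 ⊕ con 5 ⊗ 𝑛 ⊕ 𝑛 ⊗ (con 4 ⊕ con 6 ⊗ 𝑛))
      (λ I → bounded (table I) (transpose1 I) (Inv I) (preserved I) (small I) (allFin (n I)) (t₀ I)
        (m≤n⇒m≤1+n (≤-trans (m≤n⇒m≤1+n (m≤m+n _ 3)) (m≤n+m _ (size (list (λ i → fraction (f I i)) (allFin (n I)))))) ,
         ≤-refl , m≤n⇒m≤1+n (m≤m+n _ _) , ≤-refl)) ⟫
    expr (tl (tl v)) (λ I → transpose-fold I 0 (allFin (n I)) [] (Consecutive-allFin (n I)))
    where
    t₀ : ∀ I → Table I
    t₀ I = costRow I (allFin (n I)) , 0 , nil
    N : Costs → ℕ
    N I = size (list (λ i → fraction (f I i)) (allFin (n I)) ∙ table I (t₀ I))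
    L : Costs → ℕ
    L I = length (allFin (n I))
    L≤N : ∀ I → L I ≤ N I
    L≤N I = ≤-trans (length≤size (λ i → fraction (f I i)) (allFin (n I))) (m≤n⇒m≤1+n (m≤m+n _ _))
    Inv : ∀ I → List (Fin (n I)) → Table I → Set
    Inv I is (rows , k , out) = size (list rows (allFin (m I))) ≤ N I × k + length is ≤ L I ×
      size (list (λ i → fraction (f I i)) is) ≤ N I × size out + length is * (4 + 6 * N I) ≤ 1 + L I * (4 + 6 * N I)
    preserved : ∀ I i is t → Inv I (i ∷ is) t → Inv I is (transpose1 I i t)
    preserved I i is (rows , k , out) (r , kk , fs , o) =
      ≤-trans (size-list-mono (λ j → size-right (rows j)) (allFin (m I))) r ,
      ≤-trans (≤-reflexive (+-assoc k 1 (length is))) kk ,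
      ≤-trans (m≤n⇒m≤1+n (m≤n+m _ _)) fs ,
      ≤-trans (≤-trans (+-monoˡ-≤ (length is * (4 + 6 * N I)) new) (≤-reflexive (l (size out) (length is) (N I)))) o
      where
      k≤N : k ≤ N I
      k≤N = ≤-trans (m≤m+n k _) (≤-trans kk (L≤N I))
      new : size ((⌜ k ⌝ⁿ ∙ (fraction (f I i) ∙ list (λ j → left (rows j)) (allFin (m I)))) ∙ out) ≤ suc (suc ((1 + 4 * N I) + suc (N I + N I)) + size out)
      new = s≤s (+-monoˡ-≤ (size out) (s≤s (+-mono-≤ (≤-trans (size-⌜⌝ k (n<2^n k)) (s≤s (*-monoʳ-≤ 4 k≤N)))
        (s≤s (+-mono-≤ (≤-trans (m≤n⇒m≤1+n (m≤m+n _ _)) fs) (≤-trans (size-list-mono (λ j → size-left (rows j)) (allFin (m I))) r))))))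
      l : ∀ o k x → suc (suc ((1 + 4 * x) + suc (x + x)) + o) + k * (4 + 6 * x) ≡ o + (1 + k) * (4 + 6 * x)
      l = solve-∀
    small : ∀ I is t → Inv I is t → size (table I t) ≤ 4 + 5 * N I + N I * (4 + 6 * N I)
    small I is (rows , k , out) (r , kk , fs , o) = ≤-trans
      (s≤s (+-mono-≤ r (s≤s (+-mono-≤ (≤-trans (size-⌜⌝ k (n<2^n k)) (s≤s (*-monoʳ-≤ 4 (≤-trans (m≤m+n k _) (≤-trans kk (L≤N I))))))
         (≤-trans (≤-trans (m≤m+n (size out) _) o) (s≤s (*-monoˡ-≤ (4 + 6 * N I) (L≤N I))))))))
      (≤-reflexive (l (N I)))
      where
      l : ∀ x → suc (x + suc (1 + 4 * x + (1 + x * (4 + 6 * x)))) ≡ 4 + 5 * x + x * (4 + 6 * x)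
      l = solve-∀

  final : ∀ I → State I
  final I = rounds I (schedule I (closed I)) (initial I (closed I))

  -- The newest open facility comes first in `O`, so the path is its reverse; `left` removes the
  -- node that marks an entry as assigned.
  output : ∀ I → State I → Tree
  output I (_ , O , _ , a) = list (λ i → ⌜ toℕ i ⌝ⁿ) (reverse O) ∙ list (λ j → left (entry I (a j))) (allFin (m I))

  outputP : (λ ((I , s) : Σ Costs State) → state I s) ⇒ (λ (I , s) → output I s)
  outputP =
    (expr (cons nil (hd (tl v))) (λ _ → refl)
     ⟫ mapP (λ _ → nil) (λ (I , _) → facility I) (λ _ i → ⌜ toℕ i ⌝ⁿ) (expr (hd (tl v)) (λ _ → refl)) (λ (I , _ , O , _) → O)
     ⟫ expr (cons v nil) (λ _ → refl)
     ⟫ revOnto (λ _ i → ⌜ toℕ i ⌝ⁿ) (λ (I , _ , O , _) → O) (λ _ → []))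
    ▵ (expr (cons nil (tl (tl (tl v)))) (λ _ → refl)
     ⟫ mapP (λ _ → nil) (λ (I , _ , _ , _ , a) j → entry I (a j)) (λ (I , _ , _ , _ , a) j → left (entry I (a j))) (expr (hd (tl v)) (λ _ → refl)) (λ (I , _) → allFin (m I)))

  abstract
    algorithm : encodeCosts ⇒ (λ I → output I (final I))
    algorithm =
      transposeP ▵ (expr (cons nil (tl v)) (λ _ → refl)
        ⟫ mapP (λ _ → nil) (λ I → costRow I (allFin (n I))) (λ I j → nil) (expr nil (λ _ → refl)) (λ I → allFin (m I))) ⟫
      reindex (λ I → I , closed I) scheduleP ▵ expr (cons (quoteTree (fraction (Q 1))) (cons nil v)) (λ _ → refl) ⟫
      reindex (λ I → I , schedule I (closed I) , closed I) roundsP ⟫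
      reindex (λ I → I , final I) outputP

  module _ {D : Set} {a b : D → Tree} (p : a ⇒ b) where

    standalone : Program
    standalone = record { extra = 0 ; body = set (cons v nil) ⨾ _⇒_.cmd p ⨾ set (hd v) }

    standalone-runs : ∀ d → ∃[ t ] (Runs standalone (a d) t (b d) × t ≤ ⟦ con 9 ⊕ _⇒_.time p ⟧ (size (a d)))
    standalone-runs d with seq-run (set-run (cons v nil) {a d} refl) (seq-run (_⇒_.run p d nil) (set-run (hd v) refl))
    ... | t , r , t≤ = t , (_ , r , refl) , ≤-trans t≤ (≤-reflexive (l (⟦ _⇒_.time p ⟧ (size (a d)))))
      where
      l : ∀ x → suc (4 + suc (x + 3)) ≡ 9 + x
      l = solve-∀

  program : Program
  program = standalone algorithm

-- Rational values of fractions and prices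

module Values where

  open Programs
  open import Data.Bool using (Bool; true; false; T) renaming (if_then_else_ to ifᵇ_then_else_)
  open import Data.Fin using (Fin; zero; suc)
  open import Data.Integer as ℤ using (+_)
  import Data.Integer.Properties as ℤₚ
  open import Data.List using (map; allFin; tabulate)
  open import Data.List.Properties using (map-tabulate)
  open import Data.Nat as ℕ using (ℕ; zero; suc)
  open import Data.Nat.Coprimality using (Coprime)
  import Data.Nat.Properties as ℕₚ
  open import Data.Product using (_,_)
  open import Data.Rational
  open import Data.Rational.Properties
  open import Data.Rational.Solver using (module +-*-Solver)
  open import Data.Rational.Unnormalised as ℚᵘ using (ℚᵘ; mkℚᵘ)
  import Data.Rational.Unnormalised.Properties as ℚᵘₚ
  open import Data.Sum using (inj₁; inj₂)
  open import Data.Unit using (tt)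
  open import Function using (_∘_; id)
  open import Algebra.Properties.CommutativeMonoid.Sum +-0-commutativeMonoid using (sum; sum-cong-≗; ∑-distrib-+; ∑-comm; sum-replicate-zero) public
  open import Relation.Binary.PropositionalEquality hiding ([_])
  open +-*-Solver using (solve; _:+_; _:*_; _:-_; _:=_; con)

  infix 8 _⁺

  abstract
    _⁺ : ℚ → ℚ
    x ⁺ = 0ℚ ⊔ x

    0≤⁺ : ∀ x → 0ℚ ≤ x ⁺
    0≤⁺ x = p≤p⊔q 0ℚ x

    ≤⁺ : ∀ x → x ≤ x ⁺
    ≤⁺ x = p≤q⊔p 0ℚ x

    ⁺-lub : ∀ {x y} → 0ℚ ≤ y → x ≤ y → x ⁺ ≤ y
    ⁺-lub = ⊔-lub

    ⁺-zero : ∀ {x} → x ≤ 0ℚ → x ⁺ ≡ 0ℚ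
    ⁺-zero = p≥q⇒p⊔q≡p

  infixr 7 _·_

  _·_ : Bool → ℚ → ℚ
  b · x = ifᵇ b then x else 0ℚ

  0≤· : ∀ b {x} → 0ℚ ≤ x → 0ℚ ≤ b · x
  0≤· true  0≤x = 0≤x
  0≤· false 0≤x = ≤-refl

  ·≤ : ∀ b {x} → 0ℚ ≤ x → b · x ≤ x
  ·≤ true  0≤x = ≤-refl
  ·≤ false 0≤x = 0≤x

  -- Linear inequalities are certified by writing the difference of the two sides as a visibly
  -- nonnegative combination, the identity being left to the ring solver.
  by-difference : ∀ {y z} x → z - y ≡ x → 0ℚ ≤ x → y ≤ z
  by-difference {y} {z} x eq 0≤x = subst₂ _≤_ (+-identityˡ y) (l z y) (+-monoˡ-≤ y (subst (0ℚ ≤_) (sym eq) 0≤x))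
    where
    l : ∀ z y → z - y + y ≡ z
    l = solve 2 (λ z y → z :- y :+ y := z) refl

  0≤+ : ∀ {x y} → 0ℚ ≤ x → 0ℚ ≤ y → 0ℚ ≤ x + y
  0≤+ p q = +-mono-≤ p q

  0≤* : ∀ {x y} → 0ℚ ≤ x → 0ℚ ≤ y → 0ℚ ≤ x * y
  0≤* {x} {y} p q = ≤-trans (≤-reflexive (sym (*-zeroʳ x))) (*-monoˡ-≤-nonNeg x {{nonNegative p}} q)

  0≤- : ∀ {x y} → x ≤ y → 0ℚ ≤ y - x
  0≤- {x} p = ≤-trans (≤-reflexive (sym (+-inverseʳ x))) (+-monoˡ-≤ (- x) p)

  0≤-lit : ∀ q .{{_ : NonNegative q}} → 0ℚ ≤ q
  0≤-lit q = nonNegative⁻¹ q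

  sum-mono : ∀ {k} {f g : Fin k → ℚ} → (∀ i → f i ≤ g i) → sum f ≤ sum g
  sum-mono {zero}  f≤g = ≤-refl
  sum-mono {suc k} f≤g = +-mono-≤ (f≤g zero) (sum-mono (λ i → f≤g (suc i)))

  sum-nonNeg : ∀ {k} {f : Fin k → ℚ} → (∀ i → 0ℚ ≤ f i) → 0ℚ ≤ sum f
  sum-nonNeg {zero}  0≤f = ≤-refl
  sum-nonNeg {suc k} 0≤f = 0≤+ (0≤f zero) (sum-nonNeg (λ i → 0≤f (suc i)))

  sum-*ˡ : ∀ {k} x (f : Fin k → ℚ) → sum (λ i → x * f i) ≡ x * sum f
  sum-*ˡ {zero}  x f = sym (*-zeroʳ x)
  sum-*ˡ {suc k} x f = trans (cong (λ z → x * f zero + z) (sum-*ˡ x (f ∘ suc))) (sym (*-distribˡ-+ x (f zero) (sum (f ∘ suc))))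

  term≤sum : ∀ {k} {f : Fin k → ℚ} → (∀ i → 0ℚ ≤ f i) → ∀ i → f i ≤ sum f
  term≤sum {suc k} {f} 0≤f zero    = ≤-trans (≤-reflexive (sym (+-identityʳ (f zero)))) (+-monoʳ-≤ (f zero) (sum-nonNeg (λ i → 0≤f (suc i))))
  term≤sum {suc k} {f} 0≤f (suc i) = ≤-trans (term≤sum (λ i → 0≤f (suc i)) i)
    (≤-trans (≤-reflexive (sym (+-identityˡ _))) (+-monoˡ-≤ (sum (f ∘ suc)) (0≤f zero)))

  abstract
    unnormalised : Fraction → ℚᵘ
    unnormalised (a , b) = mkℚᵘ (+ a) b

    value : Fraction → ℚ
    value x = fromℚᵘ (unnormalised x)

    toℚᵘ-value : ∀ x → toℚᵘ (value x) ℚᵘ.≃ unnormalised x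
    toℚᵘ-value x = toℚᵘ-fromℚᵘ (unnormalised x)

    value-+ᶠ : ∀ x y → value (x +ᶠ y) ≡ value x + value y
    value-+ᶠ x@(a , b) y@(c , d) = toℚᵘ-injective (begin
      toℚᵘ (value (x +ᶠ y))                  ≈⟨ toℚᵘ-value (x +ᶠ y) ⟩
      unnormalised (x +ᶠ y)                  ≡⟨ cong (λ k → mkℚᵘ k (d ℕ.+ b ℕ.* suc d)) num ⟩
      unnormalised x ℚᵘ.+ unnormalised y     ≈⟨ ℚᵘₚ.+-cong (ℚᵘₚ.≃-sym (toℚᵘ-value x)) (ℚᵘₚ.≃-sym (toℚᵘ-value y)) ⟩
      toℚᵘ (value x) ℚᵘ.+ toℚᵘ (value y)     ≈⟨ ℚᵘₚ.≃-sym (toℚᵘ-homo-+ (value x) (value y)) ⟩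
      toℚᵘ (value x + value y)               ∎)
      where
      open ℚᵘₚ.≃-Reasoning
      num : + (a ℕ.* suc d ℕ.+ c ℕ.* suc b) ≡ (+ a) ℤ.* (+ suc d) ℤ.+ (+ c) ℤ.* (+ suc b)
      num = trans (ℤₚ.pos-+ (a ℕ.* suc d) (c ℕ.* suc b)) (cong₂ ℤ._+_ (ℤₚ.pos-* a (suc d)) (ℤₚ.pos-* c (suc b)))

    0≤value : ∀ x → 0ℚ ≤ value x
    0≤value (a , b) = nonNegative⁻¹ (value (a , b)) {{normalize-nonNeg a (suc b)}}

    value-≤ : ∀ a b c d → a ℕ.* suc d ℕ.≤ c ℕ.* suc b → value (a , b) ≤ value (c , d)
    value-≤ a b c d p = toℚᵘ-cancel-≤ (ℚᵘₚ.≤-respʳ-≃ (ℚᵘₚ.≃-sym (toℚᵘ-value (c , d))) (ℚᵘₚ.≤-respˡ-≃ (ℚᵘₚ.≃-sym (toℚᵘ-value (a , b)))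
      (ℚᵘ.*≤* (subst₂ ℤ._≤_ (ℤₚ.pos-* a (suc d)) (ℤₚ.pos-* c (suc b)) (ℤ.+≤+ p)))))

    value-≤⁻¹ : ∀ a b c d → value (a , b) ≤ value (c , d) → a ℕ.* suc d ℕ.≤ c ℕ.* suc b
    value-≤⁻¹ a b c d p with ℚᵘₚ.≤-respʳ-≃ (toℚᵘ-value (c , d)) (ℚᵘₚ.≤-respˡ-≃ (toℚᵘ-value (a , b)) (toℚᵘ-mono-≤ p))
    ... | ℚᵘ.*≤* q = ℤₚ.drop‿+≤+ (subst₂ ℤ._≤_ (sym (ℤₚ.pos-* a (suc d))) (sym (ℤₚ.pos-* c (suc b))) q)

    value-0ᶠ : value 0ᶠ ≡ 0ℚ
    value-0ᶠ = refl

    value-whole : ∀ k → value (k , 0) ≡ + k / 1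
    value-whole k = refl

    value-mkℚ : ∀ a b .(c : Coprime a (suc b)) → value (a , b) ≡ mkℚ (+ a) b c
    value-mkℚ a b c = fromℚᵘ-toℚᵘ (mkℚ (+ a) b c)

    value-1 : value (1 , 0) ≡ 1ℚ
    value-1 = refl

    value-½ : value (1 , 1) ≡ ½
    value-½ = refl

  ≤ᶠ-true : ∀ x y → (x ≤ᶠ y) ≡ true → value x ≤ value y
  ≤ᶠ-true (a , b) (c , d) eq = value-≤ a b c d (ℕₚ.≤ᵇ⇒≤ _ _ (subst T (sym eq) tt))

  ≤ᶠ-false : ∀ x y → (x ≤ᶠ y) ≡ false → value y ≤ value x
  ≤ᶠ-false (a , b) (c , d) eq with ≤-total (value (c , d)) (value (a , b))
  ... | inj₁ p = p
  ... | inj₂ p with () ← subst T eq (ℕₚ.≤⇒≤ᵇ (value-≤⁻¹ a b c d p))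

  value-fold : ∀ {k} (g : Fin k → Fraction) x → value (fold _+ᶠ_ (map g (allFin k)) x) ≡ sum (value ∘ g) + value x
  value-fold {k} g x = trans (cong (λ xs → value (fold _+ᶠ_ xs x)) (map-tabulate id g)) (go g x)
    where
    go : ∀ {k} (g : Fin k → Fraction) x → value (fold _+ᶠ_ (tabulate g) x) ≡ sum (value ∘ g) + value x
    go {zero}  g x = sym (+-identityˡ (value x))
    go {suc k} g x = trans (go (g ∘ suc) (g zero +ᶠ x)) (trans (cong (λ z → sum (value ∘ g ∘ suc) + z) (value-+ᶠ (g zero) x))
      (l (sum (value ∘ g ∘ suc)) (value (g zero)) (value x)))
      where
      l : ∀ s a x → s + (a + x) ≡ a + s + x
      l = solve 3 (λ s a x → s :+ (a :+ x) := a :+ s :+ x) refl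

  value-sumᶠ : ∀ {k} (g : Fin k → Fraction) → value (sumᶠ (map g (allFin k))) ≡ sum (value ∘ g)
  value-sumᶠ g = trans (value-fold g 0ᶠ) (trans (cong (λ z → sum (value ∘ g) + z) value-0ᶠ) (+-identityʳ _))

  value-if : ∀ b x → value (ifᵇ b then x else 0ᶠ) ≡ b · value x
  value-if true  x = refl
  value-if false x = value-0ᶠ

  abstract
    P : ℕ → ℚ
    P r = value (Q r)

    P-value : ∀ r → P r ≡ value (Q r)
    P-value r = refl

    P-zero : P 0 ≡ 1ℚ
    P-zero = refl

    P-suc : ∀ r → P (suc r) ≡ + 33 / 32 * P r
    P-suc r with Q r
    ... | a , b = toℚᵘ-injective (begin
      toℚᵘ (value (a ℕ.* 33 , 31 ℕ.+ b ℕ.* 32))   ≈⟨ toℚᵘ-value (a ℕ.* 33 , 31 ℕ.+ b ℕ.* 32) ⟩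
      mkℚᵘ (+ (a ℕ.* 33)) (31 ℕ.+ b ℕ.* 32)       ≈⟨ ℚᵘ.*≡* scaled ⟩
      mkℚᵘ (+ 33) 31 ℚᵘ.* mkℚᵘ (+ a) b            ≈⟨ ℚᵘₚ.*-congˡ {mkℚᵘ (+ 33) 31} (ℚᵘₚ.≃-sym (toℚᵘ-value (a , b))) ⟩
      mkℚᵘ (+ 33) 31 ℚᵘ.* toℚᵘ (value (a , b))    ≈⟨ ℚᵘₚ.≃-sym (toℚᵘ-homo-* (+ 33 / 32) (value (a , b))) ⟩
      toℚᵘ (+ 33 / 32 * value (a , b))            ∎)
      where
      open ℚᵘₚ.≃-Reasoning
      scaled : (+ (a ℕ.* 33)) ℤ.* (+ (32 ℕ.* suc b)) ≡ ((+ 33) ℤ.* (+ a)) ℤ.* (+ suc (31 ℕ.+ b ℕ.* 32))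
      scaled = trans (cong₂ ℤ._*_ (trans (cong +_ (ℕₚ.*-comm a 33)) (ℤₚ.pos-* 33 a)) (cong +_ (ℕₚ.*-comm 32 (suc b)))) refl

  0≤P : ∀ r → 0ℚ ≤ P r
  0≤P r = subst (0ℚ ≤_) (sym (P-value r)) (0≤value (Q r))

  P-mono : ∀ {r s} → r ℕ.≤ s → P r ≤ P s
  P-mono {r} r≤s = go (ℕₚ.≤⇒≤′ r≤s)
    where
    step : ∀ s → P s ≤ P (suc s)
    step s = by-difference (+ 1 / 32 * P s) (trans (cong (λ z → z - P s) (P-suc s)) (l (P s))) (0≤* (0≤-lit (+ 1 / 32)) (0≤P s))
      where
      l : ∀ x → + 33 / 32 * x - x ≡ + 1 / 32 * x
      l = solve 1 (λ x → con (+ 33 / 32) :* x :- x := con (+ 1 / 32) :* x) refl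
    go : ∀ {s} → r ℕ.≤′ s → P r ≤ P s
    go ℕ.≤′-refl        = ≤-refl
    go (ℕ.≤′-step r≤s) = ≤-trans (go r≤s) (step _)

-- A dual solution of (Unif-P) from the outcome of the rounds

module Duality where

  open Programs using (_+ᶠ_)
  open Values
  open import Data.Bool using (Bool; true; false; T)
  open import Data.Fin using (Fin; zero; suc; toℕ)
  open import Data.Integer using (+_)
  open import Data.List as List using (List; []; _∷_)
  open import Data.List.Membership.Propositional using (_∈_)
  open import Data.List.Relation.Unary.Any using (here; there; index)
  open import Data.Nat as ℕ using (ℕ; zero; suc)
  import Data.Nat.Properties as ℕₚ
  open import Data.Product using (∃-syntax; _×_; _,_)
  open import Data.Rational
  open import Data.Rational.Properties
  open import Data.Rational.Solver using (module +-*-Solver)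
  open import Data.Sum using (_⊎_; inj₁; inj₂)
  open import Data.Unit using (tt)
  open import Function using (_∘_)
  open import Relation.Binary.PropositionalEquality hiding ([_])
  open import Relation.Nullary using (Dec; yes; no; ¬_; does)
  open import Relation.Nullary.Decidable using (toWitness; dec-true; dec-false)
  open import Relation.Nullary.Negation using (contradiction)
  open import Defs using (fromℕ; Instance; Feasible; objective; Solution; cost)
  open +-*-Solver using (solve; _:+_; _:*_; _:-_; _:=_; con)

  minimal : ∀ {k} (A : Fin k → Set) → (∀ j → Dec (A j)) → (g : Fin k → ℕ) →
            (∀ j → ¬ A j) ⊎ ∃[ l ] (A l × (∀ j → A j → g l ℕ.≤ g j))
  minimal {zero}  A A? g = inj₁ λ ()
  minimal {suc k} A A? g with A? zero | minimal (A ∘ suc) (A? ∘ suc) (g ∘ suc)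
  ... | no ¬a | inj₁ none = inj₁ λ { zero → ¬a ; (suc j) → none j }
  ... | no ¬a | inj₂ (l , a , least) = inj₂ (suc l , a , λ { zero b → contradiction b ¬a ; (suc j) → least j })
  ... | yes a | inj₁ none = inj₂ (zero , a , λ { zero b → ℕₚ.≤-refl ; (suc j) b → contradiction b (none j) })
  ... | yes a | inj₂ (l , b , least) with ℕₚ.≤-total (g zero) (g (suc l))
  ...   | inj₁ p = inj₂ (zero , a , λ { zero _ → ℕₚ.≤-refl ; (suc j) c → ℕₚ.≤-trans p (least j c) })
  ...   | inj₂ p = inj₂ (suc l , b , λ { zero _ → p ; (suc j) c → least j c })

  -- What the rounds guarantee once all clients are assigned: client j is
  -- assigned to server j in round level j, at price P (1 + level j).
  record Outcome {n m : ℕ} (F : Fin n → ℚ) (c : Fin n → Fin m → ℚ) : Set where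
    field
      F≥0      : ∀ i → 0ℚ ≤ F i
      c≥0      : ∀ i j → 0ℚ ≤ c i j
      triangle : ∀ i k j l → c i j ≤ c i l + c k l + c k j
      level    : Fin m → ℕ
      server   : Fin m → Fin n
      near     : ∀ l → c (server l) l ≤ P (suc (level l))
      blocked  : ∀ l j s → level l ℕ.≤ s → level j ≡ suc s → P (suc s) ≤ c (server l) j
      stable   : ∀ l s → level l ≡ suc s → ∀ i →
                 sum (λ j → (suc s ℕ.≤ᵇ level j) · (P (suc s) - c i j) ⁺) ≤ F i + ½ * sum (λ j → (s ℕ.≤ᵇ level j) · 1ℚ)

  δ : ℚ
  δ = + 2 / 5

  ≤ᵇ-true : ∀ {a b} → a ℕ.≤ b → (a ℕ.≤ᵇ b) ≡ true
  ≤ᵇ-true {a} {b} p with a ℕ.≤ᵇ b in eq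
  ... | true  = refl
  ... | false with () ← subst T eq (ℕₚ.≤⇒≤ᵇ p)

  module _ {n m : ℕ} {F : Fin n → ℚ} {c : Fin n → Fin m → ℚ} (R : Outcome F c) where

    open Outcome R

    dual : Fin m → ℚ
    dual j = δ * P (level j)

    -- θ t is the multiplier of the constraint  Σᵢ y i t ≤ 1.  The factor 33/32
    -- accounts for the clients that joined in the round before.
    weight : Fin m → ℚ
    weight j = + 33 / 32 * dual j

    _before_ : ℚ → ℚ → Bool
    t before u = does (t <? u)

    θ : ℚ → ℚ
    θ t = ½ * sum (λ j → (t before weight j) · 1ℚ)

    charge : ℚ → Fin n → Fin m → ℚ
    charge t i j = (dual j - c i j - t) ⁺

    0≤θ : ∀ t → 0ℚ ≤ θ t
    0≤θ t = 0≤* (0≤-lit ½) (sum-nonNeg (λ j → 0≤· (t before weight j) (0≤-lit 1ℚ)))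

    -- If p is the price of l and w that of a client j assigned later, and both
    -- have a positive charge at (i , t), then the triangle inequality through
    -- the server of l bounds w.
    price-comparison : ∀ p w t cᵢₗ cᵢⱼ cₛₗ → w ≤ cₛₗ + cᵢₗ + cᵢⱼ → cₛₗ ≤ + 33 / 32 * p →
      cᵢₗ + t ≤ δ * p → cᵢⱼ + t ≤ δ * w → 0ℚ ≤ p → 0ℚ ≤ t → δ * w - cᵢⱼ - t ≤ p - cᵢⱼ
    price-comparison p w t x y z h₁ h₂ h₃ h₄ 0≤p 0≤t =
      by-difference
        -- The factor 2/3 = δ/(1 - δ) times the sum of the four hypotheses eliminates `w`. What
        -- remains is 11/240 = 1 - 2/3 (33/32 + 2/5) of `p` and 7/3 = 1 + 2 · 2/3 of `t`.
        (+ 2 / 3 * (((z + x + y - w) + (+ 33 / 32 * p - z)) + ((δ * p - (x + t)) + (δ * w - (y + t)))) + (+ 11 / 240 * p + + 7 / 3 * t))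
        (l p w t x y z)
        (0≤+ (0≤* (0≤-lit (+ 2 / 3)) (0≤+ (0≤+ (0≤- h₁) (0≤- h₂)) (0≤+ (0≤- h₃) (0≤- h₄))))
             (0≤+ (0≤* (0≤-lit (+ 11 / 240)) 0≤p) (0≤* (0≤-lit (+ 7 / 3)) 0≤t)))
      where
      l : ∀ p w t x y z → p - y - (δ * w - y - t) ≡
          + 2 / 3 * (((z + x + y - w) + (+ 33 / 32 * p - z)) + ((δ * p - (x + t)) + (δ * w - (y + t)))) + (+ 11 / 240 * p + + 7 / 3 * t)
      l = solve 6 (λ p w t x y z → p :- y :- (con δ :* w :- y :- t) :=
            con (+ 2 / 3) :* (((z :+ x :+ y :- w) :+ (con (+ 33 / 32) :* p :- z)) :+ ((con δ :* p :- (x :+ t)) :+ (con δ :* w :- (y :+ t)))) :+ (con (+ 11 / 240) :* p :+ con (+ 7 / 3) :* t)) refl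

    -- Dual feasibility. Let `l` have the lowest level among the clients with positive charge. Level
    -- 0 is excluded, since then `dual l` is 2/5 < 1 ≤ t. If the level is `suc s`, the inequality
    -- `stable` of round `s` at `i` applies: no charged client comes earlier, each charge is at most
    -- `P (suc s) - c i j` by `price-comparison`, and every client counted on the right has level at
    -- least `s`, hence weight at least `dual l` > t.
    star-bound : ∀ t → 1ℚ ≤ t → ∀ i → sum (charge t i) ≤ F i + θ t
    star-bound t 1≤t i with minimal (λ j → c i j + t < dual j) (λ j → c i j + t <? dual j) level
    ... | inj₁ none = ≤-trans (≤-reflexive (trans (sum-cong-≗ zero-charge) (sum-replicate-zero m))) (0≤+ (F≥0 i) (0≤θ t))
      where
      zero-charge : ∀ j → charge t i j ≡ 0ℚ
      zero-charge j = ⁺-zero (by-difference (c i j + t - dual j) (l (c i j) t (dual j)) (0≤- (≮⇒≥ (none j))))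
        where
        l : ∀ c t d → 0ℚ - (d - c - t) ≡ c + t - d
        l = solve 3 (λ c t d → con 0ℚ :- (d :- c :- t) := c :+ t :- d) refl
    ... | inj₂ (l , l∈A , least) = from-level (level l) refl
      where
      0≤t : 0ℚ ≤ t
      0≤t = ≤-trans (0≤-lit 1ℚ) 1≤t
      t≤dual : t ≤ dual l
      t≤dual = ≤-trans (≤-trans (≤-reflexive (sym (+-identityˡ t))) (+-monoˡ-≤ t (c≥0 i l))) (<⇒≤ l∈A)
      from-level : ∀ s → level l ≡ s → sum (charge t i) ≤ F i + θ t
      from-level zero    eq = contradiction (≤-trans 1≤t (≤-trans t≤dual (≤-reflexive (trans (cong (λ s → δ * P s) eq) (cong (δ *_) P-zero)))))
        (λ 1≤δ → <-irrefl refl (<-≤-trans (toWitness {a? = δ * 1ℚ <? 1ℚ} tt) 1≤δ))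
      from-level (suc s) eq = ≤-trans (sum-mono charge≤) (≤-trans (stable l s eq i)
        (+-monoʳ-≤ (F i) (*-monoˡ-≤-nonNeg ½ (sum-mono counted))))
        where
        P≡ : P (level l) ≡ P (suc s)
        P≡ = cong P eq
        charge≤ : ∀ j → charge t i j ≤ (suc s ℕ.≤ᵇ level j) · (P (suc s) - c i j) ⁺
        charge≤ j with c i j + t <? dual j
        ... | no ¬a = ⁺-lub (0≤· (suc s ℕ.≤ᵇ level j) (0≤⁺ _)) (≤-trans (by-difference (c i j + t - dual j) (r (c i j) t (dual j)) (0≤- (≮⇒≥ ¬a)))
              (0≤· (suc s ℕ.≤ᵇ level j) (0≤⁺ _)))
          where
          r : ∀ c t d → 0ℚ - (d - c - t) ≡ c + t - d
          r = solve 3 (λ c t d → con 0ℚ :- (d :- c :- t) := c :+ t :- d) refl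
        ... | yes a = subst (λ b → charge t i j ≤ b · (P (suc s) - c i j) ⁺) (sym (≤ᵇ-true (subst (ℕ._≤ level j) eq (least j a))))
              (⁺-lub (0≤⁺ _) (≤-trans (key (ℕₚ.m≤n⇒m<n∨m≡n (least j a))) (≤⁺ _)))
          where
          key : level l ℕ.< level j ⊎ level l ≡ level j → dual j - c i j - t ≤ P (suc s) - c i j
          key (inj₂ same) = by-difference (+ 3 / 5 * P (suc s) + t)
            (trans (cong (λ x → P (suc s) - c i j - (δ * P x - c i j - t)) (trans (sym same) eq)) (r (P (suc s)) (c i j) t))
            (0≤+ (0≤* (0≤-lit (+ 3 / 5)) (0≤P (suc s))) 0≤t)
            where
            r : ∀ p c t → p - c - (δ * p - c - t) ≡ + 3 / 5 * p + t
            r = solve 3 (λ p c t → p :- c :- (con δ :* p :- c :- t) := con (+ 3 / 5) :* p :+ t) refl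
          key (inj₁ later) with level j in eqⱼ
          ... | suc s′ = subst (λ x → δ * P (suc s′) - c i j - t ≤ P x - c i j) eq
                (price-comparison (P (level l)) (P (suc s′)) t (c i l) (c i j) (c (server l) l)
                  (≤-trans (blocked l j s′ (ℕₚ.≤-pred later) eqⱼ) (triangle (server l) i j l))
                  (≤-trans (near l) (≤-reflexive (P-suc (level l))))
                  (<⇒≤ l∈A) (<⇒≤ a) (0≤P (level l)) 0≤t)
        counted : ∀ j → (s ℕ.≤ᵇ level j) · 1ℚ ≤ (t before weight j) · 1ℚ
        counted j with s ℕ.≤ᵇ level j in sb
        ... | false = 0≤· (t before weight j) (0≤-lit 1ℚ)
        ... | true = ≤-reflexive (sym (cong (_· 1ℚ) (dec-true (t <? weight j) (<-≤-trans t<dual (≤-trans (≤-reflexive dual≡)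
                (*-monoˡ-≤-nonNeg (+ 33 / 32) (*-monoˡ-≤-nonNeg δ (P-mono (ℕₚ.≤ᵇ⇒≤ s (level j) (subst T (sym sb) tt))))))))))
          where
          t<dual : t < dual l
          t<dual = ≤-<-trans (≤-trans (≤-reflexive (sym (+-identityˡ t))) (+-monoˡ-≤ t (c≥0 i l))) l∈A
          dual≡ : dual l ≡ + 33 / 32 * (δ * P s)
          dual≡ = trans (cong (δ *_) (trans P≡ (P-suc s))) (r (P s))
            where
            r : ∀ p → δ * (+ 33 / 32 * p) ≡ + 33 / 32 * (δ * p)
            r = solve 1 (λ p → con δ :* (con (+ 33 / 32) :* p) := con (+ 33 / 32) :* (con δ :* p)) refl

  fromℕ-suc : ∀ k → fromℕ (suc k) ≡ 1ℚ + fromℕ k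
  fromℕ-suc k = begin
    fromℕ (suc k)                   ≡⟨ value-whole (suc k) ⟨
    value (suc k , 0)               ≡⟨ cong (λ z → value (suc z , 0)) (ℕₚ.*-identityʳ k) ⟨
    value ((1 , 0) +ᶠ (k , 0))      ≡⟨ value-+ᶠ (1 , 0) (k , 0) ⟩
    value (1 , 0) + value (k , 0)   ≡⟨ cong₂ _+_ value-1 (value-whole k) ⟩
    1ℚ + fromℕ k                    ∎
    where open ≡-Reasoning

  0≤fromℕ : ∀ k → 0ℚ ≤ fromℕ k
  0≤fromℕ k = nonNegative⁻¹ (fromℕ k) {{normalize-nonNeg k 1}}

  1≤fromℕ-suc : ∀ k → 1ℚ ≤ fromℕ (suc k)
  1≤fromℕ-suc k = ≤-trans (≤-trans (≤-reflexive (sym (+-identityʳ 1ℚ))) (+-monoʳ-≤ 1ℚ (0≤fromℕ k))) (≤-reflexive (sym (fromℕ-suc k)))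

  -- Summed over o, this bounds the number of positive integers below w by w.

  below-step : ∀ o w → does (fromℕ (suc o) <? w) · 1ℚ + (w - fromℕ (suc o)) ⁺ ≤ (w - fromℕ o) ⁺
  below-step o w = by-cases (fromℕ (suc o) <? w)
    where
    by-cases : Dec (fromℕ (suc o) < w) → does (fromℕ (suc o) <? w) · 1ℚ + (w - fromℕ (suc o)) ⁺ ≤ (w - fromℕ o) ⁺
    by-cases (yes p) = ≤-trans
      (+-mono-≤ (·≤ (does (fromℕ (suc o) <? w)) (0≤-lit 1ℚ)) (⁺-lub {y = w - fromℕ (suc o)} (0≤- (<⇒≤ p)) ≤-refl))
      (≤-trans (≤-reflexive (trans (cong (λ z → 1ℚ + (w - z)) (fromℕ-suc o)) (l w (fromℕ o)))) (≤⁺ _))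
      where
      l : ∀ w o → 1ℚ + (w - (1ℚ + o)) ≡ w - o
      l = solve 2 (λ w o → con 1ℚ :+ (w :- (con 1ℚ :+ o)) := w :- o) refl
    by-cases (no ¬p) = ≤-trans (≤-reflexive (cong₂ _+_ (cong (_· 1ℚ) (dec-false (fromℕ (suc o) <? w) ¬p)) (⁺-zero w≤)))
      (≤-trans (≤-reflexive (+-identityˡ 0ℚ)) (0≤⁺ _))
      where
      w≤ : w - fromℕ (suc o) ≤ 0ℚ
      w≤ = by-difference (fromℕ (suc o) - w) (l w (fromℕ (suc o))) (0≤- (≮⇒≥ ¬p))
        where
        l : ∀ w o → 0ℚ - (w - o) ≡ o - w
        l = solve 2 (λ w o → con 0ℚ :- (w :- o) := o :- w) refl

  below-count : ∀ k o w → sum {k} (λ t → does (fromℕ (suc (o ℕ.+ toℕ t)) <? w) · 1ℚ) ≤ (w - fromℕ o) ⁺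
  below-count zero    o w = 0≤⁺ _
  below-count (suc k) o w = ≤-trans (+-mono-≤ (≤-reflexive (cong below (ℕₚ.+-identityʳ o))) (≤-trans (≤-reflexive shift) (below-count k (suc o) w)))
    (below-step o w)
    where
    below : ℕ → ℚ
    below z = does (fromℕ (suc z) <? w) · 1ℚ
    shift : sum {k} (λ t → below (o ℕ.+ suc (toℕ t))) ≡ sum {k} (λ t → below (suc o ℕ.+ toℕ t))
    shift = sum-cong-≗ {k} (λ t → cong below (ℕₚ.+-suc o (toℕ t)))

  ⁺-start : ∀ {w} → 0ℚ ≤ w → (w - fromℕ 0) ⁺ ≤ w
  ⁺-start {w} 0≤weight = ⁺-lub 0≤weight (≤-reflexive (+-identityʳ w))

  -- Weak duality for fractional and integral solutions

  module _ {n m : ℕ} (I : Instance n m) (R : Outcome (Instance.f I) (Instance.c I)) where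

    open Instance I
    open Outcome R

    volume : ℚ
    volume = sum (λ j → P (level j))

    private
      d w : Fin m → ℚ
      d = dual R
      w = weight R

    0≤dual : ∀ j → 0ℚ ≤ d j
    0≤dual j = 0≤* (0≤-lit δ) (0≤P (level j))

    0≤weight : ∀ j → 0ℚ ≤ w j
    0≤weight j = 0≤* (0≤-lit (+ 33 / 32)) (0≤dual j)

    -- 31/160 = 2/5 - 1/2 · 33/32 · 2/5.
    collect : ∀ K → sum d ≤ K + ½ * sum w → + 31 / 160 * volume ≤ K
    collect K h = by-difference (K + ½ * sum w - sum d)
      (trans (l K volume) (cong₂ (λ a b → K + ½ * a - b)
        (sym (trans (sum-*ˡ (+ 33 / 32) d) (cong (+ 33 / 32 *_) (sum-*ˡ δ (λ j → P (level j))))))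
        (sym (sum-*ˡ δ (λ j → P (level j))))))
      (0≤- h)
      where
      l : ∀ k v → k - + 31 / 160 * v ≡ k + ½ * (+ 33 / 32 * (δ * v)) - δ * v
      l = solve 2 (λ k v → k :- con (+ 31 / 160) :* v := k :+ con ½ :* (con (+ 33 / 32) :* (con δ :* v)) :- con δ :* v) refl

    module _ {x : Fin n → Fin m → Fin n → ℚ} {y : Fin n → Fin n → ℚ} (feasible : Feasible I x y) where

      open Feasible feasible

      private
        τ : Fin n → ℚ
        τ t = fromℕ (suc (toℕ t))

        termwise : ∀ j i t → d j * x i j t ≤ (c i j + τ t) * x i j t + charge R (τ t) i j * y i t
        termwise j i t = ≤-trans
          (by-difference (((charge R (τ t) i j) - (d j - c i j - τ t)) * x i j t) (l (d j) (c i j) (τ t) (x i j t) (charge R (τ t) i j))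
            (0≤* (0≤- (≤⁺ (d j - c i j - τ t))) (x≥0 i j t)))
          (+-monoʳ-≤ ((c i j + τ t) * x i j t) (*-monoˡ-≤-nonNeg (charge R (τ t) i j) {{nonNegative (0≤⁺ _)}} (x≤y i j t)))
          where
          l : ∀ d c t x h → (c + t) * x + h * x - d * x ≡ (h - (d - c - t)) * x
          l = solve 5 (λ d c t x h → (c :+ t) :* x :+ h :* x :- d :* x := (h :- (d :- c :- t)) :* x) refl

        assigned : sum d ≤ sum (λ j → sum (λ i → sum (λ t → d j * x i j t)))
        assigned = sum-mono λ j → ≤-trans (≤-reflexive (sym (*-identityʳ (d j))))
          (≤-trans (*-monoˡ-≤-nonNeg (d j) {{nonNegative (0≤dual j)}} (covered j))
          (≤-reflexive (sym (trans (sum-cong-≗ (λ i → sum-*ˡ (d j) (x i j))) (sum-*ˡ (d j) (λ i → sum (x i j)))))))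

        sum₃-+ : ∀ (f g : Fin m → Fin n → Fin n → ℚ) →
          sum (λ j → sum (λ i → sum (λ t → f j i t + g j i t))) ≡
          sum (λ j → sum (λ i → sum (f j i))) + sum (λ j → sum (λ i → sum (g j i)))
        sum₃-+ f g = trans (sum-cong-≗ (λ j → trans (sum-cong-≗ (λ i → ∑-distrib-+ (f j i) (g j i))) (∑-distrib-+ (λ i → sum (f j i)) (λ i → sum (g j i)))))
          (∑-distrib-+ (λ j → sum (λ i → sum (f j i))) (λ j → sum (λ i → sum (g j i))))

        stars : sum (λ j → sum (λ i → sum (λ t → charge R (τ t) i j * y i t))) ≡
                sum (λ i → sum (λ t → y i t * sum (charge R (τ t) i)))
        stars = trans (∑-comm (λ j i → sum (λ t → charge R (τ t) i j * y i t))) (sum-cong-≗ λ i →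
          trans (∑-comm (λ j t → charge R (τ t) i j * y i t)) (sum-cong-≗ λ t →
          trans (sum-cong-≗ (λ j → *-comm (charge R (τ t) i j) (y i t))) (sum-*ˡ (y i t) (charge R (τ t) i))))

        star≤ : ∀ i t → y i t * sum (charge R (τ t) i) ≤ f i * y i t + θ R (τ t) * y i t
        star≤ i t = ≤-trans (*-monoˡ-≤-nonNeg (y i t) {{nonNegative (y≥0 i t)}} (star-bound R (τ t) (1≤fromℕ-suc (toℕ t)) i))
          (≤-reflexive (l (y i t) (f i) (θ R (τ t))))
          where
          l : ∀ y f t → y * (f + t) ≡ f * y + t * y
          l = solve 3 (λ y f t → y :* (f :+ t) := f :* y :+ t :* y) refl

        -- The constraint of one facility per time leaves Σ θ over the times. After exchanging sums
        -- this is half the number of times below each weight, and fewer than w positive integers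
        -- lie below a positive w.
        θ-total : sum (λ i → sum (λ t → θ R (τ t) * y i t)) ≤ ½ * sum w
        θ-total = begin
          sum (λ i → sum (λ t → θ R (τ t) * y i t))     ≡⟨ ∑-comm (λ i t → θ R (τ t) * y i t) ⟩
          sum (λ t → sum (λ i → θ R (τ t) * y i t))     ≡⟨ sum-cong-≗ (λ t → sum-*ˡ (θ R (τ t)) (λ i → y i t)) ⟩
          sum (λ t → θ R (τ t) * sum (λ i → y i t))     ≤⟨ sum-mono (λ t → *-monoˡ-≤-nonNeg (θ R (τ t)) {{nonNegative (0≤θ R (τ t))}} (one-each t)) ⟩
          sum (λ t → θ R (τ t) * 1ℚ)                    ≡⟨ sum-cong-≗ (λ t → *-identityʳ (θ R (τ t))) ⟩
          sum (λ t → θ R (τ t))                         ≡⟨ sum-*ˡ ½ (λ t → sum (λ j → does (τ t <? w j) · 1ℚ)) ⟩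
          ½ * sum (λ t → sum (λ j → does (τ t <? w j) · 1ℚ)) ≡⟨ cong (½ *_) (∑-comm (λ t j → does (τ t <? w j) · 1ℚ)) ⟩
          ½ * sum (λ j → sum (λ t → does (τ t <? w j) · 1ℚ)) ≤⟨ *-monoˡ-≤-nonNeg ½ (sum-mono (λ j → ≤-trans (below-count n 0 (w j)) (⁺-start (0≤weight j)))) ⟩
          ½ * sum w                                     ∎
          where open ≤-Reasoning

      -- Weak duality: coverage bounds Σ d by Σ d x, and each `d j * x` is split into the cost
      -- `(c + τ) * x` and a charge, where x ≤ y is used. The charges at one (i , t) form a star and
      -- are bounded by `star-bound`.
      lp-bound : + 31 / 160 * volume ≤ objective I x y
      lp-bound = collect (objective I x y) (begin
        sum d                                                                  ≤⟨ assigned ⟩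
        sum (λ j → sum (λ i → sum (λ t → d j * x i j t)))                      ≤⟨ sum-mono (λ j → sum-mono (λ i → sum-mono (λ t → termwise j i t))) ⟩
        sum (λ j → sum (λ i → sum (λ t → (c i j + τ t) * x i j t + charge R (τ t) i j * y i t))) ≡⟨ sum₃-+ (λ j i t → (c i j + τ t) * x i j t) (λ j i t → charge R (τ t) i j * y i t) ⟩
        C + sum (λ j → sum (λ i → sum (λ t → charge R (τ t) i j * y i t)))     ≡⟨ cong (λ z → C + z) stars ⟩
        C + sum (λ i → sum (λ t → y i t * sum (charge R (τ t) i)))             ≤⟨ +-monoʳ-≤ C (sum-mono (λ i → sum-mono (λ t → star≤ i t))) ⟩
        C + sum (λ i → sum (λ t → f i * y i t + θ R (τ t) * y i t))            ≡⟨ cong (λ z → C + z) (trans (sum-cong-≗ (λ i → ∑-distrib-+ (λ t → f i * y i t) (λ t → θ R (τ t) * y i t))) (∑-distrib-+ (λ i → sum (λ t → f i * y i t)) (λ i → sum (λ t → θ R (τ t) * y i t)))) ⟩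
        C + (B + sum (λ i → sum (λ t → θ R (τ t) * y i t)))                    ≤⟨ +-monoʳ-≤ C (+-monoʳ-≤ B θ-total) ⟩
        C + (B + ½ * sum w)                                                    ≡⟨ l C B (½ * sum w) ⟩
        B + C + ½ * sum w                                                      ∎)
        where
        open ≤-Reasoning
        B = sum (λ i → sum (λ t → f i * y i t))
        C = sum (λ j → sum (λ i → sum (λ t → (c i j + τ t) * x i j t)))
        l : ∀ c b w → c + (b + w) ≡ b + c + w
        l = solve 3 (λ c b w → c :+ (b :+ w) := b :+ c :+ w) refl

    -- The same bound for integral solutions.  pathSum o h p adds up h over the
    -- facilities of p, the first of which is at position 1 + o.
    pathSum : ℕ → (ℕ → Fin n → ℚ) → List (Fin n) → ℚ
    pathSum o h []      = 0ℚ
    pathSum o h (i ∷ p) = h (suc o) i + pathSum (suc o) h p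

    pathSum-mono : ∀ o {g h} → (∀ t i → g (suc t) i ≤ h (suc t) i) → ∀ p → pathSum o g p ≤ pathSum o h p
    pathSum-mono o g≤h []      = ≤-refl
    pathSum-mono o g≤h (i ∷ p) = +-mono-≤ (g≤h o i) (pathSum-mono (suc o) g≤h p)

    pathSum-nonNeg : ∀ o {h} → (∀ t i → 0ℚ ≤ h t i) → ∀ p → 0ℚ ≤ pathSum o h p
    pathSum-nonNeg o 0≤h []      = ≤-refl
    pathSum-nonNeg o 0≤h (i ∷ p) = 0≤+ (0≤h (suc o) i) (pathSum-nonNeg (suc o) 0≤h p)

    pathSum-term : ∀ o {h} → (∀ t i → 0ℚ ≤ h t i) → ∀ {i p} (i∈p : i ∈ p) → h (suc (o ℕ.+ toℕ (index i∈p))) i ≤ pathSum o h p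
    pathSum-term o {h} 0≤h {i} {_ ∷ p} (here refl) = ≤-trans (≤-reflexive (trans (cong (λ z → h (suc z) i) (ℕₚ.+-identityʳ o)) (sym (+-identityʳ _))))
      (+-monoʳ-≤ (h (suc o) i) (pathSum-nonNeg (suc o) 0≤h p))
    pathSum-term o {h} 0≤h {i} {k ∷ p} (there i∈p) = ≤-trans (≤-reflexive (cong (λ z → h (suc z) i) (ℕₚ.+-suc o (toℕ (index i∈p)))))
      (≤-trans (pathSum-term (suc o) 0≤h i∈p) (≤-trans (≤-reflexive (sym (+-identityˡ _))) (+-monoˡ-≤ (pathSum (suc o) h p) (0≤h (suc o) k))))

    pathSum-sum : ∀ o {k} (h : Fin k → ℕ → Fin n → ℚ) p → sum (λ j → pathSum o (h j) p) ≡ pathSum o (λ t i → sum (λ j → h j t i)) p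
    pathSum-sum o {k} h []      = sum-replicate-zero k
    pathSum-sum o {k} h (i ∷ p) = trans (∑-distrib-+ (λ j → h j (suc o) i) (λ j → pathSum (suc o) (h j) p))
      (cong (λ z → sum (λ j → h j (suc o) i) + z) (pathSum-sum (suc o) h p))

    -- The sum over positions telescopes: by `below-step`, the clients counted at position `suc o`
    -- are paid by the drop of `(w j - fromℕ o) ⁺` to the next position.
    pathSum-θ : ∀ o p → pathSum o (λ t i → f i + θ R (fromℕ t)) p ≤
                List.foldr _+_ 0ℚ (List.map f p) + ½ * sum (λ j → (w j - fromℕ o) ⁺)
    pathSum-θ o []      = 0≤+ ≤-refl (0≤* (0≤-lit ½) (sum-nonNeg (λ j → 0≤⁺ (w j - fromℕ o))))
    pathSum-θ o (i ∷ p) = begin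
      f i + θ R (fromℕ (suc o)) + pathSum (suc o) (λ t i → f i + θ R (fromℕ t)) p   ≤⟨ +-monoʳ-≤ (f i + θ R (fromℕ (suc o))) (pathSum-θ (suc o) p) ⟩
      f i + ½ * sum β + (G + ½ * sum γ)                    ≡⟨ l (f i) (sum β) G (sum γ) ⟩
      f i + G + ½ * (sum β + sum γ)                        ≡⟨ cong (λ z → f i + G + ½ * z) (∑-distrib-+ β γ) ⟨
      f i + G + ½ * sum (λ j → β j + γ j)                  ≤⟨ +-monoʳ-≤ (f i + G) (*-monoˡ-≤-nonNeg ½ (sum-mono (λ j → below-step o (w j)))) ⟩
      f i + G + ½ * sum (λ j → (w j - fromℕ o) ⁺)          ∎
      where
      open ≤-Reasoning
      G = List.foldr _+_ 0ℚ (List.map f p)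
      β γ : Fin m → ℚ
      β j = does (fromℕ (suc o) <? w j) · 1ℚ
      γ j = (w j - fromℕ (suc o)) ⁺
      l : ∀ f b g c → f + ½ * b + (g + ½ * c) ≡ f + g + ½ * (b + c)
      l = solve 4 (λ f b g c → f :+ con ½ :* b :+ (g :+ con ½ :* c) := f :+ g :+ con ½ :* (b :+ c)) refl

    -- Weak duality along the path of `S`, without passing through a point of the linear program:
    -- the charge of a client at its own facility and position is one of the terms collected along
    -- the path.
    integral-bound : ∀ S → + 31 / 160 * volume ≤ cost I S
    integral-bound S = collect (cost I S) (begin
      sum d                                                        ≤⟨ sum-mono termwise ⟩
      sum (λ j → K j + pathSum 0 (λ t i → charge R (fromℕ t) i j) path) ≡⟨ ∑-distrib-+ K (λ j → pathSum 0 (λ t i → charge R (fromℕ t) i j) path) ⟩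
      sum K + sum (λ j → pathSum 0 (λ t i → charge R (fromℕ t) i j) path) ≡⟨ cong (λ z → sum K + z) (pathSum-sum 0 (λ j t i → charge R (fromℕ t) i j) path) ⟩
      sum K + pathSum 0 (λ t i → sum (charge R (fromℕ t) i)) path  ≤⟨ +-monoʳ-≤ (sum K) (pathSum-mono 0 (λ t i → star-bound R (fromℕ (suc t)) (1≤fromℕ-suc t) i) path) ⟩
      sum K + pathSum 0 (λ t i → f i + θ R (fromℕ t)) path         ≤⟨ +-monoʳ-≤ (sum K) (pathSum-θ 0 path) ⟩
      sum K + (G + ½ * sum (λ j → (w j - fromℕ 0) ⁺))              ≤⟨ +-monoʳ-≤ (sum K) (+-monoʳ-≤ G (*-monoˡ-≤-nonNeg ½ (sum-mono (λ j → ⁺-start (0≤weight j))))) ⟩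
      sum K + (G + ½ * sum w)                                      ≡⟨ l (sum K) G (½ * sum w) ⟩
      G + sum K + ½ * sum w                                        ∎)
      where
      open ≤-Reasoning
      open Solution S
      G = List.foldr _+_ 0ℚ (List.map f path)
      K : Fin m → ℚ
      K j = c (φ j) j + fromℕ (π∘φ j)
      l : ∀ k g w → k + (g + w) ≡ g + k + w
      l = solve 3 (λ k g w → k :+ (g :+ w) := g :+ k :+ w) refl
      termwise : ∀ j → d j ≤ K j + pathSum 0 (λ t i → charge R (fromℕ t) i j) path
      termwise j = ≤-trans (by-difference (charge R (fromℕ (π∘φ j)) (φ j) j - (d j - c (φ j) j - fromℕ (π∘φ j)))
          (r (d j) (c (φ j) j) (fromℕ (π∘φ j)) (charge R (fromℕ (π∘φ j)) (φ j) j)) (0≤- (≤⁺ _)))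
        (+-monoʳ-≤ (K j) (pathSum-term 0 (λ t i → 0≤⁺ _) (φ-open j)))
        where
        r : ∀ d c t h → c + t + h - d ≡ h - (d - c - t)
        r = solve 4 (λ d c t h → c :+ t :+ h :- d := h :- (d :- c :- t)) refl

-- Invariants of the rounds

module Rounds where

  open Programs
  open Values
  open Duality
  open import Data.Bool using (Bool; true; false; not; T) renaming (if_then_else_ to ifᵇ_then_else_)
  open import Data.Fin using (Fin; zero; suc; toℕ)
  open import Data.Integer as ℤ using (+_; -[1+_])
  open import Data.List using (List; []; _∷_; _++_; map; foldr; length; allFin; reverse)
  open import Data.List.Membership.Propositional using (_∈_)
  open import Data.List.Membership.Propositional.Properties using (∈-allFin; ∈-++⁻)
  open import Data.List.Properties using (++-identityʳ; map-cong; unfold-reverse; length-reverse)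
  import Data.List.Relation.Unary.All.Properties as Allₚ
  open import Data.List.Relation.Unary.AllPairs using ([]; _∷_)
  open import Data.List.Relation.Unary.Any using (here; there; index)
  open import Data.List.Relation.Unary.Any.Properties using (reverse⁺)
  open import Data.List.Relation.Unary.Unique.Propositional using (Unique)
  open import Data.List.Relation.Unary.Unique.Propositional.Properties using (allFin⁺)
  open import Data.List.Relation.Binary.Permutation.Propositional as Perm using (_↭_; ↭-sym; ↭-trans; ↭-refl; ↭-reflexive; ↭⇒↭ₛ)
  open import Data.List.Relation.Binary.Permutation.Propositional.Properties using (∈-resp-↭; shift; ++⁺ˡ; ++⁺ʳ; ++-comm; ↭-reverse)
  import Data.List.Relation.Binary.Permutation.Setoid.Properties as SetoidPerm
  open import Data.Maybe using (Maybe; just; nothing; is-just)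
  open import Data.Nat as ℕ using (ℕ; zero; suc; z≤n; s≤s)
  import Data.Nat.Properties as ℕₚ
  open import Data.Nat.Tactic.RingSolver using (solve-∀)
  open import Data.Product using (Σ; ∃-syntax; _×_; _,_; proj₁; proj₂)
  open import Data.Rational hiding (round)
  open import Data.Rational.Properties
  open import Data.Rational.Solver using (module +-*-Solver)
  open import Data.Sum using (_⊎_; inj₁; inj₂)
  open import Data.Unit using (tt)
  open import Function using (_∘_; id)
  open import Relation.Binary.PropositionalEquality hiding ([_])
  open import Relation.Nullary.Negation using (contradiction)
  import Defs
  open Defs using (fromℕ; ⌜_⌝ᵠ; ⌜_⌝ⁿ; listTree; left; Instance; IsMetric; Solution; cost; encodeInstance; encodeSolution)
  open +-*-Solver using (solve; _:+_; _:*_; _:-_; :-_; _:=_; con)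

  -- The list of open facilities is kept in reverse chronological order, so
  -- that k is the final position of i.
  data At {k : ℕ} (i : Fin k) : List (Fin k) → ℕ → Set where
    here  : ∀ {O} → At i (i ∷ O) (suc (length O))
    there : ∀ {x O p} → At i O p → At i (x ∷ O) p

  At⇒∈ : ∀ {k} {i : Fin k} {O p} → At i O p → i ∈ O
  At⇒∈ here       = here refl
  At⇒∈ (there at) = there (At⇒∈ at)

  ∈⇒At : ∀ {k} {i : Fin k} {O} → i ∈ O → ∃[ p ] At i O p
  ∈⇒At (here refl) = _ , here
  ∈⇒At (there i∈O) = let (p , at) = ∈⇒At i∈O in p , there at

  At⇒≤ : ∀ {k} {i : Fin k} {O p} → At i O p → p ℕ.≤ length O
  At⇒≤ here       = ℕₚ.≤-refl
  At⇒≤ (there at) = ℕₚ.m≤n⇒m≤1+n (At⇒≤ at)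

  fromℕ-mono : ∀ {a b} → a ℕ.≤ b → fromℕ a ≤ fromℕ b
  fromℕ-mono {b = b} z≤n = 0≤fromℕ b
  fromℕ-mono (s≤s {a} {b} p) = subst₂ _≤_ (sym (fromℕ-suc a)) (sym (fromℕ-suc b)) (+-monoʳ-≤ 1ℚ (fromℕ-mono p))

  total : ∀ {k} → (Fin k → ℚ) → List (Fin k) → ℚ
  total F O = foldr _+_ 0ℚ (map F O)

  module _ (I : Costs) where

    F : Fin (n I) → ℚ
    F i = value (f I i)

    d : Fin (n I) → Fin (m I) → ℚ
    d i j = value (c I i j)

    0≤F : ∀ i → 0ℚ ≤ F i
    0≤F i = 0≤value (f I i)

    0≤d : ∀ i j → 0ℚ ≤ d i j
    0≤d i j = 0≤value (c I i j)

    free : Entry I → Bool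
    free e = not (is-just e)

    close : ℕ → Fin (n I) → Fin (m I) → Bool
    close r i j = c I i j ≤ᶠ Q (suc r)

    close-true : ∀ r i j → close r i j ≡ true → d i j ≤ P (suc r)
    close-true r i j eq = ≤-trans (≤ᶠ-true (c I i j) (Q (suc r)) eq) (≤-reflexive (sym (P-value (suc r))))

    close-false : ∀ r i j → close r i j ≡ false → P (suc r) ≤ d i j
    close-false r i j eq = ≤-trans (≤-reflexive (P-value (suc r))) (≤ᶠ-false (c I i j) (Q (suc r)) eq)

    -- By definition, `near I p e x` is `joins e (x ≤ᶠ p)`. Abstracting from the comparison lets the
    -- lemmas about one client proceed by cases on an entry and a Boolean.
    joins : Entry I → Bool → Bool
    joins e b = ifᵇ is-just e then false else b

    update : Fin (n I) → ℕ → Entry I → Bool → Entry I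
    update i r e b = ifᵇ joins e b then just (i , r) else e

    joining : ℕ → Fin (n I) → Assignment I → Fin (m I) → Bool
    joining r i a j = joins (a j) (close r i j)

    waiting-value : ∀ a → value (waiting I a) ≡ ½ * sum (λ j → free (a j) · 1ℚ)
    waiting-value a = trans (value-sumᶠ (λ j → ifᵇ is-just (a j) then 0ᶠ else half I))
      (trans (sum-cong-≗ (λ j → entry-value (a j))) (sum-*ˡ ½ (λ j → free (a j) · 1ℚ)))
      where
      entry-value : ∀ (e : Entry I) → value (ifᵇ is-just e then 0ᶠ else half I) ≡ ½ * (free e · 1ℚ)
      entry-value nothing  = trans value-½ (sym (*-identityʳ ½))
      entry-value (just _) = trans value-0ᶠ (sym (*-zeroʳ ½))

    nearPrices-value : ∀ r i a → value (nearPrices I (Q (suc r)) i a) ≡ sum (λ j → joining r i a j · P (suc r))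
    nearPrices-value r i a = trans (value-sumᶠ (λ j → ifᵇ joining r i a j then Q (suc r) else 0ᶠ))
      (sum-cong-≗ (λ j → trans (value-if (joining r i a j) (Q (suc r))) (cong (joining r i a j ·_) (sym (P-value (suc r))))))

    nearCosts-value : ∀ r i a → value (nearCosts I (Q (suc r)) i a) ≡ sum (λ j → joining r i a j · d i j)
    nearCosts-value r i a = trans (value-sumᶠ (λ j → ifᵇ joining r i a j then c I i j else 0ᶠ))
      (sum-cong-≗ (λ j → value-if (joining r i a j) (c I i j)))

    bill-value : ∀ r K i a → value ((f I i +ᶠ K) +ᶠ nearCosts I (Q (suc r)) i a) ≡ F i + value K + sum (λ j → joining r i a j · d i j)
    bill-value r K i a = trans (value-+ᶠ (f I i +ᶠ K) (nearCosts I (Q (suc r)) i a))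
      (cong₂ _+_ (value-+ᶠ (f I i) K) (nearCosts-value r i a))

    affordable-true : ∀ r K i a → affordable I r K i a ≡ true →
      F i + value K + sum (λ j → joining r i a j · d i j) ≤ sum (λ j → joining r i a j · P (suc r))
    affordable-true r K i a eq = subst₂ _≤_ (bill-value r K i a) (nearPrices-value r i a) (≤ᶠ-true _ (nearPrices I (Q (suc r)) i a) eq)

    affordable-false : ∀ r K i a → affordable I r K i a ≡ false →
      sum (λ j → joining r i a j · P (suc r)) ≤ F i + value K + sum (λ j → joining r i a j · d i j)
    affordable-false r K i a eq = subst₂ _≤_ (nearPrices-value r i a) (bill-value r K i a) (≤ᶠ-false _ (nearPrices I (Q (suc r)) i a) eq)

    -- An assigned client pays the price of its round; an unassigned client
    -- has already waited for every open facility.  Waiting costs half.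

    clientCost : ℕ → ℕ → Fin (m I) → Entry I → ℚ
    clientCost L ℓ j nothing        = ½ * fromℕ L
    clientCost L ℓ j (just (i , _)) = d i j + ½ * fromℕ ℓ

    payment : Entry I → ℚ
    payment nothing        = 0ℚ
    payment (just (_ , s)) = P (suc s)

    -- In `paid`, assigned clients alone cover the opening costs, their connections and half of all
    -- waiting, including what unassigned clients have accrued so far. An unassigned client
    -- therefore owes nothing for the past when it is assigned.
    record Ledger (r : ℕ) (O : List (Fin (n I))) (a : Assignment I) : Set where
      field
        position : Fin (m I) → ℕ
        placed   : ∀ j i s → a j ≡ just (i , s) → At i O (position j) × d i j ≤ P (suc s) × s ℕ.< r
        paid     : total F O + sum (λ j → clientCost (length O) (position j) j (a j)) ≤ sum (λ j → payment (a j))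

    ledger-weaken : ∀ {r O a} → Ledger r O a → Ledger (suc r) O a
    ledger-weaken L = record { position = position ; paid = paid
      ; placed = λ j i s e → let (at , near , s<r) = placed j i s e in at , near , ℕₚ.m≤n⇒m≤1+n s<r }
      where open Ledger L

    pick : Bool → ℕ → ℕ → ℕ
    pick b k l = ifᵇ b then k else l

    placed-update : ∀ {O O′} r i k j e l b → (b ≡ true → d i j ≤ P (suc r)) → (∀ {i p} → At i O p → At i O′ p) → At i O′ k →
      (∀ i s → e ≡ just (i , s) → At i O l × d i j ≤ P (suc s) × s ℕ.< suc r) →
      ∀ i′ s → update i r e b ≡ just (i′ , s) → At i′ O′ (pick (joins e b) k l) × d i′ j ≤ P (suc s) × s ℕ.< suc r
    placed-update r i k j (just _) l b     near later at old i′ s eq = let (x , y) = old i′ s eq in later x , y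
    placed-update r i k j nothing  l true  near later at old .i .r refl = at , near refl , ℕₚ.≤-refl

    payment-update : ∀ i r e b → payment (update i r e b) ≡ payment e + joins e b · P (suc r)
    payment-update i r (just _) b     = sym (+-identityʳ _)
    payment-update i r nothing  true  = sym (+-identityˡ _)
    payment-update i r nothing  false = sym (+-identityˡ _)

    payments-assign : ∀ r i a → sum (λ j → payment (assign I r i a j)) ≡ sum (λ j → payment (a j)) + sum (λ j → joining r i a j · P (suc r))
    payments-assign r i a = trans (sum-cong-≗ (λ j → payment-update i r (a j) (close r i j)))
      (∑-distrib-+ (λ j → payment (a j)) (λ j → joining r i a j · P (suc r)))

    -- Half of `L` is already booked for a waiting client, and its facility stands at position
    -- `k ≤ L`. Only the connection is new, and the price covers it.
    cost-reconnect : ∀ L k l r i j e b → (b ≡ true → d i j ≤ P (suc r)) → k ℕ.≤ L →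
      clientCost L (pick (joins e b) k l) j (update i r e b) ≤ clientCost L l j e + joins e b · P (suc r)
    cost-reconnect L k l r i j (just _) b     near k≤L = ≤-reflexive (sym (+-identityʳ _))
    cost-reconnect L k l r i j nothing  true  near k≤L = ≤-trans (+-mono-≤ (near refl) (*-monoˡ-≤-nonNeg ½ (fromℕ-mono k≤L)))
      (≤-reflexive (+-comm (P (suc r)) (½ * fromℕ L)))
    cost-reconnect L k l r i j nothing  false near k≤L = ≤-reflexive (sym (+-identityʳ _))

    -- The new facility stands at position `suc L`. Whether an unassigned client joins it or goes on
    -- waiting, its booked time rises by the same half step.
    cost-open : ∀ L l r i j e b →
      clientCost (suc L) (pick (joins e b) (suc L) l) j (update i r e b) ≤ clientCost L l j e + (joins e b · d i j + ½ * (free e · 1ℚ))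
    cost-open L l r i j (just (i′ , _)) b = ≤-reflexive (s (d i′ j + ½ * fromℕ l))
      where
      s : ∀ x → x ≡ x + (0ℚ + ½ * 0ℚ)
      s = solve 1 (λ x → x := x :+ (con 0ℚ :+ con ½ :* con 0ℚ)) refl
    cost-open L l r i j nothing  true  = ≤-reflexive (trans (cong (λ z → d i j + ½ * z) (fromℕ-suc L)) (s (d i j) (fromℕ L)))
      where
      s : ∀ x y → x + ½ * (1ℚ + y) ≡ ½ * y + (x + ½ * 1ℚ)
      s = solve 2 (λ x y → x :+ con ½ :* (con 1ℚ :+ y) := con ½ :* y :+ (x :+ con ½ :* con 1ℚ)) refl
    cost-open L l r i j nothing  false = ≤-reflexive (trans (cong (λ z → ½ * z) (fromℕ-suc L)) (s (fromℕ L)))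
      where
      s : ∀ y → ½ * (1ℚ + y) ≡ ½ * y + (0ℚ + ½ * 1ℚ)
      s = solve 1 (λ y → con ½ :* (con 1ℚ :+ y) := con ½ :* y :+ (con 0ℚ :+ con ½ :* con 1ℚ)) refl

    ledger-reconnect : ∀ {r O a} i → i ∈ O → Ledger (suc r) O a → Ledger (suc r) O (assign I r i a)
    ledger-reconnect {r} {O} {a} i i∈O Λ = record
      { position = λ j → pick (joining r i a j) k (position j)
      ; placed   = λ j → placed-update r i k j (a j) (position j) (close r i j) (close-true r i j) id at (placed j)
      ; paid     = begin
          total F O + sum (λ j → clientCost L (pick (joining r i a j) k (position j)) j (assign I r i a j))
            ≤⟨ +-monoʳ-≤ (total F O) (sum-mono (λ j → cost-reconnect L k (position j) r i j (a j) (close r i j) (close-true r i j) (At⇒≤ at))) ⟩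
          total F O + sum (λ j → C j + joining r i a j · P (suc r))
            ≡⟨ cong (λ z → total F O + z) (∑-distrib-+ C (λ j → joining r i a j · P (suc r))) ⟩
          total F O + (sum C + N)
            ≡⟨ +-assoc (total F O) (sum C) N ⟨
          total F O + sum C + N
            ≤⟨ +-monoˡ-≤ N paid ⟩
          sum (λ j → payment (a j)) + N
            ≡⟨ payments-assign r i a ⟨
          sum (λ j → payment (assign I r i a j)) ∎
      }
      where
      open Ledger Λ
      open ≤-Reasoning
      k = proj₁ (∈⇒At i∈O)
      at = proj₂ (∈⇒At i∈O)
      L = length O
      C : Fin (m I) → ℚ
      C j = clientCost L (position j) j (a j)
      N = sum (λ j → joining r i a j · P (suc r))

    -- `K` was computed at the start of the round, when at least as many clients were unassigned as
    -- now; so the bill that passed the test covers the half steps booked by this opening.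
    ledger-open : ∀ {r O a} K i → affordable I r K i a ≡ true → ½ * sum (λ j → free (a j) · 1ℚ) ≤ value K →
                  Ledger (suc r) O a → Ledger (suc r) (i ∷ O) (assign I r i a)
    ledger-open {r} {O} {a} K i aff waits Λ = record
      { position = λ j → pick (joining r i a j) (suc L) (position j)
      ; placed   = λ j → placed-update r i (suc L) j (a j) (position j) (close r i j) (close-true r i j) there here (placed j)
      ; paid     = begin
          F i + total F O + sum (λ j → clientCost (suc L) (pick (joining r i a j) (suc L) (position j)) j (assign I r i a j))
            ≤⟨ +-monoʳ-≤ (F i + total F O) (sum-mono (λ j → cost-open L (position j) r i j (a j) (close r i j))) ⟩
          F i + total F O + sum (λ j → C j + (joining r i a j · d i j + ½ * (free (a j) · 1ℚ)))
            ≡⟨ cong (λ z → F i + total F O + z) (trans (∑-distrib-+ C (λ j → joining r i a j · d i j + ½ * (free (a j) · 1ℚ)))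
                 (cong (λ z → sum C + z) (trans (∑-distrib-+ (λ j → joining r i a j · d i j) (λ j → ½ * (free (a j) · 1ℚ))) (cong (λ z → D + z) (sum-*ˡ ½ (λ j → free (a j) · 1ℚ)))))) ⟩
          F i + total F O + (sum C + (D + ½ * sum (λ j → free (a j) · 1ℚ)))
            ≤⟨ +-monoʳ-≤ (F i + total F O) (+-monoʳ-≤ (sum C) (+-monoʳ-≤ D waits)) ⟩
          F i + total F O + (sum C + (D + value K))
            ≡⟨ s (F i) (total F O) (sum C) D (value K) ⟩
          total F O + sum C + (F i + value K + D)
            ≤⟨ +-mono-≤ paid (affordable-true r K i a aff) ⟩
          sum (λ j → payment (a j)) + sum (λ j → joining r i a j · P (suc r))
            ≡⟨ payments-assign r i a ⟨
          sum (λ j → payment (assign I r i a j)) ∎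
      }
      where
      open Ledger Λ
      open ≤-Reasoning
      L = length O
      C : Fin (m I) → ℚ
      C j = clientCost L (position j) j (a j)
      D = sum (λ j → joining r i a j · d i j)
      s : ∀ f t c e k → f + t + (c + (e + k)) ≡ t + c + (f + k + e)
      s = solve 5 (λ f t c e k → f :+ t :+ (c :+ (e :+ k)) := t :+ c :+ (f :+ k :+ e)) refl

    -- Within round `r` an entry changes only from empty to one dated `r`. `Blocked` and `Settled`
    -- survive such changes, so they can be established facility by facility and hold at the end of
    -- the round.
    Extends : ℕ → Assignment I → Assignment I → Set
    Extends r a₀ a = ∀ j → a j ≡ a₀ j ⊎ (a₀ j ≡ nothing × ∃[ i ] a j ≡ just (i , r))

    extends-trans : ∀ {r a b e} → Extends r a b → Extends r b e → Extends r a e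
    extends-trans ab be j with be j | ab j
    ... | inj₁ p       | inj₁ q       = inj₁ (trans p q)
    ... | inj₁ p       | inj₂ (q , i , s) = inj₂ (q , i , trans p s)
    ... | inj₂ (p , s) | inj₁ q       = inj₂ (trans (sym q) p , s)
    ... | inj₂ (p , s) | inj₂ (q , _) = inj₂ (q , s)

    extends-free : ∀ {r a b} → Extends r a b → ∀ j → b j ≡ nothing → a j ≡ nothing
    extends-free ab j eq with ab j
    ... | inj₁ p       = trans (sym p) eq
    ... | inj₂ (q , _) = q

    extends-assign : ∀ r i a → Extends r a (assign I r i a)
    extends-assign r i a j = go (a j) (close r i j)
      where
      go : ∀ e b → update i r e b ≡ e ⊎ (e ≡ nothing × ∃[ i′ ] update i r e b ≡ just (i′ , r))
      go (just _) b     = inj₁ refl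
      go nothing  true  = inj₂ (refl , i , refl)
      go nothing  false = inj₁ refl

    free-≤ : ∀ {r a b} → Extends r a b → ∀ j {x} → 0ℚ ≤ x → free (b j) · x ≤ free (a j) · x
    free-≤ {a = a} {b} ab j {x} 0≤x with b j in eq
    ... | just _  = 0≤· (free (a j)) 0≤x
    ... | nothing = ≤-reflexive (cong (λ e → free e · x) (sym (extends-free ab j eq)))

    Blocked : ℕ → Assignment I → Fin (n I) → Set
    Blocked r a i = ∀ j → a j ≡ nothing → P (suc r) ≤ d i j

    Settled : ℕ → Fraction → Assignment I → Fin (n I) → Set
    Settled r K a i = sum (λ j → free (a j) · (P (suc r) - d i j) ⁺) ≤ F i + value K

    blocked-extends : ∀ {r a b i} → Extends r a b → Blocked r a i → Blocked r b i
    blocked-extends ab blocked j eq = blocked j (extends-free ab j eq)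

    settled-extends : ∀ {r K a b i} → Extends r a b → Settled r K a i → Settled r K b i
    settled-extends ab settled = ≤-trans (sum-mono (λ j → free-≤ ab j (0≤⁺ _))) settled

    blocked-assign : ∀ r i a → Blocked r (assign I r i a) i
    blocked-assign r i a j = go (a j) (close r i j) (close-false r i j)
      where
      go : ∀ e b → (b ≡ false → P (suc r) ≤ d i j) → update i r e b ≡ nothing → P (suc r) ≤ d i j
      go nothing false far _ = far refl

    difference-zero : ∀ {x y} → x ≤ y → (x - y) ⁺ ≡ 0ℚ
    difference-zero {x} {y} x≤y = ⁺-zero (≤-trans (+-monoˡ-≤ (- y) x≤y) (≤-reflexive (+-inverseʳ y)))

    blocked⇒settled : ∀ {r a i} K → Blocked r a i → Settled r K a i
    blocked⇒settled {r} {a} {i} K blocked = ≤-trans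
      (≤-reflexive (trans (sum-cong-≗ (λ j → none (a j) (blocked j))) (sum-replicate-zero (m I))))
      (0≤+ (0≤F i) (0≤value K))
      where
      none : ∀ {j} e → (e ≡ nothing → P (suc r) ≤ d i j) → free e · (P (suc r) - d i j) ⁺ ≡ 0ℚ
      none (just _) far = refl
      none nothing  far = difference-zero (far refl)

    -- For an unassigned client, `(P (suc r) - d i j) ⁺` vanishes unless the client is near, and
    -- then it is price minus connection. The failed test, read backwards, is the claim.
    rejected⇒settled : ∀ r K i a → affordable I r K i a ≡ false → Settled r K a i
    rejected⇒settled r K i a eq = begin
      sum (λ j → free (a j) · (P (suc r) - d i j) ⁺)   ≤⟨ sum-mono (λ j → offer≤ (a j) (close r i j) (close-true r i j) (close-false r i j)) ⟩
      sum (λ j → joining r i a j · P (suc r) - joining r i a j · d i j) ≡⟨ ∑-distrib-+ (λ j → joining r i a j · P (suc r)) (λ j → - (joining r i a j · d i j)) ⟩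
      A + sum (λ j → - (joining r i a j · d i j))      ≡⟨ cong (λ z → A + z) (trans (sum-cong-≗ (λ j → negate (joining r i a j · d i j))) (sum-*ˡ (- 1ℚ) (λ j → joining r i a j · d i j))) ⟩
      A + (- 1ℚ) * B                                   ≤⟨ +-monoˡ-≤ ((- 1ℚ) * B) (affordable-false r K i a eq) ⟩
      F i + value K + B + (- 1ℚ) * B                   ≡⟨ s (F i + value K) B ⟩
      F i + value K                                    ∎
      where
      open ≤-Reasoning
      A = sum (λ j → joining r i a j · P (suc r))
      B = sum (λ j → joining r i a j · d i j)
      s : ∀ x b → x + b + (- 1ℚ) * b ≡ x
      s = solve 2 (λ x b → x :+ b :+ con (- 1ℚ) :* b := x) refl
      negate : ∀ x → - x ≡ (- 1ℚ) * x
      negate = solve 1 (λ x → :- x := con (- 1ℚ) :* x) refl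
      offer≤ : ∀ {j} e b → (b ≡ true → d i j ≤ P (suc r)) → (b ≡ false → P (suc r) ≤ d i j) →
               free e · (P (suc r) - d i j) ⁺ ≤ joins e b · P (suc r) - joins e b · d i j
      offer≤ (just _) b     near far = ≤-refl
      offer≤ nothing  true  near far = ⁺-lub (0≤- (near refl)) ≤-refl
      offer≤ nothing  false near far = ≤-reflexive (difference-zero (far refl))

    reconnect-correct : ∀ r O is a → (∀ {i} → i ∈ is → i ∈ O) → Ledger (suc r) O a → let a′ = reconnect I r is a in
      Ledger (suc r) O a′ × Extends r a a′ × (∀ {i} → i ∈ is → Blocked r a′ i)
    reconnect-correct r O []       a is⊆O Λ = Λ , (λ _ → inj₁ refl) , λ ()
    reconnect-correct r O (i ∷ is) a is⊆O Λ =
      let (Λ′ , ext , blocked) = reconnect-correct r O is (assign I r i a) (is⊆O ∘ there) (ledger-reconnect i (is⊆O (here refl)) Λ) in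
      Λ′ , extends-trans (extends-assign r i a) ext ,
      λ { (here refl) → blocked-extends ext (blocked-assign r i a) ; (there i∈is) → blocked i∈is }

    -- The closed list of `s` holds only the facilities rejected so far in this pass; those still to
    -- be tested are in neither list and nothing is asserted about them.
    record Midway (r : ℕ) (K : Fraction) (a₀ : Assignment I) (s : Sites I) : Set where
      constructor midway
      field
        ledger  : Ledger (suc r) (proj₁ s) (proj₂ (proj₂ s))
        extends : Extends r a₀ (proj₂ (proj₂ s))
        blocked : ∀ {i} → i ∈ proj₁ s → Blocked r (proj₂ (proj₂ s)) i
        settled : ∀ {i} → i ∈ proj₁ (proj₂ s) → Settled r K (proj₂ (proj₂ s)) i

    tryOpen-correct : ∀ r K a₀ i s → ½ * sum (λ j → free (a₀ j) · 1ℚ) ≤ value K → Midway r K a₀ s → Midway r K a₀ (tryOpen I r K i s)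
    tryOpen-correct r K a₀ i (O , C , a) waits (midway Λ ext blocked settled) with affordable I r K i a in eq
    ... | true  = midway
      (ledger-open K i eq (≤-trans (*-monoˡ-≤-nonNeg ½ (sum-mono (λ j → free-≤ ext j (0≤-lit 1ℚ)))) waits) Λ)
      (extends-trans ext (extends-assign r i a))
      (λ { (here refl) → blocked-assign r i a ; (there i∈O) → blocked-extends (extends-assign r i a) (blocked i∈O) })
      (λ i∈C → settled-extends (extends-assign r i a) (settled i∈C))
    ... | false = midway Λ ext blocked
      (λ { (here refl) → rejected⇒settled r K i a eq ; (there i∈C) → settled i∈C })

    pass-correct : ∀ r K a₀ is s → ½ * sum (λ j → free (a₀ j) · 1ℚ) ≤ value K → Midway r K a₀ s → Midway r K a₀ (pass I r K is s)
    pass-correct r K a₀ []       s waits M = M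
    pass-correct r K a₀ (i ∷ is) s waits M = pass-correct r K a₀ is _ waits (tryOpen-correct r K a₀ i s waits M)

    sitesList : Sites I → List (Fin (n I))
    sitesList (O , C , _) = O ++ C

    tryOpen-↭ : ∀ r K i s → sitesList (tryOpen I r K i s) ↭ i ∷ sitesList s
    tryOpen-↭ r K i (O , C , a) with affordable I r K i a
    ... | true  = ↭-refl
    ... | false = shift i O C

    pass-↭ : ∀ r K is s → sitesList (pass I r K is s) ↭ is ++ sitesList s
    pass-↭ r K []       s = ↭-refl
    pass-↭ r K (i ∷ is) s = ↭-trans (pass-↭ r K is (tryOpen I r K i s)) (↭-trans (++⁺ˡ is (tryOpen-↭ r K i s)) (shift i is (sitesList s)))

    -- Tells from the current entry whether the client was unassigned at the start of round `s`.
    -- Statements about past rounds can thus be made without past assignments.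
    alive : ℕ → Entry I → Bool
    alive s nothing        = true
    alive s (just (_ , t)) = s ℕ.≤ᵇ t

    -- In `stable t`, the left side runs over the clients unassigned after round `t`, the right side
    -- counts those unassigned at its start. In `blocked`, the facility of `l` is open from round
    -- `t` on, so whoever is still unassigned after round `u` is at least the price of that round
    -- away from it.
    record Invariant (r : ℕ) (s : Sites I) : Set where
      field
        ledger  : Ledger r (proj₁ s) (proj₂ (proj₂ s))
        stable  : ∀ t → t ℕ.< r → ∀ i → sum (λ j → alive (suc t) (proj₂ (proj₂ s) j) · (P (suc t) - d i j) ⁺) ≤
                                      F i + ½ * sum (λ j → alive t (proj₂ (proj₂ s) j) · 1ℚ)
        blocked : ∀ l i t → proj₂ (proj₂ s) l ≡ just (i , t) → ∀ u → t ℕ.≤ u → u ℕ.< r →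
                  ∀ j → alive (suc u) (proj₂ (proj₂ s) j) ≡ true → P (suc u) ≤ d i j
        sites-↭ : sitesList s ↭ allFin (n I)

    ≤ᵇ-false : ∀ {a b} → b ℕ.< a → (a ℕ.≤ᵇ b) ≡ false
    ≤ᵇ-false {a} {b} b<a with a ℕ.≤ᵇ b in eq
    ... | false = refl
    ... | true  = contradiction (ℕₚ.≤ᵇ⇒≤ a b (subst T (sym eq) tt)) (ℕₚ.<⇒≱ b<a)

    -- An entry filled in round `r` was empty before, and either form counts as alive at every `t`
    -- up to `r`.
    alive-extends : ∀ {r a b} → Extends r a b → ∀ t → t ℕ.≤ r → ∀ j → alive t (b j) ≡ alive t (a j)
    alive-extends ab t t≤r j with ab j
    ... | inj₁ p = cong (alive t) p
    ... | inj₂ (q , i , p) = trans (cong (alive t) p) (trans (≤ᵇ-true t≤r) (cong (alive t) (sym q)))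

    alive-free : ∀ {r} {a : Assignment I} → (∀ j i s → a j ≡ just (i , s) → s ℕ.< r) → ∀ j → alive r (a j) ≡ free (a j)
    alive-free {r} {a} early j with a j in eq
    ... | nothing      = refl
    ... | just (i , s) = ≤ᵇ-false (early j i s eq)

    round-correct : ∀ r s → Invariant r s → Invariant (suc r) (proj₂ (round I (r , s)))
    round-correct r s@(O , C , a₀) Inv = record
      { ledger  = Midway.ledger M
      ; stable  = stable′
      ; blocked = blocked′
      ; sites-↭ = ↭-trans (pass-↭ r K C (O , [] , a₁)) (↭-trans (↭-reflexive (cong (C ++_) (++-identityʳ O)))
                    (↭-trans (++-comm C O) sites-↭))
      }
      where
      open Invariant Inv
      K = waiting I a₀
      a₁ = reconnect I r O a₀
      R = reconnect-correct r O O a₀ id (ledger-weaken ledger)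
      M : Midway r K a₀ (pass I r K C (O , [] , a₁))
      M = pass-correct r K a₀ C (O , [] , a₁) (≤-reflexive (sym (waiting-value a₀)))
            (midway (proj₁ R) (proj₁ (proj₂ R)) (proj₂ (proj₂ R)) λ ())
      a′ : Assignment I
      a′ = proj₂ (proj₂ (pass I r K C (O , [] , a₁)))
      ext : Extends r a₀ a′
      ext = Midway.extends M
      O′ = proj₁ (pass I r K C (O , [] , a₁))
      C′ = proj₁ (proj₂ (pass I r K C (O , [] , a₁)))
      -- The permutation guarantees that no facility is lost. An open one is blocked, so all its
      -- terms vanish; a closed one was rejected in this pass.
      settled-all : ∀ i → Settled r K a′ i
      settled-all i with ∈-++⁻ O′ (∈-resp-↭ (↭-sym (↭-trans (pass-↭ r K C (O , [] , a₁)) (↭-trans (↭-reflexive (cong (C ++_) (++-identityʳ O)))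
                    (↭-trans (++-comm C O) sites-↭)))) (∈-allFin i))
      ... | inj₁ i∈O = blocked⇒settled K (Midway.blocked M i∈O)
      ... | inj₂ i∈C = Midway.settled M i∈C
      early₀ : ∀ j i t → a₀ j ≡ just (i , t) → t ℕ.< r
      early₀ j i t eq = proj₂ (proj₂ (Ledger.placed ledger j i t eq))
      early′ : ∀ j i t → a′ j ≡ just (i , t) → t ℕ.< suc r
      early′ j i t eq = proj₂ (proj₂ (Ledger.placed (Midway.ledger M) j i t eq))
      stable′ : ∀ t → t ℕ.< suc r → ∀ i → sum (λ j → alive (suc t) (a′ j) · (P (suc t) - d i j) ⁺) ≤ F i + ½ * sum (λ j → alive t (a′ j) · 1ℚ)
      stable′ t t<1+r i with ℕₚ.m≤n⇒m<n∨m≡n (ℕₚ.≤-pred t<1+r)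
      ... | inj₁ t<r = subst₂ (λ x y → x ≤ F i + ½ * y)
        (sum-cong-≗ (λ j → cong (_· (P (suc t) - d i j) ⁺) (sym (alive-extends ext (suc t) t<r j))))
        (sum-cong-≗ (λ j → cong (_· 1ℚ) (sym (alive-extends ext t (ℕₚ.<⇒≤ t<r) j))))
        (stable t t<r i)
      -- The inequality of the round just finished: its left side refers to `a′`, while `K` counts
      -- the clients unassigned in `a₀`, which are those alive at `t`.
      ... | inj₂ refl = subst₂ (λ x y → x ≤ F i + y)
        (sum-cong-≗ (λ j → cong (_· (P (suc t) - d i j) ⁺) (sym (alive-free early′ j))))
        (trans (waiting-value a₀) (cong (½ *_) (sum-cong-≗ (λ j → cong (_· 1ℚ) (trans (sym (alive-free early₀ j)) (sym (alive-extends ext t ℕₚ.≤-refl j)))))))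
        (settled-all i)
      blocked′ : ∀ l i t → a′ l ≡ just (i , t) → ∀ u → t ℕ.≤ u → u ℕ.< suc r → ∀ j → alive (suc u) (a′ j) ≡ true → P (suc u) ≤ d i j
      blocked′ l i t eq u t≤u u<1+r j al with ℕₚ.m≤n⇒m<n∨m≡n (ℕₚ.≤-pred u<1+r)
      ... | inj₂ refl = Midway.blocked M (At⇒∈ (proj₁ (Ledger.placed (Midway.ledger M) l i t eq))) j (nothing-if-free (a′ j) (trans (sym (alive-free early′ j)) al))
        where
        nothing-if-free : ∀ e → free e ≡ true → e ≡ nothing
        nothing-if-free nothing _ = refl
      ... | inj₁ u<r with ext l
      ...   | inj₁ p = blocked l i t (trans (sym p) eq) u t≤u u<r j (trans (sym (alive-extends ext (suc u) u<r j)) al)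
      ...   | inj₂ (_ , i′ , p) with trans (sym eq) p
      ...     | refl = contradiction u<r (ℕₚ.≤⇒≯ t≤u)

  rounds-number : ∀ I ts s → proj₁ (rounds I ts s) ≡ proj₁ s ℕ.+ length ts
  rounds-number I []       s = sym (ℕₚ.+-identityʳ (proj₁ s))
  rounds-number I (_ ∷ ts) s = trans (rounds-number I ts (round I s)) (sym (ℕₚ.+-suc (proj₁ s) (length ts)))

  rounds-correct : ∀ I ts s → Invariant I (proj₁ s) (proj₂ s) → Invariant I (proj₁ (rounds I ts s)) (proj₂ (rounds I ts s))
  rounds-correct I []       s inv = inv
  rounds-correct I (_ ∷ ts) s inv = rounds-correct I ts (round I s) (round-correct I (proj₁ s) (proj₂ s) inv)

  initial-correct : ∀ I C → C ↭ allFin (n I) → Invariant I 0 (proj₂ (initial I C))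
  initial-correct I C C↭ = record
    { ledger  = record { position = λ _ → 0 ; placed = λ _ _ _ () ; paid = ≤-reflexive (+-identityˡ _) }
    ; stable  = λ _ ()
    ; blocked = λ _ _ _ ()
    ; sites-↭ = C↭
    }

  final-correct : ∀ I → Invariant I (proj₁ (final I)) (proj₂ (final I))
  final-correct I = rounds-correct I (schedule I (closed I)) (initial I (closed I)) (initial-correct I (closed I) (↭-reverse (allFin (n I))))

  -- Every client is eventually assigned

  P-linear : ∀ k s → P s + fromℕ k * (+ 1 / 32 * P s) ≤ P (k ℕ.+ s)
  P-linear zero    s = ≤-reflexive (l (P s))
    where
    l : ∀ x → x + 0ℚ * (+ 1 / 32 * x) ≡ x
    l = solve 1 (λ x → x :+ con 0ℚ :* (con (+ 1 / 32) :* x) := x) refl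
  P-linear (suc k) s = begin
    P s + fromℕ (suc k) * (+ 1 / 32 * P s)             ≡⟨ cong (λ z → P s + z * (+ 1 / 32 * P s)) (fromℕ-suc k) ⟩
    P s + (1ℚ + fromℕ k) * (+ 1 / 32 * P s)            ≡⟨ l₁ (P s) (fromℕ k) ⟩
    P s + fromℕ k * (+ 1 / 32 * P s) + + 1 / 32 * P s  ≤⟨ +-mono-≤ (P-linear k s) (*-monoˡ-≤-nonNeg (+ 1 / 32) (P-mono (ℕₚ.m≤n+m s k))) ⟩
    P (k ℕ.+ s) + + 1 / 32 * P (k ℕ.+ s)               ≡⟨ l₂ (P (k ℕ.+ s)) ⟩
    + 33 / 32 * P (k ℕ.+ s)                            ≡⟨ P-suc (k ℕ.+ s) ⟨
    P (suc k ℕ.+ s)                                    ∎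
    where
    open ≤-Reasoning
    l₁ : ∀ x k → x + (1ℚ + k) * (+ 1 / 32 * x) ≡ x + k * (+ 1 / 32 * x) + + 1 / 32 * x
    l₁ = solve 2 (λ x k → x :+ (con 1ℚ :+ k) :* (con (+ 1 / 32) :* x) := x :+ k :* (con (+ 1 / 32) :* x) :+ con (+ 1 / 32) :* x) refl
    l₂ : ∀ x → x + + 1 / 32 * x ≡ + 33 / 32 * x
    l₂ = solve 1 (λ x → x :+ con (+ 1 / 32) :* x := con (+ 33 / 32) :* x) refl

  -- Bernoulli's inequality: 32 increases by 1/32 at least double the price.
  P-double : ∀ s → P s + P s ≤ P (32 ℕ.+ s)
  P-double s = ≤-trans (≤-reflexive (l (P s))) (P-linear 32 s)
    where
    l : ∀ x → x + x ≡ x + fromℕ 32 * (+ 1 / 32 * x)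
    l = solve 1 (λ x → x :+ x := x :+ con (fromℕ 32) :* (con (+ 1 / 32) :* x)) refl

  fromℕ-+ : ∀ a b → fromℕ (a ℕ.+ b) ≡ fromℕ a + fromℕ b
  fromℕ-+ zero    b = sym (+-identityˡ (fromℕ b))
  fromℕ-+ (suc a) b = trans (fromℕ-suc (a ℕ.+ b)) (trans (cong (λ z → 1ℚ + z) (fromℕ-+ a b))
    (trans (sym (+-assoc 1ℚ (fromℕ a) (fromℕ b))) (cong (λ z → z + fromℕ b) (sym (fromℕ-suc a)))))

  -- One more digit takes v + 1 to at most 2v + 3 ≤ 4 (v + 1), and 64 rounds at least quadruple the
  -- price.
  val<P : ∀ ds → fromℕ (suc (val ds)) ≤ P (length ds ℕ.* 64)
  val<P []       = ≤-reflexive (sym P-zero)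
  val<P (e ∷ ds) = begin
    fromℕ (suc (dval e ℕ.+ 2 ℕ.* val ds))   ≤⟨ fromℕ-mono (ℕₚ.≤-trans (s≤s (ℕₚ.+-monoˡ-≤ (2 ℕ.* val ds) (dval≤2 e))) (ℕₚ.≤-trans (ℕₚ.m≤m+n _ (1 ℕ.+ 2 ℕ.* val ds)) (ℕₚ.≤-reflexive (l (val ds))))) ⟩
    fromℕ ((k ℕ.+ k) ℕ.+ (k ℕ.+ k))         ≡⟨ fromℕ-+ (k ℕ.+ k) (k ℕ.+ k) ⟩
    fromℕ (k ℕ.+ k) + fromℕ (k ℕ.+ k)       ≤⟨ +-mono-≤ twice twice ⟩
    P (32 ℕ.+ s) + P (32 ℕ.+ s)             ≤⟨ P-double (32 ℕ.+ s) ⟩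
    P (64 ℕ.+ s)                            ∎
    where
    open ≤-Reasoning
    k = suc (val ds)
    s = length ds ℕ.* 64
    dval≤2 : ∀ e → dval e ℕ.≤ 2
    dval≤2 true  = ℕₚ.≤-refl
    dval≤2 false = ℕₚ.n≤1+n 1
    l : ∀ v → suc (2 ℕ.+ 2 ℕ.* v) ℕ.+ (1 ℕ.+ 2 ℕ.* v) ≡ (suc v ℕ.+ suc v) ℕ.+ (suc v ℕ.+ suc v)
    l = solve-∀
    twice : fromℕ (k ℕ.+ k) ≤ P (32 ℕ.+ s)
    twice = ≤-trans (≤-reflexive (fromℕ-+ k k)) (≤-trans (+-mono-≤ (val<P ds) (val<P ds)) (P-double s))

  length-clock : ∀ k ds → length (clock k ds) ≡ suc (length ds ℕ.* k)
  length-clock k ds = trans (go ds (tt ∷ [])) (ℕₚ.+-comm (length ds ℕ.* k) 1)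
    where
    length-prepend : ∀ k ts → length (prepend k ts) ≡ k ℕ.+ length ts
    length-prepend zero    ts = refl
    length-prepend (suc k) ts = cong suc (length-prepend k ts)
    go : ∀ ds ts → length (fold (λ _ → prepend k) ds ts) ≡ length ds ℕ.* k ℕ.+ length ts
    go []       ts = refl
    go (_ ∷ ds) ts = trans (go ds (prepend k ts)) (trans (cong (λ z → length ds ℕ.* k ℕ.+ z) (length-prepend k ts))
      (l (length ds ℕ.* k) k (length ts)))
      where
      l : ∀ a k t → a ℕ.+ (k ℕ.+ t) ≡ k ℕ.+ a ℕ.+ t
      l = solve-∀

  value≤num : ∀ x → value x ≤ fromℕ (proj₁ x)
  value≤num (a , b) = ≤-trans (value-≤ a b a 0 (ℕₚ.*-monoʳ-≤ a (s≤s z≤n))) (≤-reflexive (value-whole a))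

  -- The membership excludes the empty list; the facility returned is the head, whose column
  -- `ceilingPrice` adds up.
  ceilingPrice-bound : ∀ I C {i₀} → i₀ ∈ C → ∃[ i ] (∀ j → d I i j + (F I i + ½ * sum {m I} (λ _ → 1ℚ)) ≤ value (ceilingPrice I C))
  ceilingPrice-bound I (i ∷ C) _ = i , λ j → begin
    d I i j + (F I i + W)                          ≤⟨ +-monoˡ-≤ (F I i + W) (term≤sum (0≤d I i) j) ⟩
    sum (d I i) + (F I i + W)                      ≡⟨ +-assoc (sum (d I i)) (F I i) W ⟨
    sum (d I i) + F I i + W                        ≡⟨ cong₂ _+_ column-value (waiting-value I (unassigned I)) ⟨
    value (sumᶠ (column I (i ∷ C))) + value (waiting I (unassigned I)) ≡⟨ value-+ᶠ (sumᶠ (column I (i ∷ C))) (waiting I (unassigned I)) ⟨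
    value (ceilingPrice I (i ∷ C))                 ∎
    where
    open ≤-Reasoning
    W = ½ * sum {m I} (λ _ → 1ℚ)
    column-value : value (sumᶠ (column I (i ∷ C))) ≡ sum (d I i) + F I i
    column-value = trans (value-fold (c I i) (f I i +ᶠ 0ᶠ)) (cong (λ z → sum (d I i) + z)
      (trans (value-+ᶠ (f I i) 0ᶠ) (trans (cong (λ z → F I i + z) value-0ᶠ) (+-identityʳ (F I i)))))

  module _ (I : Costs) where

    private
      a : Assignment I
      a = proj₂ (proj₂ (proj₂ (final I)))
      R = proj₁ (final I)

    open Invariant (final-correct I)

    -- If `j` were still unassigned, its term in the stability inequality of the last round at the
    -- head facility would give a price of at most `ceilingPrice`, while the schedule is long enough
    -- for the price to exceed it.
    all-assigned : Fin (n I) → ∀ j → ∃[ i ] ∃[ s ] a j ≡ just (i , s)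
    all-assigned i₀ j = go (a j) refl
      where
      num = proj₁ (ceilingPrice I (closed I))
      ds = bits num
      t = length ds ℕ.* 64
      R≡ : R ≡ suc t
      R≡ = trans (rounds-number I (schedule I (closed I)) (initial I (closed I))) (length-clock 64 ds)
      go : ∀ e → a j ≡ e → ∃[ i ] ∃[ s ] a j ≡ just (i , s)
      go (just (i , s)) eq = i , s , eq
      go nothing        eq = contradiction (begin-strict
        value (ceilingPrice I (closed I))                  ≤⟨ value≤num (ceilingPrice I (closed I)) ⟩
        fromℕ num                                          ≡⟨ cong fromℕ {x = val ds} {y = num} (val-bits num) ⟨
        fromℕ (val ds)                                     ≡⟨ +-identityˡ (fromℕ (val ds)) ⟨
        0ℚ + fromℕ (val ds)                                <⟨ +-monoˡ-< (fromℕ (val ds)) (positive⁻¹ 1ℚ) ⟩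
        1ℚ + fromℕ (val ds)                                ≡⟨ fromℕ-suc (val ds) ⟨
        fromℕ (suc (val ds))                               ≤⟨ val<P ds ⟩
        P t                                                ≤⟨ P-mono (ℕₚ.n≤1+n t) ⟩
        P (suc t)                                          ≡⟨ l (d I i j) (P (suc t)) ⟩
        d I i j + (P (suc t) - d I i j)                    ≤⟨ +-monoʳ-≤ (d I i j) (≤-trans (≤⁺ _) (≤-trans (≤-reflexive (cong (λ e → alive I (suc t) e · (P (suc t) - d I i j) ⁺) (sym eq)))
                                                               (term≤sum (λ j′ → 0≤· (alive I (suc t) (a j′)) (0≤⁺ _)) j))) ⟩
        d I i j + sum (λ j′ → alive I (suc t) (a j′) · (P (suc t) - d I i j′) ⁺) ≤⟨ +-monoʳ-≤ (d I i j) (stable t (ℕₚ.≤-reflexive (sym R≡)) i) ⟩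
        d I i j + (F I i + ½ * sum (λ j′ → alive I t (a j′) · 1ℚ)) ≤⟨ +-monoʳ-≤ (d I i j) (+-monoʳ-≤ (F I i) (*-monoˡ-≤-nonNeg ½ (sum-mono (λ j′ → ·≤ (alive I t (a j′)) (0≤-lit 1ℚ))))) ⟩
        d I i j + (F I i + ½ * sum {m I} (λ _ → 1ℚ))       ≤⟨ proj₂ bound j ⟩
        value (ceilingPrice I (closed I))                  ∎) (<-irrefl refl)
        where
        open ≤-Reasoning
        bound = ceilingPrice-bound I (closed I) {i₀} (reverse⁺ (∈-allFin i₀))
        i = proj₁ bound
        l : ∀ d p → p ≡ d + (p - d)
        l = solve 2 (λ d p → p := d :+ (p :- d)) refl

  -- From the final state to a solution and its cost

  IndexIs : ∀ {k} → Fin k → ℕ → List (Fin k) → Set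
  IndexIs i p xs = Σ (i ∈ xs) λ i∈xs → toℕ (index i∈xs) ≡ p

  index-prefix : ∀ {k} {i : Fin k} {p xs} ys → IndexIs i p xs → IndexIs i p (xs ++ ys)
  index-prefix ys (here refl , eq) = here refl , eq
  index-prefix ys (there i∈xs , refl) with index-prefix ys (i∈xs , refl)
  ... | i∈ , eq = there i∈ , cong suc eq

  index-last : ∀ {k} {i : Fin k} xs → IndexIs i (length xs) (xs ++ i ∷ [])
  index-last []       = here refl , refl
  index-last (_ ∷ xs) with index-last xs
  ... | i∈ , eq = there i∈ , cong suc eq

  -- The cost of a solution reads positions off membership proofs, so proof and index pass through
  -- the reversal together. `At` counts positions from 1, `index` from 0.
  At-reverse : ∀ {k} {i : Fin k} {O p} → At i O p → ∃[ q ] (p ≡ suc q × IndexIs i q (reverse O))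
  At-reverse {i = i} (here {O}) = length O , refl ,
    subst (IndexIs i (length O)) (sym (unfold-reverse i O)) (subst (λ l → IndexIs i l (reverse O ++ i ∷ [])) (length-reverse O) (index-last (reverse O)))
  At-reverse {i = i} (there {x} {O} at) with At-reverse at
  ... | q , eq , at′ = q , eq , subst (IndexIs i q) (sym (unfold-reverse x O)) (index-prefix (x ∷ []) at′)

  unique-prefix : ∀ {k} (xs : List (Fin k)) {ys} → Unique (xs ++ ys) → Unique xs
  unique-prefix []       u       = []
  unique-prefix (x ∷ xs) (p ∷ u) = Allₚ.++⁻ˡ xs p ∷ unique-prefix xs u

  total-↭ : ∀ {k} (F : Fin k → ℚ) {xs ys} → xs ↭ ys → total F xs ≡ total F ys
  total-↭ F Perm.refl         = refl
  total-↭ F (Perm.prep x p)   = cong (λ z → F x + z) (total-↭ F p)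
  total-↭ F (Perm.swap {xs} {ys} x y p) = trans (cong (λ z → F x + (F y + z)) (total-↭ F p)) (l (F x) (F y) (total F ys))
    where
    l : ∀ x y z → x + (y + z) ≡ y + (x + z)
    l = solve 3 (λ x y z → x :+ (y :+ z) := y :+ (x :+ z)) refl
  total-↭ F (Perm.trans p q)  = trans (total-↭ F p) (total-↭ F q)

  total-nonNeg : ∀ {k} {F : Fin k → ℚ} → (∀ i → 0ℚ ≤ F i) → ∀ xs → 0ℚ ≤ total F xs
  total-nonNeg 0≤F []       = ≤-refl
  total-nonNeg 0≤F (x ∷ xs) = 0≤+ (0≤F x) (total-nonNeg 0≤F xs)

  toFraction : ℚ → Fraction
  toFraction q = ℤ.∣ ↥ q ∣ , ℚ.denominator-1 q

  nonNeg-view : ∀ q → 0ℚ ≤ q → (value (toFraction q) ≡ q) × (fraction (toFraction q) ≡ ⌜ q ⌝ᵠ)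
  nonNeg-view (mkℚ (+ a) b c)    0≤q = value-mkℚ a b c , refl
  nonNeg-view (mkℚ -[1+ a ] b c) 0≤q = contradiction (nonNegative 0≤q) λ ()

  module _ {n m : ℕ} (J : Instance n m) where

    open Instance J renaming (f to fᴶ; c to cᴶ)

    costs : Costs
    costs = record { n = n ; m = m ; f = λ i → toFraction (fᴶ i) ; c = λ i j → toFraction (cᴶ i j) }

    encode-costs : encodeCosts costs ≡ encodeInstance J
    encode-costs = cong₂ Defs._∙_
      (cong listTree (map-cong (λ i → proj₂ (nonNeg-view (fᴶ i) (f≥0 i))) (allFin n)))
      (cong listTree (map-cong (λ j → cong listTree (map-cong (λ i → proj₂ (nonNeg-view (cᴶ i j) (c≥0 i j))) (allFin n))) (allFin m)))

    F≡ : ∀ i → F costs i ≡ fᴶ i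
    F≡ i = proj₁ (nonNeg-view (fᴶ i) (f≥0 i))

    d≡ : ∀ i j → d costs i j ≡ cᴶ i j
    d≡ i j = proj₁ (nonNeg-view (cᴶ i j) (c≥0 i j))

    -- `some` expresses that a client forces a facility to exist. It comes from feasibility of the
    -- linear program or from a given solution, and it also covers instances with neither facilities
    -- nor clients.
    module _ (metric : IsMetric J) (some : Fin m → Fin n) where

      private
        I = costs
        R = proj₁ (final I)
        O C : List (Fin n)
        O = proj₁ (proj₂ (final I))
        C = proj₁ (proj₂ (proj₂ (final I)))
        a : Assignment I
        a = proj₂ (proj₂ (proj₂ (final I)))
        inv : Invariant I R (proj₂ (final I))
        inv = final-correct I
        open Invariant inv
        open Ledger ledger

        server : Fin m → Fin n
        server j = proj₁ (all-assigned I (some j) j)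

        level : Fin m → ℕ
        level j = proj₁ (proj₂ (all-assigned I (some j) j))

        entry≡ : ∀ j → a j ≡ just (server j , level j)
        entry≡ j = proj₂ (proj₂ (all-assigned I (some j) j))

        level<R : ∀ j → level j ℕ.< R
        level<R j = proj₂ (proj₂ (placed j (server j) (level j) (entry≡ j)))

      outcome : Outcome fᴶ cᴶ
      outcome = record
        { F≥0      = f≥0
        ; c≥0      = c≥0
        ; triangle = triangle
        ; level    = level
        ; server   = server
        ; near     = λ l → subst (_≤ P (suc (level l))) (d≡ (server l) l) (proj₁ (proj₂ (placed l (server l) (level l) (entry≡ l))))
        ; blocked  = λ l j s l≤s j≡ → subst (P (suc s) ≤_) (d≡ (server l) j)
            (blocked l (server l) (level l) (entry≡ l) s l≤s (ℕₚ.≤-trans (ℕₚ.n≤1+n _) (subst (ℕ._< R) j≡ (level<R j))) j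
              (trans (cong (alive I (suc s)) (entry≡ j)) (≤ᵇ-true (ℕₚ.≤-reflexive (sym j≡)))))
        ; stable   = λ l s l≡ i → subst₂ _≤_
            (sum-cong-≗ (λ j → cong₂ (λ e z → e · (P (suc s) - z) ⁺) (cong (alive I (suc s)) (entry≡ j)) (d≡ i j)))
            (cong₂ (λ x y → x + ½ * y) (F≡ i) (sum-cong-≗ (λ j → cong (λ e → e · 1ℚ) (cong (alive I s) (entry≡ j)))))
            (stable s (ℕₚ.≤-trans (ℕₚ.n≤1+n _) (subst (ℕ._< R) l≡ (level<R l))) i)
        }
        where
        open IsMetric metric renaming (d to D)
        triangle : ∀ i k j l → cᴶ i j ≤ cᴶ i l + cᴶ k l + cᴶ k j
        triangle i k j l = begin
          cᴶ i j                                                   ≡⟨ d-extends i j ⟨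
          D (inj₁ i) (inj₂ j)                                      ≤⟨ d-triangle (inj₁ i) (inj₂ l) (inj₂ j) ⟩
          D (inj₁ i) (inj₂ l) + D (inj₂ l) (inj₂ j)                ≤⟨ +-monoʳ-≤ (D (inj₁ i) (inj₂ l)) (d-triangle (inj₂ l) (inj₁ k) (inj₂ j)) ⟩
          D (inj₁ i) (inj₂ l) + (D (inj₂ l) (inj₁ k) + D (inj₁ k) (inj₂ j)) ≡⟨ +-assoc (D (inj₁ i) (inj₂ l)) (D (inj₂ l) (inj₁ k)) (D (inj₁ k) (inj₂ j)) ⟨
          D (inj₁ i) (inj₂ l) + D (inj₂ l) (inj₁ k) + D (inj₁ k) (inj₂ j) ≡⟨ cong₂ _+_ (cong₂ _+_ (d-extends i l) (trans (d-sym (inj₂ l) (inj₁ k)) (d-extends k l))) (d-extends k j) ⟩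
          cᴶ i l + cᴶ k l + cᴶ k j                                 ∎
          where open ≤-Reasoning

      private
        opened : ∀ j → ∃[ q ] (position j ≡ suc q × IndexIs (server j) q (reverse O))
        opened j = At-reverse (proj₁ (placed j (server j) (level j) (entry≡ j)))

      solution : Solution n m
      solution = record
        { path   = reverse O
        ; unique = unique-prefix (reverse O) (SetoidPerm.Unique-resp-↭ (setoid (Fin n))
            (↭⇒↭ₛ (↭-sym (↭-trans (++⁺ʳ C (↭-reverse O)) sites-↭))) (allFin⁺ n))
        ; φ      = server
        ; φ-open = λ j → proj₁ (proj₂ (proj₂ (opened j)))
        }

      output-solution : output I (final I) ≡ encodeSolution solution
      output-solution = cong (Defs._∙_ (listTree (map (λ i → ⌜ toℕ i ⌝ⁿ) (reverse O))))
        (cong listTree (map-cong (λ j → cong (left ∘ entry I) (entry≡ j)) (allFin m)))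

      -- The ledger books waiting at one half, so doubling all payments pays the full time. A
      -- payment is 33/32 times the price preceding it, whence 2 · 33/32.
      solution-cost : cost J solution ≤ + 33 / 16 * volume J outcome
      solution-cost = begin
        total fᴶ (reverse O) + sum (λ j → cᴶ (server j) j + fromℕ (Solution.π∘φ solution j))
          ≡⟨ cong₂ _+_ (trans (total-↭ fᴶ (↭-reverse O)) (total-cong O))
                       (sum-cong-≗ (λ j → cong₂ _+_ (sym (d≡ (server j) j)) (cong fromℕ (trans (cong suc (proj₂ (proj₂ (proj₂ (opened j))))) (sym (proj₁ (proj₂ (opened j)))))))) ⟩
        total (F I) O + sum (λ j → d I (server j) j + fromℕ (position j))
          ≤⟨ +-mono-≤ (double₁ (total-nonNeg (0≤F I) O)) (sum-mono (λ j → double₂ (fromℕ (position j)) (0≤d I (server j) j))) ⟩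
        + 2 / 1 * total (F I) O + sum (λ j → + 2 / 1 * (d I (server j) j + ½ * fromℕ (position j)))
          ≡⟨ cong (λ z → + 2 / 1 * total (F I) O + z) (trans (sum-*ˡ (+ 2 / 1) (λ j → d I (server j) j + ½ * fromℕ (position j)))
               (cong (λ z → + 2 / 1 * z) (sum-cong-≗ (λ j → cong (clientCost I (length O) (position j) j) (sym (entry≡ j)))))) ⟩
        + 2 / 1 * total (F I) O + + 2 / 1 * sum (λ j → clientCost I (length O) (position j) j (a j))
          ≡⟨ *-distribˡ-+ (+ 2 / 1) (total (F I) O) _ ⟨
        + 2 / 1 * (total (F I) O + sum (λ j → clientCost I (length O) (position j) j (a j)))
          ≤⟨ *-monoˡ-≤-nonNeg (+ 2 / 1) paid ⟩
        + 2 / 1 * sum (λ j → payment I (a j))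
          ≡⟨ cong (λ z → + 2 / 1 * z) (trans (sum-cong-≗ (λ j → trans (cong (payment I) (entry≡ j)) (P-suc (level j)))) (sum-*ˡ (+ 33 / 32) (λ j → P (level j)))) ⟩
        + 2 / 1 * (+ 33 / 32 * volume J outcome)
          ≡⟨ l₃ (volume J outcome) ⟩
        + 33 / 16 * volume J outcome ∎
        where
        open ≤-Reasoning
        total-cong : ∀ xs → total fᴶ xs ≡ total (F I) xs
        total-cong xs = cong (foldr _+_ 0ℚ) (map-cong (λ i → sym (F≡ i)) xs)
        double₁ : ∀ {t} → 0ℚ ≤ t → t ≤ + 2 / 1 * t
        double₁ {t} = by-difference t (l t)
          where
          l : ∀ t → + 2 / 1 * t - t ≡ t
          l = solve 1 (λ t → con (+ 2 / 1) :* t :- t := t) refl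
        double₂ : ∀ {c} p → 0ℚ ≤ c → c + p ≤ + 2 / 1 * (c + ½ * p)
        double₂ {c} p = by-difference c (l c p)
          where
          l : ∀ c p → + 2 / 1 * (c + ½ * p) - (c + p) ≡ c
          l = solve 2 (λ c p → con (+ 2 / 1) :* (c :+ con ½ :* p) :- (c :+ p) := c) refl
        l₃ : ∀ v → + 2 / 1 * (+ 33 / 32 * v) ≡ + 33 / 16 * v
        l₃ = solve 1 (λ v → con (+ 2 / 1) :* (con (+ 33 / 32) :* v) := con (+ 33 / 16) :* v) refl

      volume-nonNeg : 0ℚ ≤ volume J outcome
      volume-nonNeg = sum-nonNeg (λ j → 0≤P (level j))

-- Lower bound on the ratio and the final guarantees

module Guarantees where

  open import Defs hiding (_^_; _:=_)
  open Programs using (⟦_⟧; con; _⊕_; degree; coefficient; ⟦⟧-monomial; 1≤size; _⇒_; algorithm; program; output; final; standalone-runs)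
  open Values
  open Duality
  open Rounds
  open import Data.Fin using (Fin; zero; suc)
  open import Data.Integer as ℤ using (+_)
  import Data.Integer.Properties as ℤₚ
  open import Data.Nat as ℕ using (ℕ; zero; suc; _⊔_)
  import Data.Nat.Properties as ℕₚ
  open import Data.Product using (∃-syntax; _×_; _,_; proj₁; proj₂)
  open import Data.Rational as ℚ using (ℚ; 0ℚ; 1ℚ; _+_; _*_; _-_; -_; _≤_; _<_; _/_; _≤?_; _<?_; positive; nonNegative; ≢-nonZero)
  open import Data.Rational.Properties hiding (_≤?_; _<?_)
  open import Data.Rational.Solver using (module +-*-Solver)
  open import Data.Rational.Unnormalised as ℚᵘ using (mkℚᵘ)
  import Data.Rational.Unnormalised.Properties as ℚᵘₚ
  open import Data.Sum using (inj₁; inj₂)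
  open import Data.Unit using (tt)
  open import Relation.Binary.PropositionalEquality hiding ([_])
  open import Relation.Nullary using (yes; no; ¬_)
  open import Relation.Nullary.Decidable using (toWitness)
  open import Relation.Nullary.Negation using (contradiction)
  open +-*-Solver using (solve; _:+_; _:*_; _:-_; _:=_) renaming (con to lit)

  ÷₀-cancel : ∀ p {q} → 0ℚ < q → (p ÷₀ q) * q ≡ p
  ÷₀-cancel p {q} 0<q with q ≟ 0ℚ
  ... | yes refl = contradiction 0<q (<-irrefl refl)
  ... | no  q≢0  = trans (*-assoc p (1/q) q) (trans (cong (p *_) (*-inverseˡ q {{≢-nonZero q≢0}})) (*-identityʳ p))
    where
    1/q = ℚ.1/_ q {{≢-nonZero q≢0}}

  ≤÷₀ : ∀ x p {q} → 0ℚ < q → x * q ≤ p → x ≤ p ÷₀ q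
  ≤÷₀ x p {q} 0<q xq≤p = *-cancelʳ-≤-pos q {{positive 0<q}} (≤-trans xq≤p (≤-reflexive (sym (÷₀-cancel p 0<q))))

  ÷₀≤ : ∀ x p {q} → 0ℚ < q → p ÷₀ q ≤ x → p ≤ x * q
  ÷₀≤ x p {q} 0<q p/q≤x = ≤-trans (≤-reflexive (sym (÷₀-cancel p 0<q))) (*-monoʳ-≤-nonNeg q {{nonNegative (<⇒≤ 0<q)}} p/q≤x)

  /1-mono : ∀ {j k} → j ℤ.≤ k → j / 1 ≤ k / 1
  /1-mono {j} {k} j≤k = toℚᵘ-cancel-≤ (ℚᵘₚ.≤-respˡ-≃ (ℚᵘₚ.≃-sym (toℚᵘ-fromℚᵘ (mkℚᵘ j 0)))
    (ℚᵘₚ.≤-respʳ-≃ (ℚᵘₚ.≃-sym (toℚᵘ-fromℚᵘ (mkℚᵘ k 0))) (ℚᵘ.*≤* (ℤₚ.*-monoʳ-≤-nonNeg (+ 1) j≤k))))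

  -- Otherwise the ceiling is at most 1. Taking for the tolerance the gap ε between α and 1, a late
  -- term a of α satisfies 1 ≤ (1 + ε) a ≤ (1 + ε) (1 - ε) < 1.
  2≤ceiling : ∀ α k → const 0ℚ <ʳ α → α <ʳ const 1ℚ → IsCeiling k (const 1ℚ ÷ʳ α) → + 2 / 1 ≤ k / 1
  2≤ceiling α k (ε₀ , 0<ε₀ , N₀ , α>0) (ε , 0<ε , N₁ , α<1) (1/α≤k , _) with ℤₚ.≤-total (+ 2) k
  ... | inj₁ 2≤k = /1-mono 2≤k
  ... | inj₂ k≤2 with ℤₚ._≟_ k (+ 2)
  ...   | yes refl = ≤-refl
  ...   | no  k≢2  = contradiction (begin-strict
    1ℚ                             ≤⟨ ÷₀≤ (k / 1 + ε) 1ℚ 0<a (below N N₂≤N) ⟩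
    (k / 1 + ε) * a                ≤⟨ *-monoʳ-≤-nonNeg a {{nonNegative (<⇒≤ 0<a)}} (+-monoˡ-≤ ε (/1-mono {k} {+ 1} (ℤₚ.i<j⇒i≤pred[j] (ℤₚ.≤∧≢⇒< k≤2 k≢2)))) ⟩
    (1ℚ + ε) * a                   ≤⟨ *-monoˡ-≤-nonNeg (1ℚ + ε) {{nonNegative (0≤+ (0≤-lit 1ℚ) (<⇒≤ 0<ε))}} a≤ ⟩
    (1ℚ + ε) * (1ℚ - ε)            ≡⟨ l₁ ε ⟩
    1ℚ - ε * ε                     <⟨ +-monoʳ-< 1ℚ (neg-antimono-< (subst (_< ε * ε) (*-zeroʳ ε) (*-monoʳ-<-pos ε {{positive 0<ε}} 0<ε))) ⟩
    1ℚ - 0ℚ                        ≡⟨⟩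
    1ℚ                             ∎) (<-irrefl refl)
    where
    open ≤-Reasoning
    N₂ = proj₁ (1/α≤k ε 0<ε)
    below = proj₂ (1/α≤k ε 0<ε)
    N = N₀ ⊔ N₁ ⊔ N₂
    N₂≤N : N₂ ℕ.≤ N
    N₂≤N = ℕₚ.m≤n⊔m (N₀ ⊔ N₁) N₂
    a = α N
    0<a : 0ℚ < a
    0<a = <-≤-trans 0<ε₀ (≤-trans (≤-reflexive (sym (+-identityˡ ε₀))) (α>0 N (ℕₚ.≤-trans (ℕₚ.m≤m⊔n N₀ N₁) (ℕₚ.m≤m⊔n (N₀ ⊔ N₁) N₂))))
    a≤ : a ≤ 1ℚ - ε
    a≤ = ≤-trans (≤-reflexive (l₂ a ε)) (+-monoˡ-≤ (- ε) (α<1 N (ℕₚ.≤-trans (ℕₚ.m≤n⊔m N₀ N₁) (ℕₚ.m≤m⊔n (N₀ ⊔ N₁) N₂))))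
      where
      l₂ : ∀ a e → a ≡ a + e - e
      l₂ = solve 2 (λ a e → a := a :+ e :- e) refl
    l₁ : ∀ e → (1ℚ + e) * (1ℚ - e) ≡ 1ℚ - e * e
    l₁ = solve 1 (λ e → (lit 1ℚ :+ e) :* (lit 1ℚ :- e) := lit 1ℚ :- e :* e) refl

  -- If α ≤ 3/4 then already 4/α ⌈1/α⌉ ≥ (16/3) 2, and otherwise
  -- 3/(1-β) + 2/(1-α) ≥ 3 + 8.
  ratio-bound : ∀ α β k → const 0ℚ <ʳ α → α <ʳ const 1ℚ → const 0ℚ <ʳ β → β <ʳ const 1ℚ → IsCeiling k (const 1ℚ ÷ʳ α) →
                ∃[ N ] (∀ i → N ℕ.≤ i → + 32 / 3 ≤ ratio α β k i)
  ratio-bound α β k 0<α@(ε₀ , 0<ε₀ , N₀ , α>0) α<1@(ε₁ , 0<ε₁ , N₁ , α<) (ε₂ , 0<ε₂ , N₂ , β>0) (ε₃ , 0<ε₃ , N₃ , β<) k-ceil =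
    (N₀ ⊔ N₁) ⊔ (N₂ ⊔ N₃) , λ i N≤i → at i
      (ℕₚ.≤-trans (ℕₚ.m≤m⊔n N₀ N₁) (ℕₚ.≤-trans (ℕₚ.m≤m⊔n (N₀ ⊔ N₁) (N₂ ⊔ N₃)) N≤i))
      (ℕₚ.≤-trans (ℕₚ.m≤n⊔m N₀ N₁) (ℕₚ.≤-trans (ℕₚ.m≤m⊔n (N₀ ⊔ N₁) (N₂ ⊔ N₃)) N≤i))
      (ℕₚ.≤-trans (ℕₚ.m≤m⊔n N₂ N₃) (ℕₚ.≤-trans (ℕₚ.m≤n⊔m (N₀ ⊔ N₁) (N₂ ⊔ N₃)) N≤i))
      (ℕₚ.≤-trans (ℕₚ.m≤n⊔m N₂ N₃) (ℕₚ.≤-trans (ℕₚ.m≤n⊔m (N₀ ⊔ N₁) (N₂ ⊔ N₃)) N≤i))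
    where
    above : ∀ {ε x} → 0ℚ < ε → 0ℚ + ε ≤ x → 0ℚ < x
    above {ε} 0<ε p = <-≤-trans 0<ε (≤-trans (≤-reflexive (sym (+-identityˡ ε))) p)
    gap : ∀ {ε} x → 0ℚ < ε → x + ε ≤ 1ℚ → 0ℚ < 1ℚ - x
    gap {ε} x 0<ε p = <-≤-trans 0<ε (by-difference (1ℚ - (x + ε)) (l x ε) (0≤- p))
      where
      l : ∀ x e → 1ℚ - x - e ≡ 1ℚ - (x + e)
      l = solve 2 (λ x e → lit 1ℚ :- x :- e := lit 1ℚ :- (x :+ e)) refl
    at : ∀ i → N₀ ℕ.≤ i → N₁ ℕ.≤ i → N₂ ℕ.≤ i → N₃ ℕ.≤ i → + 32 / 3 ≤ ratio α β k i
    at i i₀ i₁ i₂ i₃ with ≤-total (α i) (+ 3 / 4)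
    ... | inj₁ α≤¾ = ≤-trans third (p≤q⊔p (first ℚ.⊔ second′) third′)
      where
      first = (ln (const 1ℚ ÷ʳ β) ÷ʳ (const 1ℚ -ʳ β)) i
      second′ = (fromℕ 3 ÷₀ (1ℚ - β i)) + (fromℕ 2 ÷₀ (1ℚ - α i))
      third′ = (fromℕ 4 ÷₀ α i) * (k / 1)
      third : + 32 / 3 ≤ third′
      third = ≤-trans (*-monoˡ-≤-nonNeg (+ 16 / 3) (2≤ceiling α k 0<α α<1 k-ceil))
        (*-monoʳ-≤-nonNeg (k / 1) {{nonNegative (≤-trans (0≤-lit (+ 2 / 1)) (2≤ceiling α k 0<α α<1 k-ceil))}}
          (≤÷₀ (+ 16 / 3) (fromℕ 4) (above 0<ε₀ (α>0 i i₀)) (*-monoˡ-≤-nonNeg (+ 16 / 3) α≤¾)))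
    ... | inj₂ ¾≤α = ≤-trans second (≤-trans (p≤q⊔p first second′) (p≤p⊔q (first ℚ.⊔ second′) third′))
      where
      first = (ln (const 1ℚ ÷ʳ β) ÷ʳ (const 1ℚ -ʳ β)) i
      second′ = (fromℕ 3 ÷₀ (1ℚ - β i)) + (fromℕ 2 ÷₀ (1ℚ - α i))
      third′ = (fromℕ 4 ÷₀ α i) * (k / 1)
      second : + 32 / 3 ≤ second′
      second = ≤-trans (toWitness {a? = + 32 / 3 ≤? fromℕ 3 + fromℕ 8} tt) (+-mono-≤
        (≤÷₀ (fromℕ 3) (fromℕ 3) (gap (β i) 0<ε₃ (β< i i₃)) (by-difference (fromℕ 3 * β i) (l₁ (β i)) (0≤* (0≤-lit (fromℕ 3)) (<⇒≤ (above 0<ε₂ (β>0 i i₂))))))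
        (≤÷₀ (fromℕ 8) (fromℕ 2) (gap (α i) 0<ε₁ (α< i i₁)) (by-difference (fromℕ 8 * (α i - + 3 / 4)) (l₂ (α i)) (0≤* (0≤-lit (fromℕ 8)) (0≤- ¾≤α)))))
        where
        l₁ : ∀ b → fromℕ 3 - fromℕ 3 * (1ℚ - b) ≡ fromℕ 3 * b
        l₁ = solve 1 (λ b → lit (fromℕ 3) :- lit (fromℕ 3) :* (lit 1ℚ :- b) := lit (fromℕ 3) :* b) refl
        l₂ : ∀ a → fromℕ 2 - fromℕ 8 * (1ℚ - a) ≡ fromℕ 8 * (a - + 3 / 4)
        l₂ = solve 1 (λ a → lit (fromℕ 2) :- lit (fromℕ 8) :* (lit 1ℚ :- a) := lit (fromℕ 8) :* (a :- lit (+ 3 / 4))) refl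

  const-< : ∀ {p q} → p < q → const p <ʳ const q
  const-< {p} {q} p<q = q - p , 0<q-p , 0 , λ _ _ → ≤-reflexive (l p q)
    where
    l : ∀ p q → p + (q - p) ≡ q
    l = solve 2 (λ p q → p :+ (q :- p) := q) refl
    0<q-p : 0ℚ < q - p
    0<q-p = subst (_< q - p) (+-inverseʳ p) (+-monoˡ-< (- p) p<q)

  module _ {n m : ℕ} (J : Instance n m) (metric : IsMetric J) where

    runs : ∃[ t ] (Runs program (encodeInstance J) t (output (costs J) (final (costs J))) ×
                   t ℕ.≤ ⟦ con 9 ⊕ _⇒_.time algorithm ⟧ (size (encodeInstance J)))
    runs = subst (λ x → ∃[ t ] (Runs program x t (output (costs J) (final (costs J))) × t ℕ.≤ ⟦ con 9 ⊕ _⇒_.time algorithm ⟧ (size x)))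
      (encode-costs J) (standalone-runs algorithm (costs J))

    returns : ∀ some → Returns program J (solution J metric some)
    returns some = subst (λ x → ∃[ t ] Runs program (encodeInstance J) t x) (output-solution J metric some)
      (proj₁ runs , proj₁ (proj₂ runs))

    -- The constant is the quotient of 33/16 and 31/160. Nonnegativity of `v` is returned as well,
    -- since enlarging the ratio later depends on it.
    cost-bound : ∀ some {v} → + 31 / 160 * volume J (outcome J metric some) ≤ v → cost J (solution J metric some) ≤ + 330 / 31 * v × 0ℚ ≤ v
    cost-bound some {v} lower =
      ≤-trans (solution-cost J metric some) (≤-trans (≤-reflexive (l V)) (*-monoˡ-≤-nonNeg (+ 330 / 31) lower)) ,
      ≤-trans (0≤* (0≤-lit (+ 31 / 160)) (volume-nonNeg J metric some)) lower
      where
      V = volume J (outcome J metric some)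
      l : ∀ v → + 33 / 16 * v ≡ + 330 / 31 * (+ 31 / 160 * v)
      l = solve 1 (λ v → lit (+ 33 / 16) :* v := lit (+ 330 / 31) :* (lit (+ 31 / 160) :* v)) refl

  weaken-ratio : ∀ {x v} ρ → x ≤ + 330 / 31 * v × 0ℚ ≤ v → + 330 / 31 ≤ ρ → x ≤ ρ * v
  weaken-ratio {x} {v} ρ (p , 0≤v) q = ≤-trans p (*-monoʳ-≤-nonNeg v {{nonNegative 0≤v}} q)

  polynomial-time : RunsInPolyTime program
  polynomial-time = coefficient p , degree p , λ J metric →
    let (t , r , t≤) = runs J metric in
    t , _ , r , ℕₚ.≤-trans t≤ (⟦⟧-monomial p (size (encodeInstance J)) (1≤size (encodeInstance J)))
    where
    p = con 9 ⊕ _⇒_.time algorithm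

  -- Without facilities the covering constraint of a client would read 1 ≤ 0.
  feasible⇒facility : ∀ {n m} (J : Instance n m) {x y} → Feasible J x y → Fin m → Fin n
  feasible⇒facility {zero}  J feasible j = contradiction (Feasible.covered feasible j) (<⇒≱′ (toWitness {a? = 0ℚ <? 1ℚ} tt))
    where
    <⇒≱′ : ∀ {p q} → p < q → ¬ (q ≤ p)
    <⇒≱′ p<q q≤p = <-irrefl refl (<-≤-trans p<q q≤p)
  feasible⇒facility {suc n} J feasible j = zero

  -- `≤ʳ` compares late terms, so it is enough that `ρ` eventually stays above 32/3; the same
  -- program therefore serves every choice of the parameters.
  achieves : ∀ ρ → ∃[ N ] (∀ i → N ℕ.≤ i → + 32 / 3 ≤ ρ i) → AchievesLPRatio program ρ
  achieves ρ (N , large) J metric OPT ((x , y , feasible , refl) , _) =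
    solution J metric some , returns J metric some , λ ε 0<ε → N , λ i N≤i →
      ≤-trans (weaken-ratio (ρ i) bound (≤-trans (toWitness {a? = + 330 / 31 ≤? + 32 / 3} tt) (large i N≤i)))
        (≤-trans (≤-reflexive (sym (+-identityʳ (ρ i * objective J x y)))) (+-monoʳ-≤ (ρ i * objective J x y) (<⇒≤ 0<ε)))
    where
    some = feasible⇒facility J feasible
    bound = cost-bound J metric some (lp-bound J (outcome J metric some) feasible)

  approximates : ∀ ρ → + 330 / 31 ≤ ρ → IsApproximationAlgorithm ρ program
  approximates ρ large = polynomial-time , λ J metric S* _ →
    let some = Solution.φ S* in
    solution J metric some , returns J metric some ,
    weaken-ratio ρ (cost-bound J metric some (integral-bound J (outcome J metric some) S*)) large

open import Defs
open import Data.Integer using (+_)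
open import Data.Rational using (0ℚ; 1ℚ; _/_)
open import Data.Product using (∃-syntax; _×_; _,_)
open import Data.Rational.Properties using (_<?_; _≤?_)
open import Data.Unit using (tt)
open import Relation.Nullary.Decidable using (toWitness)
open Programs using (program)
open Guarantees using (polynomial-time; achieves; approximates; ratio-bound; const-<)

theorem2p14 : (∀ α β → IsCauchy α → IsCauchy β →
    const 0ℚ <ʳ α → α <ʳ const 1ℚ →
    const 0ℚ <ʳ β → β <ʳ const 1ℚ →
    ∀ k → IsCeiling k (const 1ℚ ÷ʳ α) →
    ∃[ P ] (RunsInPolyTime P × AchievesLPRatio P (ratio α β k)))
    ×
    (∃[ P ] ((∀ k → IsCeiling k (const 1ℚ ÷ʳ const (+ 7426 / 10000)) →
    AchievesLPRatio P (ratio (const (+ 7426 / 10000)) (const (+ 21 / 1000000)) k))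
    × IsApproximationAlgorithm (+ 10773 / 1000) P))
theorem2p14 =
  (λ α β _ _ 0<α α<1 0<β β<1 k k-ceil →
    program , polynomial-time , achieves (ratio α β k) (ratio-bound α β k 0<α α<1 0<β β<1 k-ceil)) ,
  program ,
  (λ k k-ceil → achieves _ (ratio-bound (const (+ 7426 / 10000)) (const (+ 21 / 1000000)) k
    (const-< (toWitness {a? = 0ℚ <? + 7426 / 10000} tt)) (const-< (toWitness {a? = + 7426 / 10000 <? 1ℚ} tt))
    (const-< (toWitness {a? = 0ℚ <? + 21 / 1000000} tt)) (const-< (toWitness {a? = + 21 / 1000000 <? 1ℚ} tt)) k-ceil)) ,
  approximates (+ 10773 / 1000) (toWitness {a? = + 330 / 31 ≤? + 10773 / 1000} tt)
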